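{- Let $\mathfrak{P}$ be the class of permutations, i.e. of finite sets equipped with two total orders $<$ and $\prec$. There exist thirty-seven $\mathbf{Z}$-valued measures $\mu_1,\dots,\mu_{37}$ on $\mathfrak{P}$, and together they define a ring isomorphism $$\Theta(\mathfrak{P}) \to \mathbf{Z}^{37},\qquad [i]\mapsto (\mu_1(i),\dots,\mu_{37}(i)),$$ where $\Theta(\mathfrak{P})$ is the ring carrying the universal measure on $\mathfrak{P}$. Explicitly, write $\mu(X,x)$ for the value of $\mu$ on the inclusion $X\setminus\{x\}\to X$, and write a marked permutation $(X,x)$ as a word with a dot over the marked element. The thirty-seven measures are determined by their values on the ten marked permutations $$\dot 1,\quad \dot 1 2,\quad 1\dot 2,\quad 2\dot 1,\quad \dot 2 1,\quad 13\dot 2,\quad 1\dot 3 2,\quad \dot 2 3 1,\quad 2\dot 3 1,\quad 21\dot 3 54,$$ and the value vectors, in this order, are: 1: $(0,0,0,-1,0,-1,0,0,0,0)$; 2: $(0,0,0,0,-1,-1,0,0,0,0)$; 3: $(0,0,0,-1,0,0,-1,0,0,0)$; 4: $(0,0,0,0,-1,0,-1,0,0,0)$; 5: $(0,-1,0,0,0,0,0,-1,0,0)$; 6: $(0,0,-1,0,0,0,0,-1,0,0)$; 7: $(0,-1,0,0,0,0,0,0,-1,0)$; 8: $(0,0,-1,0,0,0,0,0,-1,0)$; 9: $(0,-1,0,0,0,0,0,0,0,-1)$; 10: $(0,0,-1,0,0,0,0,0,0,-1)$; 11: $(0,0,0,-1,0,0,0,0,0,-1)$; 12: $(0,0,0,0,-1,0,0,0,0,-1)$;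 13: $(0,0,0,-1,0,-1,-1,0,0,1)$; 14: $(0,0,0,0,-1,-1,-1,0,0,1)$; 15: $(0,-1,0,0,0,0,0,-1,-1,1)$; 16: $(0,0,-1,0,0,0,0,-1,-1,1)$; 17: $(0,1,0,-1,-1,-1,-1,0,0,1)$; 18: $(0,0,1,-1,-1,-1,-1,0,0,1)$; 19: $(0,-1,-1,1,0,0,0,-1,-1,1)$; 20: $(0,-1,-1,0,1,0,0,-1,-1,1)$; 21: $(1,0,0,0,0,-1,0,0,0,0)$; 22: $(1,0,0,0,0,0,-1,0,0,0)$; 23: $(1,0,0,0,0,0,0,-1,0,0)$; 24: $(1,0,0,0,0,0,0,0,-1,0)$; 25: $(1,0,0,0,0,0,0,0,0,-1)$; 26: $(1,0,0,0,0,-1,-1,0,0,1)$; 27: $(1,0,0,0,0,0,0,-1,-1,1)$; 28: $(-1,-1,-1,0,0,0,0,-1,0,0)$; 29: $(-1,-1,-1,0,0,0,0,0,-1,0)$; 30: $(-1,-1,-1,0,0,0,0,0,0,-1)$; 31: $(-1,-1,-1,0,0,0,0,-1,-1,1)$; 32: $(-1,0,0,-1,-1,-1,0,0,0,0)$; 33: $(-1,0,0,-1,-1,0,-1,0,0,0)$; 34: $(-1,0,0,-1,-1,0,0,0,0,-1)$; 35: $(-1,0,0,-1,-1,-1,-1,0,0,1)$; 36: $(1,1,1,-1,-1,-1,-1,0,0,1)$; 37: $(1,-1,-1,1,1,0,0,-1,-1,1)$.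
   Context: A permutation is a finite (possibly empty) set equipped with two total orders $<$ and $\prec$. An embedding of permutations is an injective map that preserves both orders. A permutation is denoted by a sequence of distinct numbers: $<$ is the usual order on numbers, and $\prec$ is the order of appearance in the sequence. For instance $3142$ is the permutation on $\{1,2,3,4\}$ with $1<2<3<4$ and $3\prec 1\prec 4\prec 2$. A marked permutation is a pair $(X,x)$ with $X$ a permutation and $x\in X$. Given embeddings $i\colon Y\to X$ and $j\colon Y\to Y'$ of permutations, an amalgamation is a permutation $X'$ with embeddings $i'\colon Y'\to X'$ and $j'\colon X\to X'$ such that $i'\circ j=j'\circ i$ and $i',j'$ are jointly surjective. Amalgamations are considered up to isomorphism, meaning isomorphisms of $X'$ compatible with $i'$ and $j'$. There are finitely many of them. A measure on $\mathfrak{P}$ valued in a commutative ring $k$ is a rule $\mu$ assigning to each embedding $i\colon Y\to X$ of permutations a value $\mu(i)\in k$ such that: (a) $\mu(i)=1$ if $i$ is an isomorphism; (b) $\mu(j\circ i)=\mu(j)\mu(i)$ whenever the composition is defined; (c) if $i\colon Y\to X$ and $j\colon Y\to Y'$ are embeddings and $(X'_\alpha,i'_\alpha,j'_\alpha)$, $1\le\alpha\le n$, are all the amalgamations up to isomorphism, then $\mu(i)=\sum_{\alpha=1}^n\mu(i'_\alpha)$. The ring $\Theta(\mathfrak{P})$ is the quotient of the polynomial ring over $\mathbf{Z}$ in formal symbols $[i]$, one for each embedding $i$ of permutations, by the ideal generated by the relations corresponding to (a), (b), (c), with $[i]$ in place of $\mu(i)$. Thus $k$-valued measures on $\mathfrak{P}$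 correspond bijectively to ring homomorphisms $\Theta(\mathfrak{P})\to k$. -}

module Defs where

open import Algebra.Bundles using (CommutativeRing)
import Algebra.Construct.Pointwise as Pointwise
import Algebra.Definitions.RawMonoid as RawMonoidDefinitions
import Algebra.Properties.AbelianGroup as AbelianGroupProperties
import Algebra.Properties.CommutativeSemigroup as CommutativeSemigroupProperties
import Algebra.Properties.Ring as RingProperties
open import Data.Fin using (Fin; zero; suc; punchIn; punchOut)
import Data.Fin as Fin
import Data.Fin.Properties as Fin
open import Data.Integer using (ℤ; 0ℤ; 1ℤ; -1ℤ)
import Data.Integer as ℤ
import Data.Integer.Properties as ℤ
open import Data.Nat using (ℕ; zero; suc)
import Data.Nat as ℕ
import Data.Nat.Properties as ℕ
open import Data.Product using (Σ; ∃; _×_; _,_; proj₁)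
open import Data.Sum using (_⊎_)
open import Data.Vec using (Vec; []; _∷_; lookup)
import Data.Vec.Relation.Unary.AllPairs as AllPairs
open import Data.Vec.Relation.Unary.Unique.Propositional using (Unique)
open import Data.Vec.Relation.Unary.Unique.Propositional.Properties using (lookup-injective)
open import Function using (Injective; _↔_; Inverse; mk↔ₛ′; _∘_; _on_)
open import Level using (Level; 0ℓ; _⊔_)
import Level
open import Relation.Binary using (Rel; Setoid; IsStrictTotalOrder; tri<; tri≈; tri>)
open import Relation.Binary.PropositionalEquality
  using (_≡_; _≢_; _≗_; refl; sym; trans; cong; subst)
import Relation.Binary.Reasoning.Setoid as SetoidReasoning
open import Relation.Nullary using (contradiction)
open import Relation.Nullary.Decidable using (True; toWitness; ¬?)
open import Relation.Unary using (Pred)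

private
  variable
    a c ℓ s : Level

record Permutation : Set₁ where
  infix 4 _<_ _≺_
  field
    Carrier              : Set
    size                 : ℕ
    enumeration          : Carrier ↔ Fin size
    _<_ _≺_              : Rel Carrier 0ℓ
    <-isStrictTotalOrder : IsStrictTotalOrder _≡_ _<_
    ≺-isStrictTotalOrder : IsStrictTotalOrder _≡_ _≺_

open Permutation using (Carrier)

private
  variable
    X Y Z Y′ : Permutation

record Embedding (Y X : Permutation) : Set where
  private
    module Y = Permutation Y
    module X = Permutation X
  field
    to        : Y.Carrier → X.Carrier
    injective : Injective _≡_ _≡_ to
    <-mono    : ∀ {y z} → y Y.< z → to y X.< to z
    ≺-mono    : ∀ {y z} → y Y.≺ z → to y X.≺ to z

open Embedding using (to)

-- Embeddings are maps, so two of them are equal when they agree pointwise,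
-- whatever the accompanying proofs.

infix 4 _≐_

_≐_ : Rel (Embedding Y X) 0ℓ
i ≐ i′ = to i ≗ to i′

idᴱ : Embedding X X
idᴱ = record
  { to = λ x → x ; injective = λ p → p ; <-mono = λ p → p ; ≺-mono = λ p → p }

infixr 9 _∘ᴱ_

_∘ᴱ_ : Embedding Y X → Embedding Z Y → Embedding Z X
j ∘ᴱ i = record
  { to        = to j ∘ to i
  ; injective = injective i ∘ injective j
  ; <-mono    = <-mono j ∘ <-mono i
  ; ≺-mono    = ≺-mono j ∘ ≺-mono i
  } where open Embedding

IsIso : Embedding Y X → Set
IsIso {Y} {X} i = Σ (Embedding X Y) λ i⁻¹ → (i ∘ᴱ i⁻¹ ≐ idᴱ) × (i⁻¹ ∘ᴱ i ≐ idᴱ)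

record Amalgamation (i : Embedding Y X) (j : Embedding Y Y′) : Set₁ where
  field
    X′                 : Permutation
    i′                 : Embedding Y′ X′
    j′                 : Embedding X X′
    commutes           : i′ ∘ᴱ j ≐ j′ ∘ᴱ i
    jointly-surjective : ∀ x′ → (∃ λ y′ → to i′ y′ ≡ x′) ⊎ (∃ λ x → to j′ x ≡ x′)

infix 4 _≅_

_≅_ : {i : Embedding Y X} {j : Embedding Y Y′} → Rel (Amalgamation i j) 0ℓ
A ≅ B = Σ (Embedding A.X′ B.X′) λ f → IsIso f × (f ∘ᴱ A.i′ ≐ B.i′) × (f ∘ᴱ A.j′ ≐ B.j′)
  where
  module A = Amalgamation A
  module B = Amalgamation B

record AllAmalgamations (i : Embedding Y X) (j : Embedding Y Y′) : Set₁ where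
  field
    count    : ℕ
    member   : Fin count → Amalgamation i j
    complete : ∀ A → ∃ λ α → A ≅ member α
    distinct : ∀ {α β} → member α ≅ member β → α ≡ β

record Measure (k : CommutativeRing c ℓ) : Set (Level.suc 0ℓ ⊔ c ⊔ ℓ) where
  private
    module k = CommutativeRing k
  open k using (_≈_; _*_; 1#)
  open RawMonoidDefinitions k.+-rawMonoid using (sum)
  field
    value      : Embedding Y X → k.Carrier
    value-cong : {i i′ : Embedding Y X} → i ≐ i′ → value i ≈ value i′
    value-iso  : (i : Embedding Y X) → IsIso i → value i ≈ 1#
    value-∘    : (j : Embedding Y X) (i : Embedding Z Y) →
                 value (j ∘ᴱ i) ≈ value j * value i
    value-sum  : (i : Embedding Y X) (j : Embedding Y Y′) (As : AllAmalgamations i j) →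
                 let open AllAmalgamations As in
                 value i ≈ sum (λ α → value (Amalgamation.i′ (member α)))

-- The polynomial ring over ℤ on a setoid of variables.  Its elements are
-- polynomial expressions, and its equality is the least congruence which
-- satisfies the laws of commutative rings, is compatible with the arithmetic of
-- ℤ, and respects equality of variables.

module Polynomials (V : Setoid a ℓ) where

  private
    module V = Setoid V

  infixl 7 _⊗_
  infixl 6 _⊕_
  infix  8 ⊝_
  infix  4 _≈ᴾ_

  data Poly : Set a where
    con     : ℤ → Poly
    var     : V.Carrier → Poly
    _⊕_ _⊗_ : Poly → Poly → Poly
    ⊝_      : Poly → Poly

  data _≈ᴾ_ : Rel Poly (a ⊔ ℓ) where
    reflᴾ  : ∀ {p} → p ≈ᴾ p
    symᴾ   : ∀ {p q} → p ≈ᴾ q → q ≈ᴾ p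
    transᴾ : ∀ {p q r} → p ≈ᴾ q → q ≈ᴾ r → p ≈ᴾ r

    var-cong : ∀ {x y} → x V.≈ y → var x ≈ᴾ var y
    ⊕-cong   : ∀ {p q r t} → p ≈ᴾ q → r ≈ᴾ t → p ⊕ r ≈ᴾ q ⊕ t
    ⊗-cong   : ∀ {p q r t} → p ≈ᴾ q → r ≈ᴾ t → p ⊗ r ≈ᴾ q ⊗ t
    ⊝-cong   : ∀ {p q} → p ≈ᴾ q → ⊝ p ≈ᴾ ⊝ q

    con-+ : ∀ m n → con (m ℤ.+ n) ≈ᴾ con m ⊕ con n
    con-* : ∀ m n → con (m ℤ.* n) ≈ᴾ con m ⊗ con n

    ⊕-assoc     : ∀ p q r → (p ⊕ q) ⊕ r ≈ᴾ p ⊕ (q ⊕ r)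
    ⊕-comm      : ∀ p q → p ⊕ q ≈ᴾ q ⊕ p
    ⊕-identityˡ : ∀ p → con 0ℤ ⊕ p ≈ᴾ p
    ⊝-inverseˡ  : ∀ p → ⊝ p ⊕ p ≈ᴾ con 0ℤ
    ⊗-assoc     : ∀ p q r → (p ⊗ q) ⊗ r ≈ᴾ p ⊗ (q ⊗ r)
    ⊗-comm      : ∀ p q → p ⊗ q ≈ᴾ q ⊗ p
    ⊗-identityˡ : ∀ p → con 1ℤ ⊗ p ≈ᴾ p
    ⊗-distribˡ  : ∀ p q r → p ⊗ (q ⊕ r) ≈ᴾ (p ⊗ q) ⊕ (p ⊗ r)

  polynomialRing : CommutativeRing a (a ⊔ ℓ)
  polynomialRing = record
    { Carrier = Poly
    ; _≈_     = _≈ᴾ_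
    ; _+_     = _⊕_
    ; _*_     = _⊗_
    ; -_      = ⊝_
    ; 0#      = con 0ℤ
    ; 1#      = con 1ℤ
    ; isCommutativeRing = record
      { isRing = record
        { +-isAbelianGroup = record
          { isGroup = record
            { isMonoid = record
              { isSemigroup = record
                { isMagma = record
                  { isEquivalence = record { refl = reflᴾ ; sym = symᴾ ; trans = transᴾ }
                  ; ∙-cong        = ⊕-cong
                  }
                ; assoc = ⊕-assoc
                }
              ; identity = ⊕-identityˡ , λ p → transᴾ (⊕-comm p _) (⊕-identityˡ p)
              }
            ; inverse = ⊝-inverseˡ , λ p → transᴾ (⊕-comm p _) (⊝-inverseˡ p)
            ; ⁻¹-cong = ⊝-cong
            }
          ; comm = ⊕-comm
          }
        ; *-cong     = ⊗-cong
        ; *-assoc    = ⊗-assoc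
        ; *-identity = ⊗-identityˡ , λ p → transᴾ (⊗-comm p _) (⊗-identityˡ p)
        ; distrib    = ⊗-distribˡ , λ p q r →
            transᴾ (⊗-comm _ p) (transᴾ (⊗-distribˡ p q r) (⊕-cong (⊗-comm p q) (⊗-comm p r)))
        }
      ; *-comm = ⊗-comm
      }
    }

module Quotient (R : CommutativeRing c ℓ) (S : Pred (CommutativeRing.Carrier R) s) where

  open CommutativeRing R renaming (Carrier to ∣R∣; refl to ≈-refl; sym to ≈-sym; trans to ≈-trans)
  open RingProperties ring using (-‿distribˡ-*; -‿distribʳ-*)
  open AbelianGroupProperties +-abelianGroup using (⁻¹-∙-comm; ⁻¹-involutive)
  open CommutativeSemigroupProperties +-commutativeSemigroup using (interchange)
  open SetoidReasoning setoid

  data Ideal : Pred ∣R∣ (c ⊔ ℓ ⊔ s) where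
    generator : ∀ {x} → S x → Ideal x
    zeroᴵ     : Ideal 0#
    addᴵ      : ∀ {x y} → Ideal x → Ideal y → Ideal (x + y)
    scaleᴵ    : ∀ r {x} → Ideal x → Ideal (r * x)
    respᴵ     : ∀ {x y} → x ≈ y → Ideal x → Ideal y

  infix 4 _≈ᴵ_

  _≈ᴵ_ : Rel ∣R∣ (c ⊔ ℓ ⊔ s)
  x ≈ᴵ y = Ideal (x - y)

  private
    negᴵ : ∀ {x} → Ideal x → Ideal (- x)
    negᴵ {x} p = respᴵ
      (≈-trans (≈-sym (-‿distribˡ-* 1# x)) (-‿cong (*-identityˡ x))) (scaleᴵ (- 1#) p)

    ≈⇒≈ᴵ : ∀ {x y} → x ≈ y → x ≈ᴵ y
    ≈⇒≈ᴵ {x} {y} x≈y = respᴵ (≈-sym (≈-trans (+-congʳ x≈y) (-‿inverseʳ y))) zeroᴵ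

    ≈ᴵ-sym : ∀ {x y} → x ≈ᴵ y → y ≈ᴵ x
    ≈ᴵ-sym {x} {y} p = respᴵ (begin
      - (x - y)      ≈⟨ ⁻¹-∙-comm x (- y) ⟨
      - x + - (- y)  ≈⟨ +-congˡ (⁻¹-involutive y) ⟩
      - x + y        ≈⟨ +-comm (- x) y ⟩
      y - x          ∎) (negᴵ p)

    ≈ᴵ-trans : ∀ {x y z} → x ≈ᴵ y → y ≈ᴵ z → x ≈ᴵ z
    ≈ᴵ-trans {x} {y} {z} p q = respᴵ (begin
      (x - y) + (y - z)    ≈⟨ +-assoc x (- y) (y - z) ⟩
      x + (- y + (y - z))  ≈⟨ +-congˡ (+-assoc (- y) y (- z)) ⟨
      x + ((- y + y) - z)  ≈⟨ +-congˡ (+-congʳ (-‿inverseˡ y)) ⟩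
      x + (0# - z)         ≈⟨ +-congˡ (+-identityˡ (- z)) ⟩
      x - z                ∎) (addᴵ p q)

    +-congᴵ : ∀ {x y u v} → x ≈ᴵ y → u ≈ᴵ v → x + u ≈ᴵ y + v
    +-congᴵ {x} {y} {u} {v} p q = respᴵ (begin
      (x - y) + (u - v)      ≈⟨ interchange x (- y) u (- v) ⟩
      (x + u) + (- y + - v)  ≈⟨ +-congˡ (⁻¹-∙-comm y v) ⟩
      (x + u) - (y + v)      ∎) (addᴵ p q)

    -‿congᴵ : ∀ {x y} → x ≈ᴵ y → - x ≈ᴵ - y
    -‿congᴵ {x} {y} p = respᴵ (≈-sym (⁻¹-∙-comm x (- y))) (negᴵ p)

    *-congˡᴵ : ∀ {x y} r → x ≈ᴵ y → r * x ≈ᴵ r * y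
    *-congˡᴵ {x} {y} r p = respᴵ (begin
      r * (x - y)        ≈⟨ distribˡ r x (- y) ⟩
      r * x + r * - y    ≈⟨ +-congˡ (-‿distribʳ-* r y) ⟨
      r * x - r * y      ∎) (scaleᴵ r p)

    *-congᴵ : ∀ {x y u v} → x ≈ᴵ y → u ≈ᴵ v → x * u ≈ᴵ y * v
    *-congᴵ {x} {y} {u} {v} p q =
      ≈ᴵ-trans (≈⇒≈ᴵ (*-comm x u))
        (≈ᴵ-trans (*-congˡᴵ u p) (≈ᴵ-trans (≈⇒≈ᴵ (*-comm u y)) (*-congˡᴵ y q)))

  quotientRing : CommutativeRing c (c ⊔ ℓ ⊔ s)
  quotientRing = record
    { Carrier = ∣R∣
    ; _≈_     = _≈ᴵ_
    ; _+_     = _+_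
    ; _*_     = _*_
    ; -_      = -_
    ; 0#      = 0#
    ; 1#      = 1#
    ; isCommutativeRing = record
      { isRing = record
        { +-isAbelianGroup = record
          { isGroup = record
            { isMonoid = record
              { isSemigroup = record
                { isMagma = record
                  { isEquivalence = record
                    { refl = ≈⇒≈ᴵ ≈-refl ; sym = ≈ᴵ-sym ; trans = ≈ᴵ-trans }
                  ; ∙-cong = +-congᴵ
                  }
                ; assoc = λ x y z → ≈⇒≈ᴵ (+-assoc x y z)
                }
              ; identity = (λ x → ≈⇒≈ᴵ (+-identityˡ x)) , λ x → ≈⇒≈ᴵ (+-identityʳ x)
              }
            ; inverse = (λ x → ≈⇒≈ᴵ (-‿inverseˡ x)) , λ x → ≈⇒≈ᴵ (-‿inverseʳ x)
            ; ⁻¹-cong = -‿congᴵ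
            }
          ; comm = λ x y → ≈⇒≈ᴵ (+-comm x y)
          }
        ; *-cong     = *-congᴵ
        ; *-assoc    = λ x y z → ≈⇒≈ᴵ (*-assoc x y z)
        ; *-identity = (λ x → ≈⇒≈ᴵ (*-identityˡ x)) , λ x → ≈⇒≈ᴵ (*-identityʳ x)
        ; distrib    = (λ x y z → ≈⇒≈ᴵ (distribˡ x y z)) , λ x y z → ≈⇒≈ᴵ (distribʳ x y z)
        }
      ; *-comm = λ x y → ≈⇒≈ᴵ (*-comm x y)
      }
    }

data Symbol : Set₁ where
  symbol : Embedding Y X → Symbol

data _≈ˢ_ : Rel Symbol (Level.suc 0ℓ) where
  symbol-cong : {i i′ : Embedding Y X} → i ≐ i′ → symbol i ≈ˢ symbol i′

symbols : Setoid (Level.suc 0ℓ) (Level.suc 0ℓ)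
symbols = record
  { Carrier       = Symbol
  ; _≈_           = _≈ˢ_
  ; isEquivalence = record
    { refl  = λ { {symbol _} → symbol-cong λ _ → refl }
    ; sym   = λ { (symbol-cong p) → symbol-cong λ y → sym (p y) }
    ; trans = λ { (symbol-cong p) (symbol-cong q) → symbol-cong λ y → trans (p y) (q y) }
    }
  }

ℤ[symbols] : CommutativeRing (Level.suc 0ℓ) (Level.suc 0ℓ)
ℤ[symbols] = Polynomials.polynomialRing symbols

[_] : Embedding Y X → CommutativeRing.Carrier ℤ[symbols]
[ i ] = Polynomials.var (symbol i)

module _ where
  open CommutativeRing ℤ[symbols] using (_-_; _*_; 1#; +-rawMonoid) renaming (Carrier to Poly)
  open RawMonoidDefinitions +-rawMonoid using (sum)

  data Relator : Pred Poly (Level.suc 0ℓ) where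
    iso          : (i : Embedding Y X) → IsIso i → Relator ([ i ] - 1#)
    composition  : (j : Embedding Y X) (i : Embedding Z Y) →
                   Relator ([ j ∘ᴱ i ] - [ j ] * [ i ])
    amalgamation : (i : Embedding Y X) (j : Embedding Y Y′) (As : AllAmalgamations i j) →
                   let open AllAmalgamations As in
                   Relator ([ i ] - sum (λ α → [ Amalgamation.i′ (member α) ]))

Θ : CommutativeRing (Level.suc 0ℓ) (Level.suc 0ℓ)
Θ = Quotient.quotientRing ℤ[symbols] Relator

ℤ-ring : CommutativeRing 0ℓ 0ℓ
ℤ-ring = ℤ.+-*-commutativeRing

ℤ^_ : ℕ → CommutativeRing 0ℓ 0ℓ
ℤ^ n = Pointwise.commutativeRing (Fin n) ℤ-ring

private
  restrict : {A B : Set} {_<_ : Rel B 0ℓ} (f : A → B) → Injective _≡_ _≡_ f →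
             IsStrictTotalOrder _≡_ _<_ → IsStrictTotalOrder _≡_ (_<_ on f)
  restrict f f-injective sto = record
    { isStrictPartialOrder = record
      { isEquivalence = Relation.Binary.PropositionalEquality.isEquivalence
      ; irrefl        = λ { refl → irrefl refl }
      ; trans         = <-trans
      ; <-resp-≈      = (λ { refl p → p }) , (λ { refl p → p })
      }
    ; compare = λ x y → case x y (compare (f x) (f y))
    }
    where
    open IsStrictTotalOrder sto using (irrefl; compare) renaming (trans to <-trans)
    open Relation.Binary using (Tri)
    case : ∀ x y → Tri _ (f x ≡ f y) _ → Tri _ (x ≡ y) _
    case x y (tri< p q r) = tri< p (q ∘ cong f) r
    case x y (tri≈ p q r) = tri≈ p (f-injective q) r
    case x y (tri> p q r) = tri> p (q ∘ cong f) r

  -- Proofs of _ ≢ x are definitionally equal, so the first projection from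
  -- Σ A (_≢ x) is injective.
  removeElement : {A : Set} (n : ℕ) → A ↔ Fin n → (x : A) → Σ A (_≢ x) ↔ Fin (ℕ.pred n)
  removeElement         zero    e x = contradiction (Inverse.to e x) Fin.¬Fin0
  removeElement {A = A} (suc n) e x = mk↔ₛ′ f g f∘g g∘f
    where
    module e = Inverse e

    e-injective : Injective _≡_ _≡_ e.to
    e-injective {y} {z} p =
      trans (sym (e.strictlyInverseʳ y)) (trans (cong e.from p) (e.strictlyInverseʳ z))

    ≢-to : ∀ {y} → y ≢ x → e.to x ≢ e.to y
    ≢-to y≢x p = y≢x (sym (e-injective p))

    f : Σ A (_≢ x) → Fin n
    f (y , y≢x) = punchOut (≢-to y≢x)

    g : Fin n → Σ A (_≢ x)
    g k = e.from (punchIn (e.to x) k) , λ p →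
      Fin.punchInᵢ≢i (e.to x) k (trans (sym (e.strictlyInverseˡ _)) (cong e.to p))

    f∘g : ∀ k → f (g k) ≡ k
    f∘g k = trans (Fin.punchOut-cong (e.to x) (e.strictlyInverseˡ (punchIn (e.to x) k)))
                  (Fin.punchOut-punchIn (e.to x))

    Σ-≡ : {u v : Σ A (_≢ x)} → proj₁ u ≡ proj₁ v → u ≡ v
    Σ-≡ refl = refl

    g∘f : ∀ u → g (f u) ≡ u
    g∘f (y , y≢x) =
      Σ-≡ (trans (cong e.from (Fin.punchIn-punchOut (≢-to y≢x))) (e.strictlyInverseʳ y))

infixl 6 _∖_

_∖_ : (X : Permutation) → Carrier X → Permutation
X ∖ x = record
  { Carrier              = Σ X.Carrier (_≢ x)
  ; size                 = ℕ.pred X.size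
  ; enumeration          = removeElement X.size X.enumeration x
  ; _<_                  = X._<_ on proj₁
  ; _≺_                  = X._≺_ on proj₁
  ; <-isStrictTotalOrder = restrict proj₁ (λ { refl → refl }) X.<-isStrictTotalOrder
  ; ≺-isStrictTotalOrder = restrict proj₁ (λ { refl → refl }) X.≺-isStrictTotalOrder
  } where module X = Permutation X

inclusion : (X : Permutation) (x : Carrier X) → Embedding (X ∖ x) X
inclusion X x = record
  { to        = proj₁
  ; injective = λ { refl → refl }
  ; <-mono    = λ p → p
  ; ≺-mono    = λ p → p
  }

MarkedPermutation : Set₁
MarkedPermutation = Σ Permutation Carrier

valueAt : {k : CommutativeRing c ℓ} → Measure k → MarkedPermutation → CommutativeRing.Carrier k
valueAt μ (X , x) = Measure.value μ (inclusion X x)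

-- The permutation denoted by a word of distinct numbers.  An element is
-- represented by its position in the word, counted from 0; hence _≺_ is the order
-- of positions and _<_ compares the letters there.

word : ∀ {n} (w : Vec ℕ n) {distinct : True (AllPairs.allPairs? (λ m n → ¬? (m ℕ.≟ n)) w)} →
       Permutation
word {n} w {distinct} = record
  { Carrier              = Fin n
  ; size                 = n
  ; enumeration          = mk↔ₛ′ (λ p → p) (λ p → p) (λ _ → refl) (λ _ → refl)
  ; _<_                  = ℕ._<_ on lookup w
  ; _≺_                  = Fin._<_
  ; <-isStrictTotalOrder =
      restrict (lookup w) (λ {p} {q} → lookup-injective unique p q) ℕ.<-isStrictTotalOrder
  ; ≺-isStrictTotalOrder = Fin.<-isStrictTotalOrder
  }
  where
  unique : Unique w
  unique = toWitness distinct

-- The dots over the letters become positions, which are also counted from 0.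

markedPermutations : Vec MarkedPermutation 10
markedPermutations =
  (word (1 ∷ [])                 , 0F) ∷
  (word (1 ∷ 2 ∷ [])             , 0F) ∷
  (word (1 ∷ 2 ∷ [])             , 1F) ∷
  (word (2 ∷ 1 ∷ [])             , 1F) ∷
  (word (2 ∷ 1 ∷ [])             , 0F) ∷
  (word (1 ∷ 3 ∷ 2 ∷ [])         , 2F) ∷
  (word (1 ∷ 3 ∷ 2 ∷ [])         , 1F) ∷
  (word (2 ∷ 3 ∷ 1 ∷ [])         , 0F) ∷
  (word (2 ∷ 3 ∷ 1 ∷ [])         , 1F) ∷
  (word (2 ∷ 1 ∷ 3 ∷ 5 ∷ 4 ∷ []) , 2F) ∷
  []
  where open import Data.Fin.Patterns using (0F; 1F; 2F)

HasValues : Measure ℤ-ring → Vec ℤ 10 → Set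
HasValues μ v = ∀ m → valueAt μ (lookup markedPermutations m) ≡ lookup v m

valueTable : Vec (Vec ℤ 10) 37
valueTable =
  ( 0ℤ ∷  0ℤ ∷  0ℤ ∷ -1ℤ ∷  0ℤ ∷ -1ℤ ∷  0ℤ ∷  0ℤ ∷  0ℤ ∷  0ℤ ∷ []) ∷
  ( 0ℤ ∷  0ℤ ∷  0ℤ ∷  0ℤ ∷ -1ℤ ∷ -1ℤ ∷  0ℤ ∷  0ℤ ∷  0ℤ ∷  0ℤ ∷ []) ∷
  ( 0ℤ ∷  0ℤ ∷  0ℤ ∷ -1ℤ ∷  0ℤ ∷  0ℤ ∷ -1ℤ ∷  0ℤ ∷  0ℤ ∷  0ℤ ∷ []) ∷
  ( 0ℤ ∷  0ℤ ∷  0ℤ ∷  0ℤ ∷ -1ℤ ∷  0ℤ ∷ -1ℤ ∷  0ℤ ∷  0ℤ ∷  0ℤ ∷ []) ∷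
  ( 0ℤ ∷ -1ℤ ∷  0ℤ ∷  0ℤ ∷  0ℤ ∷  0ℤ ∷  0ℤ ∷ -1ℤ ∷  0ℤ ∷  0ℤ ∷ []) ∷
  ( 0ℤ ∷  0ℤ ∷ -1ℤ ∷  0ℤ ∷  0ℤ ∷  0ℤ ∷  0ℤ ∷ -1ℤ ∷  0ℤ ∷  0ℤ ∷ []) ∷
  ( 0ℤ ∷ -1ℤ ∷  0ℤ ∷  0ℤ ∷  0ℤ ∷  0ℤ ∷  0ℤ ∷  0ℤ ∷ -1ℤ ∷  0ℤ ∷ []) ∷
  ( 0ℤ ∷  0ℤ ∷ -1ℤ ∷  0ℤ ∷  0ℤ ∷  0ℤ ∷  0ℤ ∷  0ℤ ∷ -1ℤ ∷  0ℤ ∷ []) ∷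
  ( 0ℤ ∷ -1ℤ ∷  0ℤ ∷  0ℤ ∷  0ℤ ∷  0ℤ ∷  0ℤ ∷  0ℤ ∷  0ℤ ∷ -1ℤ ∷ []) ∷
  ( 0ℤ ∷  0ℤ ∷ -1ℤ ∷  0ℤ ∷  0ℤ ∷  0ℤ ∷  0ℤ ∷  0ℤ ∷  0ℤ ∷ -1ℤ ∷ []) ∷
  ( 0ℤ ∷  0ℤ ∷  0ℤ ∷ -1ℤ ∷  0ℤ ∷  0ℤ ∷  0ℤ ∷  0ℤ ∷  0ℤ ∷ -1ℤ ∷ []) ∷
  ( 0ℤ ∷  0ℤ ∷  0ℤ ∷  0ℤ ∷ -1ℤ ∷  0ℤ ∷  0ℤ ∷  0ℤ ∷  0ℤ ∷ -1ℤ ∷ []) ∷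
  ( 0ℤ ∷  0ℤ ∷  0ℤ ∷ -1ℤ ∷  0ℤ ∷ -1ℤ ∷ -1ℤ ∷  0ℤ ∷  0ℤ ∷  1ℤ ∷ []) ∷
  ( 0ℤ ∷  0ℤ ∷  0ℤ ∷  0ℤ ∷ -1ℤ ∷ -1ℤ ∷ -1ℤ ∷  0ℤ ∷  0ℤ ∷  1ℤ ∷ []) ∷
  ( 0ℤ ∷ -1ℤ ∷  0ℤ ∷  0ℤ ∷  0ℤ ∷  0ℤ ∷  0ℤ ∷ -1ℤ ∷ -1ℤ ∷  1ℤ ∷ []) ∷
  ( 0ℤ ∷  0ℤ ∷ -1ℤ ∷  0ℤ ∷  0ℤ ∷  0ℤ ∷  0ℤ ∷ -1ℤ ∷ -1ℤ ∷  1ℤ ∷ []) ∷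
  ( 0ℤ ∷  1ℤ ∷  0ℤ ∷ -1ℤ ∷ -1ℤ ∷ -1ℤ ∷ -1ℤ ∷  0ℤ ∷  0ℤ ∷  1ℤ ∷ []) ∷
  ( 0ℤ ∷  0ℤ ∷  1ℤ ∷ -1ℤ ∷ -1ℤ ∷ -1ℤ ∷ -1ℤ ∷  0ℤ ∷  0ℤ ∷  1ℤ ∷ []) ∷
  ( 0ℤ ∷ -1ℤ ∷ -1ℤ ∷  1ℤ ∷  0ℤ ∷  0ℤ ∷  0ℤ ∷ -1ℤ ∷ -1ℤ ∷  1ℤ ∷ []) ∷
  ( 0ℤ ∷ -1ℤ ∷ -1ℤ ∷  0ℤ ∷  1ℤ ∷  0ℤ ∷  0ℤ ∷ -1ℤ ∷ -1ℤ ∷  1ℤ ∷ []) ∷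
  ( 1ℤ ∷  0ℤ ∷  0ℤ ∷  0ℤ ∷  0ℤ ∷ -1ℤ ∷  0ℤ ∷  0ℤ ∷  0ℤ ∷  0ℤ ∷ []) ∷
  ( 1ℤ ∷  0ℤ ∷  0ℤ ∷  0ℤ ∷  0ℤ ∷  0ℤ ∷ -1ℤ ∷  0ℤ ∷  0ℤ ∷  0ℤ ∷ []) ∷
  ( 1ℤ ∷  0ℤ ∷  0ℤ ∷  0ℤ ∷  0ℤ ∷  0ℤ ∷  0ℤ ∷ -1ℤ ∷  0ℤ ∷  0ℤ ∷ []) ∷
  ( 1ℤ ∷  0ℤ ∷  0ℤ ∷  0ℤ ∷  0ℤ ∷  0ℤ ∷  0ℤ ∷  0ℤ ∷ -1ℤ ∷  0ℤ ∷ []) ∷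
  ( 1ℤ ∷  0ℤ ∷  0ℤ ∷  0ℤ ∷  0ℤ ∷  0ℤ ∷  0ℤ ∷  0ℤ ∷  0ℤ ∷ -1ℤ ∷ []) ∷
  ( 1ℤ ∷  0ℤ ∷  0ℤ ∷  0ℤ ∷  0ℤ ∷ -1ℤ ∷ -1ℤ ∷  0ℤ ∷  0ℤ ∷  1ℤ ∷ []) ∷
  ( 1ℤ ∷  0ℤ ∷  0ℤ ∷  0ℤ ∷  0ℤ ∷  0ℤ ∷  0ℤ ∷ -1ℤ ∷ -1ℤ ∷  1ℤ ∷ []) ∷
  (-1ℤ ∷ -1ℤ ∷ -1ℤ ∷  0ℤ ∷  0ℤ ∷  0ℤ ∷  0ℤ ∷ -1ℤ ∷  0ℤ ∷  0ℤ ∷ []) ∷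
  (-1ℤ ∷ -1ℤ ∷ -1ℤ ∷  0ℤ ∷  0ℤ ∷  0ℤ ∷  0ℤ ∷  0ℤ ∷ -1ℤ ∷  0ℤ ∷ []) ∷
  (-1ℤ ∷ -1ℤ ∷ -1ℤ ∷  0ℤ ∷  0ℤ ∷  0ℤ ∷  0ℤ ∷  0ℤ ∷  0ℤ ∷ -1ℤ ∷ []) ∷
  (-1ℤ ∷ -1ℤ ∷ -1ℤ ∷  0ℤ ∷  0ℤ ∷  0ℤ ∷  0ℤ ∷ -1ℤ ∷ -1ℤ ∷  1ℤ ∷ []) ∷
  (-1ℤ ∷  0ℤ ∷  0ℤ ∷ -1ℤ ∷ -1ℤ ∷ -1ℤ ∷  0ℤ ∷  0ℤ ∷  0ℤ ∷  0ℤ ∷ []) ∷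
  (-1ℤ ∷  0ℤ ∷  0ℤ ∷ -1ℤ ∷ -1ℤ ∷  0ℤ ∷ -1ℤ ∷  0ℤ ∷  0ℤ ∷  0ℤ ∷ []) ∷
  (-1ℤ ∷  0ℤ ∷  0ℤ ∷ -1ℤ ∷ -1ℤ ∷  0ℤ ∷  0ℤ ∷  0ℤ ∷  0ℤ ∷ -1ℤ ∷ []) ∷
  (-1ℤ ∷  0ℤ ∷  0ℤ ∷ -1ℤ ∷ -1ℤ ∷ -1ℤ ∷ -1ℤ ∷  0ℤ ∷  0ℤ ∷  1ℤ ∷ []) ∷
  ( 1ℤ ∷  1ℤ ∷  1ℤ ∷ -1ℤ ∷ -1ℤ ∷ -1ℤ ∷ -1ℤ ∷  0ℤ ∷  0ℤ ∷  1ℤ ∷ []) ∷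
  ( 1ℤ ∷ -1ℤ ∷ -1ℤ ∷  1ℤ ∷  1ℤ ∷  0ℤ ∷  0ℤ ∷ -1ℤ ∷ -1ℤ ∷  1ℤ ∷ []) ∷
  []

{-# OPTIONS --safe #-}
module Submission where

-- An element added to a permutation Y lies in a cell of the grid which the points of Y cut
-- out of the plane.  A measure is therefore a function on cells which is additive when
-- another point is added to Y (and the cell containing that point counts 1 more), and for
-- which adding two points in either order gives the same product.
--
-- Additivity forces the value of a cell with neighbours l, r, b, t to the left, right,
-- bottom and top to be κ(l,b) - κ(r,b) - κ(l,t) + κ(r,t) - [r = t], where κ(p,q), the value
-- of the quadrant to the right of p and above q, depends only on the relative position of
-- p and q: the deviation of a measure from this expression changes sign when a cell is
-- moved across the line of a point, and it vanishes for at most two points by the choice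
-- of κ.  For three or more points it vanishes since a cell does not change when a point
-- which does not bound it is removed.
--
-- The products give quadratic equations for the eight free parameters of κ.  They force
-- the parameters to be 0, 1 or -1 on complementary idempotents, which split 1 into a sum
-- of elements on each of which the measure takes the values of one of the 37 rows.
-- Conversely, whether a row is a measure depends only on the local configurations of two
-- cells, of which there are finitely many.

open import Defs
open import Algebra.Bundles using (CommutativeRing)
import Algebra.Definitions.RawMonoid as RawMonoidDefinitions
open import Algebra.Morphism.Structures using (module RingMorphisms)
import Algebra.Properties.CommutativeMonoid.Sum as Sum
open import Algebra.Solver.Ring.AlmostCommutativeRing
  using (AlmostCommutativeRing; fromCommutativeRing; _-Raw-AlmostCommutative⟶_)
open import Data.Bool using (Bool; true; false; not; if_then_else_)
import Data.Bool.Properties as Bool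
open import Data.Empty using (⊥; ⊥-elim)
open import Data.Fin using (Fin; zero; suc; #_)
import Data.Fin as Fin
open import Data.Fin.Patterns using (0F; 1F; 2F; 3F; 4F; 5F; 6F; 7F; 8F)
import Data.Fin.Properties as Fin
open import Data.Integer using (ℤ; 0ℤ; 1ℤ; -1ℤ)
import Data.Integer as ℤ
import Data.Integer.Properties as ℤ
open import Data.List using (List; []; _∷_; _++_; length; concatMap; filter)
import Data.List as List
open import Data.List.Membership.Propositional using (_∈_; _∉_; find; lose)
import Data.List.Membership.Propositional.Properties as ∈
open import Data.List.Membership.Propositional.Properties.WithK using (unique∧set⇒bag)
open import Data.List.Properties using (map-id)
open import Data.List.Relation.Binary.BagAndSetEquality using (∼bag⇒↭)
open import Data.List.Relation.Binary.Permutation.Propositional using (_↭_; ↭⇒↭ₛ)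
import Data.List.Relation.Binary.Permutation.Propositional as Perm
import Data.List.Relation.Binary.Permutation.Propositional.Properties as Perm
import Data.List.Relation.Binary.Permutation.Setoid.Properties as PermSetoid
open import Data.List.Relation.Unary.All using (All; []; _∷_)
import Data.List.Relation.Unary.All as All
import Data.List.Relation.Unary.All.Properties as All
open import Data.List.Relation.Unary.AllPairs using (AllPairs; []; _∷_)
import Data.List.Relation.Unary.AllPairs as AllPairs
import Data.List.Relation.Unary.AllPairs.Properties as AllPairs
open import Data.List.Relation.Unary.Any using (Any; here; there)
import Data.List.Relation.Unary.Any as Any
open import Data.List.Relation.Unary.Any.Properties using (concatMap⁺)
import Data.List.Relation.Unary.Any.Properties as Any
open import Data.Maybe using (Maybe; just; nothing)
import Data.Maybe as Maybe
import Data.Maybe.Properties as Maybe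
open import Data.Nat using (ℕ; zero; suc)
import Data.Nat as ℕ
import Data.Nat.Properties as ℕ
open import Data.Product using (Σ; ∃; Σ-syntax; _×_; _,_; proj₁; proj₂)
import Data.Product.Properties as ×
open import Data.Sum using (_⊎_; inj₁; inj₂; [_,_]′)
open import Data.Unit using (⊤)
open import Data.Vec using (Vec; []; _∷_; lookup)
import Data.Vec as Vec
import Data.Vec.Properties as Vec
open import Function using (_↔_; Inverse; mk↔ₛ′; _∘_; _on_; case_of_)
open import Function.Bundles using (mk⇔)
open import Level using (Level; 0ℓ; _⊔_)
import Level
open import Relation.Binary using (Rel; IsStrictTotalOrder; Tri; tri<; tri≈; tri>)
open import Relation.Binary.PropositionalEquality
  using (_≡_; _≢_; refl; sym; trans; cong; cong₂; subst; subst₂; module ≡-Reasoning)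
import Relation.Binary.Reasoning.Setoid as SetoidReasoning
open import Relation.Nullary using (¬_; Dec; yes; no; contradiction; does)
open import Relation.Nullary.Decidable using (map′; ¬?; _×-dec_; _→-dec_; decidable-stable; dec-true; dec-false; from-yes)

open Permutation using (Carrier; size; enumeration)
open Embedding using (to; injective)

-- The sum axiom concerns all pairs of embeddings and every system of representatives. Embeddings
-- are composites of one-point extensions, and amalgamations of a composite are pasted from those of
-- its factors, so two one-point extensions suffice. These have at most five amalgamations: four
-- relative positions of the new points and their identification. Conversely, a function on cells
-- yields a multiplicative function by taking products along a list of added points, which is well
-- defined once two consecutive points may be exchanged.
--
-- The term [r = t] has the following origin. The value of a region is the sum over its cells plus
-- the number of points inside it. In the alternating sum of the four quadrants all cells but the
-- given one cancel. The points that survive lie to the right of l but not of r, and above b but not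
-- above t. No point lies strictly between two opposite neighbours of a cell, so such a point is
-- both r and t.
--
-- Counting absent elements, p and q have eight relative positions. These are the eight parameters,
-- fixed by the eight middle words of the table. The first and the last word follow by additivity.

private
  variable
    c ℓ : Level
    X Y Z W Y′ : Permutation

-- Permutations and embeddings along two axes

data Axis : Set where
  place height : Axis

-- With the axis as an argument, most facts about the two orders are proved once for both.
Order : (X : Permutation) → Axis → Rel (Carrier X) 0ℓ
Order X place  = Permutation._≺_ X
Order X height = Permutation._<_ X

isSTO : (X : Permutation) (a : Axis) → IsStrictTotalOrder _≡_ (Order X a)
isSTO X place  = Permutation.≺-isStrictTotalOrder X
isSTO X height = Permutation.<-isStrictTotalOrder X

permutation : (A : Set) (n : ℕ) → A ↔ Fin n → (R : Axis → Rel A 0ℓ) →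
              (∀ a → IsStrictTotalOrder _≡_ (R a)) → Permutation
permutation A n e R sto = record
  { Carrier = A ; size = n ; enumeration = e
  ; _<_ = R height ; _≺_ = R place
  ; <-isStrictTotalOrder = sto height ; ≺-isStrictTotalOrder = sto place
  }

irrefl : ∀ X a {x} → ¬ Order X a x x
irrefl X a = IsStrictTotalOrder.irrefl (isSTO X a) refl

asym : ∀ X a {x y} → Order X a x y → ¬ Order X a y x
asym X a = IsStrictTotalOrder.asym (isSTO X a)

ordTrans : ∀ X a {x y z} → Order X a x y → Order X a y z → Order X a x z
ordTrans X a = IsStrictTotalOrder.trans (isSTO X a)

compare : ∀ X a x y → Tri (Order X a x y) (x ≡ y) (Order X a y x)
compare X a = IsStrictTotalOrder.compare (isSTO X a)

_<?_ : ∀ {X a} (x y : Carrier X) → Dec (Order X a x y)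
_<?_ {X} {a} = IsStrictTotalOrder._<?_ (isSTO X a)

infix 4 _≟_
_≟_ : ∀ {X} (x y : Carrier X) → Dec (x ≡ y)
_≟_ {X} = IsStrictTotalOrder._≟_ (isSTO X place)

mono : (i : Embedding Y X) → ∀ a {y z} → Order Y a y z → Order X a (to i y) (to i z)
mono i place  = Embedding.≺-mono i
mono i height = Embedding.<-mono i

-- Strict monotonicity already gives injectivity, because distinct elements are comparable.
embedding : (f : Carrier Y → Carrier X) →
            (∀ a {y z} → Order Y a y z → Order X a (f y) (f z)) → Embedding Y X
embedding {Y} {X} f m = record
  { to = f ; injective = inj _ _ ; <-mono = m height ; ≺-mono = m place }
  where
  inj : ∀ y z → f y ≡ f z → y ≡ z
  inj y z p with compare Y place y z
  ... | tri≈ _ q _ = q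
  ... | tri< q _ _ = contradiction (subst (Order X place _) (sym p) (m place q)) (irrefl X place)
  ... | tri> _ _ q = contradiction (subst (Order X place _) p (m place q)) (irrefl X place)

reflects : (i : Embedding Y X) → ∀ a {y z} → Order X a (to i y) (to i z) → Order Y a y z
reflects {Y} {X} i a {y} {z} p with compare Y a y z
... | tri< q _ _ = q
... | tri≈ _ refl _ = contradiction p (irrefl X a)
... | tri> _ _ q = contradiction (mono i a q) (asym X a p)

Onto : Embedding Y X → Set
Onto i = ∀ x → ∃ λ y → to i y ≡ x

onto⇒iso : (i : Embedding Y X) → Onto i → IsIso i
onto⇒iso {Y} {X} i s = i⁻¹ , (λ x → proj₂ (s x)) , λ y → injective i (proj₂ (s (to i y)))
  where
  i⁻¹ : Embedding X Y
  i⁻¹ = embedding (λ x → proj₁ (s x)) λ a {x} {z} p →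
    reflects i a (subst₂ (Order X a) (sym (proj₂ (s x))) (sym (proj₂ (s z))) p)

iso⇒onto : (i : Embedding Y X) → IsIso i → Onto i
iso⇒onto i (i⁻¹ , p , _) x = to i⁻¹ x , p x

elements : (X : Permutation) → List (Carrier X)
elements X = List.tabulate (Inverse.from (enumeration X))

∈-elements : ∀ X (x : Carrier X) → x ∈ elements X
∈-elements X x = subst (_∈ elements X) (Inverse.strictlyInverseʳ (enumeration X) x)
  (∈.∈-tabulate⁺ (Inverse.to (enumeration X) x))

elements-unique : ∀ X → AllPairs _≢_ (elements X)
elements-unique X = AllPairs.tabulate⁺ λ {k} {l} k≢l p → k≢l
  (trans (sym (e.strictlyInverseˡ k)) (trans (cong e.to p) (e.strictlyInverseˡ l)))
  where module e = Inverse (enumeration X)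

any? : ∀ X {P : Carrier X → Set} → (∀ x → Dec (P x)) → Dec (∃ P)
any? X {P} P? = map′ (λ (k , p) → e.from k , p)
  (λ (x , p) → e.to x , subst P (sym (e.strictlyInverseʳ x)) p) (Fin.any? (λ k → P? (e.from k)))
  where module e = Inverse (enumeration X)

all? : ∀ X {P : Carrier X → Set} → (∀ x → Dec (P x)) → Dec (∀ x → P x)
all? X {P} P? = map′ (λ f x → subst P (e.strictlyInverseʳ x) (f (e.to x)))
  (λ f k → f (e.from k)) (Fin.all? (λ k → P? (e.from k)))
  where module e = Inverse (enumeration X)

inImage? : (i : Embedding Y X) → ∀ x → Dec (∃ λ y → to i y ≡ x)
inImage? {Y} {X} i x = any? Y (λ y → _≟_ {X} (to i y) x)

onto-or-misses : (i : Embedding Y X) → Onto i ⊎ ∃ λ x → ∀ y → to i y ≢ x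
onto-or-misses {Y} {X} i with any? X (λ x → ¬? (inImage? i x))
... | yes (x , q) = inj₂ (x , λ y p → q (y , p))
... | no  q       = inj₁ λ x → decidable-stable (inImage? i x) λ r → q (x , r)

record OnePoint (i : Embedding Y X) : Set where
  field
    point : Carrier X
    fresh : ∀ y → to i y ≢ point
    cover : ∀ x → x ≡ point ⊎ ∃ λ y → to i y ≡ x

inclusion-onePoint : ∀ X x → OnePoint (inclusion X x)
inclusion-onePoint X x = record { point = x ; fresh = proj₂ ; cover = cov }
  where
  cov : ∀ z → z ≡ x ⊎ ∃ λ y → to (inclusion X x) y ≡ z
  cov z with _≟_ {X} z x
  ... | yes p = inj₁ p
  ... | no  q = inj₂ ((z , q) , refl)

∖-order : ∀ X x a {u v : Carrier (X ∖ x)} → Order X a (proj₁ u) (proj₁ v) → Order (X ∖ x) a u v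
∖-order X x place  p = p
∖-order X x height p = p

corestrict : (i : Embedding Y X) (x : Carrier X) → (∀ y → to i y ≢ x) → Embedding Y (X ∖ x)
corestrict {X = X} i x q =
  embedding (λ y → to i y , q y) λ a {y} {z} p → ∖-order X x a {to i y , q y} {to i z , q z} (mono i a p)

-- Recursion on the size of `X`: an embedding that is not onto misses some `x` and factors through
-- the permutation without `x`. The factored map has the same underlying function but other proofs,
-- hence `resp`.
embedding-induction :
  (Q : ∀ {Y X} → Embedding Y X → Set ℓ) →
  (∀ {Y X} {i j : Embedding Y X} → i ≐ j → Q i → Q j) →
  (∀ {Y X} (i : Embedding Y X) → IsIso i → Q i) →
  (∀ {Y X} x (i : Embedding Y (X ∖ x)) → Q i → Q (inclusion X x ∘ᴱ i)) →
  ∀ {Y X} (i : Embedding Y X) → Q i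
embedding-induction Q resp isoQ step i = go _ i refl
  where
  go : ∀ n {Y X} (i : Embedding Y X) → size X ≡ n → Q i
  go n {Y} {X} i eq with onto-or-misses i
  ... | inj₁ s = isoQ i (onto⇒iso i s)
  go zero {Y} {X} i eq | inj₂ (x , _) =
    contradiction (subst Fin eq (Inverse.to (enumeration X) x)) Fin.¬Fin0
  go (suc n) {Y} {X} i eq | inj₂ (x , q) =
    resp {i = inclusion X x ∘ᴱ corestrict i x q} (λ _ → refl)
      (step x (corestrict i x q) (go n (corestrict i x q) (cong ℕ.pred eq)))

-- Enumerations of amalgamations

module _ {i : Embedding Y X} {j : Embedding Y Y′} where

  open Amalgamation

  -- A map of amalgamations is onto because its target is covered by Y′ and X.

  amalgamation-map⇒≅ : (A B : Amalgamation i j) (f : Embedding (X′ A) (X′ B)) →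
                       f ∘ᴱ i′ A ≐ i′ B → f ∘ᴱ j′ A ≐ j′ B → A ≅ B
  amalgamation-map⇒≅ A B f p q = f , onto⇒iso f s , p , q
    where
    s : Onto f
    s x with jointly-surjective B x
    ... | inj₁ (y , refl) = to (i′ A) y , p y
    ... | inj₂ (z , refl) = to (j′ A) z , q z

  ≅-refl : ∀ {A : Amalgamation i j} → A ≅ A
  ≅-refl {A} = amalgamation-map⇒≅ A A idᴱ (λ _ → refl) (λ _ → refl)

  ≅-sym : ∀ {A B : Amalgamation i j} → A ≅ B → B ≅ A
  ≅-sym {A} {B} (f , (f⁻¹ , _ , l) , p , q) = amalgamation-map⇒≅ B A f⁻¹
    (λ y → trans (cong (to f⁻¹) (sym (p y))) (l _))
    (λ y → trans (cong (to f⁻¹) (sym (q y))) (l _))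

  ≅-trans : ∀ {A B C : Amalgamation i j} → A ≅ B → B ≅ C → A ≅ C
  ≅-trans {A} {B} {C} (f , _ , p , q) (g , _ , p′ , q′) = amalgamation-map⇒≅ A C (g ∘ᴱ f)
    (λ y → trans (cong (to g) (p y)) (p′ y)) (λ y → trans (cong (to g) (q y)) (q′ y))

-- Lists take the place of families over `Fin` here, so that enumerations can be mapped and
-- concatenated.
record Enumeration (i : Embedding Y X) (j : Embedding Y Y′) : Set₁ where
  field
    members  : List (Amalgamation i j)
    complete : ∀ A → Any (A ≅_) members
    distinct : AllPairs (λ A B → ¬ A ≅ B) members

open Enumeration

enumeration⇒all : {i : Embedding Y X} {j : Embedding Y Y′} → Enumeration i j → AllAmalgamations i j
enumeration⇒all {i = i} {j} E = record
  { count    = length (members E)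
  ; member   = List.lookup (members E)
  ; complete = λ A → Any.index (complete E A) , Any.lookup-index (complete E A)
  ; distinct = unique (distinct E) _ _
  }
  where
  unique : ∀ {As : List (Amalgamation i j)} → AllPairs (λ A B → ¬ A ≅ B) As →
           ∀ α β → List.lookup As α ≅ List.lookup As β → α ≡ β
  unique (_ ∷ _)  zero    zero    _ = refl
  unique (r ∷ _)  zero    (suc β) e = contradiction e (All.lookup r (∈.∈-lookup β))
  unique {A ∷ As} (r ∷ _)  (suc α) zero    e =
    contradiction (≅-sym {A = List.lookup As α} {A} e) (All.lookup r (∈.∈-lookup α))
  unique (_ ∷ rs) (suc α) (suc β) e = cong suc (unique rs α β e)

map-enumeration : {Y₁ X₁ Y′₁ Y₂ X₂ Y′₂ : Permutation}
  {i : Embedding Y₁ X₁} {j : Embedding Y₁ Y′₁} {i₂ : Embedding Y₂ X₂} {j₂ : Embedding Y₂ Y′₂}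
  (F : Amalgamation i j → Amalgamation i₂ j₂) (G : Amalgamation i₂ j₂ → Amalgamation i j) →
  (∀ {A B} → A ≅ B → F A ≅ F B) → (∀ {A B} → F A ≅ F B → A ≅ B) → (∀ A → A ≅ F (G A)) →
  Enumeration i j → Enumeration i₂ j₂
map-enumeration F G pres refl′ FG E = record
  { members  = List.map F (members E)
  ; complete = λ A → Any.map⁺ (Any.map
      (λ {B} e → ≅-trans {A = A} {F (G A)} {F B} (FG A) (pres e)) (complete E (G A)))
  ; distinct = AllPairs.map⁺ (AllPairs.map (λ r e → r (refl′ e)) (distinct E))
  }

flip : {i : Embedding Y X} {j : Embedding Y Y′} → Amalgamation i j → Amalgamation j i
flip A = record
  { X′ = X′ ; i′ = j′ ; j′ = i′ ; commutes = λ y → sym (commutes y)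
  ; jointly-surjective = λ x → [ inj₂ , inj₁ ]′ (jointly-surjective x) }
  where open Amalgamation A

flip-enumeration : {i : Embedding Y X} {j : Embedding Y Y′} → Enumeration i j → Enumeration j i
flip-enumeration {i = i} {j = j} = map-enumeration flip flip
  (λ {A} {B} → flip-≅ {A = A} {B}) (λ {A} {B} → flip-≅ {A = flip A} {flip B})
  (λ A → ≅-refl {i = j} {j = i} {A = A})
  where
  flip-≅ : {i : Embedding Y X} {j : Embedding Y Y′} {A B : Amalgamation i j} → A ≅ B → flip A ≅ flip B
  flip-≅ (f , s , p , q) = f , s , q , p

resp-amalgamation : {i i₂ : Embedding Y X} {j j₂ : Embedding Y Y′} → i ≐ i₂ → j ≐ j₂ →
  Amalgamation i j → Amalgamation i₂ j₂
resp-amalgamation p q A = record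
  { X′ = X′ ; i′ = i′ ; j′ = j′
  ; commutes = λ y → trans (cong (to i′) (sym (q y))) (trans (commutes y) (cong (to j′) (p y)))
  ; jointly-surjective = jointly-surjective }
  where open Amalgamation A

resp-enumeration : {i i₂ : Embedding Y X} {j j₂ : Embedding Y Y′} → i ≐ i₂ → j ≐ j₂ →
  Enumeration i j → Enumeration i₂ j₂
resp-enumeration {i₂ = i₂} {j₂ = j₂} p q = map-enumeration (resp-amalgamation p q)
  (resp-amalgamation (λ y → sym (p y)) (λ y → sym (q y)))
  (λ e → e) (λ e → e) (λ A → ≅-refl {i = i₂} {j = j₂} {A = A})

-- Along an isomorphism `X` contributes no point of its own, so every amalgamation is `Y′` again.
iso-enumeration : (i : Embedding Y X) → IsIso i → (j : Embedding Y Y′) → Enumeration i j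
iso-enumeration {Y} {X} {Y′} i (i⁻¹ , r , l) j = record
  { members  = A ∷ []
  ; complete = λ W → here (≅-sym {A = A} {W} (amalgamation-map⇒≅ A W (Amalgamation.i′ W) (λ _ → refl)
      λ x → trans (Amalgamation.commutes W _) (cong (to (Amalgamation.j′ W)) (r x))))
  ; distinct = [] ∷ []
  }
  where
  A : Amalgamation i j
  A = record
    { X′ = Y′ ; i′ = idᴱ ; j′ = j ∘ᴱ i⁻¹ ; commutes = λ y → cong (to j) (sym (l y))
    ; jointly-surjective = λ y → inj₁ (y , refl) }

module Paste {x : Carrier X} {i : Embedding Y (X ∖ x)} {j : Embedding Y Y′} where

  open Amalgamation

  private
    incl : Embedding (X ∖ x) X
    incl = inclusion X x

  paste : (A : Amalgamation i j) → Amalgamation incl (j′ A) → Amalgamation (incl ∘ᴱ i) j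
  paste A B = record
    { X′ = X′ B ; i′ = i′ B ∘ᴱ i′ A ; j′ = j′ B
    ; commutes = λ y → trans (cong (to (i′ B)) (commutes A y)) (commutes B (to i y))
    ; jointly-surjective = surj
    }
    where
    surj : ∀ w → (∃ λ y → to (i′ B) (to (i′ A) y) ≡ w) ⊎ (∃ λ z → to (j′ B) z ≡ w)
    surj w with jointly-surjective B w
    ... | inj₂ q = inj₂ q
    ... | inj₁ (v , refl) with jointly-surjective A v
    ...   | inj₁ (y , refl) = inj₁ (y , refl)
    ...   | inj₂ (z , refl) = inj₂ (to incl z , sym (commutes B z))

  paste-injectiveʳ : ∀ A {B B₂} → paste A B ≅ paste A B₂ → B ≅ B₂
  paste-injectiveʳ A {B} {B₂} (f , _ , p , q) = amalgamation-map⇒≅ B B₂ f comm q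
    where
    comm : f ∘ᴱ i′ B ≐ i′ B₂
    comm v with jointly-surjective A v
    ... | inj₁ (y , refl) = p y
    ... | inj₂ (z , refl) =
      trans (cong (to f) (commutes B z)) (trans (q _) (sym (commutes B₂ z)))

  -- The first stage sits inside the pasted amalgamation as the union of the images of `Y′` and of
  -- `X` without `x`, and a map of amalgamations respects both images.
  paste-injectiveˡ : ∀ {A A₂ B B₂} → paste A B ≅ paste A₂ B₂ → A ≅ A₂
  paste-injectiveˡ {A} {A₂} {B} {B₂} (f , _ , p , q) = amalgamation-map⇒≅ A A₂ e
    (λ y → injective (i′ B₂) (trans (key _) (p y)))
    (λ z → injective (i′ B₂) (trans (key _)
      (trans (cong (to f) (commutes B z)) (trans (q _) (sym (commutes B₂ z))))))
    where
    lift : ∀ v → ∃ λ v₂ → to (i′ B₂) v₂ ≡ to f (to (i′ B) v)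
    lift v with jointly-surjective A v
    ... | inj₁ (y , refl) = to (i′ A₂) y , sym (p y)
    ... | inj₂ (z , refl) = to (j′ A₂) z ,
      trans (commutes B₂ z) (trans (sym (q _)) (cong (to f) (sym (commutes B z))))

    key : ∀ v → to (i′ B₂) (proj₁ (lift v)) ≡ to f (to (i′ B) v)
    key v = proj₂ (lift v)

    e : Embedding (X′ A) (X′ A₂)
    e = embedding (λ v → proj₁ (lift v)) λ a {u} {v} u<v → reflects (i′ B₂) a
      (subst₂ (Order (X′ B₂) a) (sym (key u)) (sym (key v)) (mono f a (mono (i′ B) a u<v)))

  -- If `x` is identified with an element of `Y′`, the first stage is all of `V`; otherwise it is
  -- `V` without the image of `x`.
  split : (V : Amalgamation (incl ∘ᴱ i) j) →
          Σ[ A ∈ Amalgamation i j ] Σ[ B ∈ Amalgamation incl (j′ A) ] V ≅ paste A B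
  split V with inImage? (i′ V) (to (j′ V) x)
  ... | yes (y′ , e) = A , B , amalgamation-map⇒≅ V (paste A B) idᴱ (λ _ → refl) (λ _ → refl)
    where
    surj : ∀ w → (∃ λ y → to (i′ V) y ≡ w) ⊎ (∃ λ z → to (j′ V) (to incl z) ≡ w)
    surj w with jointly-surjective V w
    ... | inj₁ q = inj₁ q
    ... | inj₂ (z , refl) with _≟_ {X} z x
    ...   | yes refl = inj₁ (y′ , e)
    ...   | no  z≢x  = inj₂ ((z , z≢x) , refl)

    A : Amalgamation i j
    A = record { X′ = X′ V ; i′ = i′ V ; j′ = j′ V ∘ᴱ incl
               ; commutes = commutes V ; jointly-surjective = surj }

    B : Amalgamation incl (j′ V ∘ᴱ incl)
    B = record { X′ = X′ V ; i′ = idᴱ ; j′ = j′ V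
               ; commutes = λ _ → refl ; jointly-surjective = λ w → inj₁ (w , refl) }
  ... | no  q = A , B , amalgamation-map⇒≅ V (paste A B) idᴱ (λ _ → refl) (λ _ → refl)
    where
    w₀ : Carrier (X′ V)
    w₀ = to (j′ V) x

    i₀ : Embedding Y′ (X′ V ∖ w₀)
    i₀ = corestrict (i′ V) w₀ λ y e → q (y , e)

    j₀ : Embedding (X ∖ x) (X′ V ∖ w₀)
    j₀ = corestrict (j′ V ∘ᴱ incl) w₀ λ z e → proj₂ z (injective (j′ V) e)

    surj : ∀ w → (∃ λ y → to i₀ y ≡ w) ⊎ (∃ λ z → to j₀ z ≡ w)
    surj (w , w≢) with jointly-surjective V w
    ... | inj₁ (y , refl) = inj₁ (y , refl)
    ... | inj₂ (z , refl) = inj₂ ((z , λ { refl → w≢ refl }) , refl)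

    A : Amalgamation i j
    A = record { X′ = X′ V ∖ w₀ ; i′ = i₀ ; j′ = j₀
               ; commutes = λ y → injective (inclusion (X′ V) w₀) (commutes V y)
               ; jointly-surjective = surj }

    surjB : ∀ w → (∃ λ y → proj₁ y ≡ w) ⊎ (∃ λ z → to (j′ V) z ≡ w)
    surjB w with _≟_ {X′ V} w w₀
    ... | yes e  = inj₂ (x , sym e)
    ... | no  w≢ = inj₁ ((w , w≢) , refl)

    B : Amalgamation incl j₀
    B = record { X′ = X′ V ; i′ = inclusion (X′ V) w₀ ; j′ = j′ V
               ; commutes = λ _ → refl ; jointly-surjective = surjB }

  -- Completeness of the list of first stages only yields a member isomorphic to the given first
  -- stage, so the second stage has to be carried over to that member.
  transport : {A A₂ : Amalgamation i j} → A ≅ A₂ → Amalgamation incl (j′ A) → Amalgamation incl (j′ A₂)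
  transport {A} {A₂} (f , (f⁻¹ , r , l) , p , q) B = record
    { X′ = X′ B ; i′ = i′ B ∘ᴱ f⁻¹ ; j′ = j′ B
    ; commutes = λ z →
        trans (cong (to (i′ B)) (trans (cong (to f⁻¹) (sym (q z))) (l (to (j′ A) z)))) (commutes B z)
    ; jointly-surjective = surj }
    where
    surj : ∀ w → (∃ λ y → to (i′ B) (to f⁻¹ y) ≡ w) ⊎ (∃ λ z → to (j′ B) z ≡ w)
    surj w with jointly-surjective B w
    ... | inj₁ (y , e) = inj₁ (to f y , trans (cong (to (i′ B)) (l y)) e)
    ... | inj₂ s       = inj₂ s

  paste-transport : ∀ {A A₂ : Amalgamation i j} (e : A ≅ A₂) B → paste A B ≅ paste A₂ (transport {A} {A₂} e B)
  paste-transport {A} {A₂} e@(f , (f⁻¹ , r , l) , p , q) B =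
    amalgamation-map⇒≅ (paste A B) (paste A₂ (transport {A} {A₂} e B)) idᴱ
      (λ y → cong (to (i′ B)) (trans (sym (l (to (i′ A) y))) (cong (to f⁻¹) (p y)))) (λ _ → refl)

  paste-congʳ : ∀ A {B B₂} → B ≅ B₂ → paste A B ≅ paste A B₂
  paste-congʳ A {B} {B₂} (f , s , p , q) = f , s , (λ y → p (to (i′ A) y)) , q

  paste-enumeration : Enumeration i j → (∀ A → Enumeration incl (j′ A)) → Enumeration (incl ∘ᴱ i) j
  paste-enumeration E F = record
    { members  = concatMap (λ A → List.map (paste A) (members (F A))) (members E)
    ; complete = comp
    ; distinct = AllPairs.concat⁺
        (All.map⁺ (All.tabulate λ {A} _ → AllPairs.map⁺ (AllPairs.map
          (λ {B} {B₂} r e → r (paste-injectiveʳ A {B} {B₂} e)) (distinct (F A)))))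
        (AllPairs.map⁺ (AllPairs.map (λ {A} {A₂} r → All.map⁺ (All.tabulate λ {B} _ →
          All.map⁺ (All.tabulate λ {B₂} _ e → r (paste-injectiveˡ {A} {A₂} {B} {B₂} e))))
          (distinct E)))
    }
    where
    comp : ∀ V → Any (V ≅_) (concatMap (λ A → List.map (paste A) (members (F A))) (members E))
    comp V with split V
    ... | A , B , e = concatMap⁺ (λ A → List.map (paste A) (members (F A)))
      (Any.map (λ {A₂} e₂ → Any.map⁺ (Any.map (λ {B₂} e₃ →
          ≅-trans {A = V} {paste A B} {paste A₂ B₂} e
            (≅-trans {A = paste A B} {paste A₂ (transport {A} {A₂} e₂ B)} {paste A₂ B₂}
              (paste-transport {A} {A₂} e₂ B)
              (paste-congʳ A₂ {transport {A} {A₂} e₂ B} {B₂} e₃)))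
          (complete (F A₂) (transport {A} {A₂} e₂ B))))
        (complete E A))

-- Sums over lists in a commutative ring

module Totals (k : CommutativeRing c ℓ) where

  open CommutativeRing k renaming (Carrier to ∣k∣; refl to ≈-refl; sym to ≈-sym; trans to ≈-trans)
  open RawMonoidDefinitions +-rawMonoid using (sum)
  open SetoidReasoning setoid

  total : ∀ {b} {B : Set b} → (B → ∣k∣) → List B → ∣k∣
  total h xs = sum λ α → h (List.lookup xs α)

  total-cong : ∀ {b} {B : Set b} {h h₂ : B → ∣k∣} → (∀ x → h x ≈ h₂ x) → ∀ xs → total h xs ≈ total h₂ xs
  total-cong p []       = ≈-refl
  total-cong p (x ∷ xs) = +-cong (p x) (total-cong p xs)

  total-map : ∀ {b d} {B : Set b} {D : Set d} (h : D → ∣k∣) (g : B → D) xs →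
              total h (List.map g xs) ≈ total (h ∘ g) xs
  total-map h g []       = ≈-refl
  total-map h g (x ∷ xs) = +-congˡ (total-map h g xs)

  total-++ : ∀ {b} {B : Set b} (h : B → ∣k∣) xs ys → total h (xs ++ ys) ≈ total h xs + total h ys
  total-++ h []       ys = ≈-sym (+-identityˡ _)
  total-++ h (x ∷ xs) ys = ≈-trans (+-congˡ (total-++ h xs ys)) (≈-sym (+-assoc _ _ _))

  total-concatMap : ∀ {b d} {B : Set b} {D : Set d} (h : D → ∣k∣) (g : B → List D) xs →
                    total h (concatMap g xs) ≈ total (λ x → total h (g x)) xs
  total-concatMap h g []       = ≈-refl
  total-concatMap h g (x ∷ xs) =
    ≈-trans (total-++ h (g x) (concatMap g xs)) (+-congˡ (total-concatMap h g xs))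

  total-*ʳ : ∀ {b} {B : Set b} (h : B → ∣k∣) r xs → total h xs * r ≈ total (λ x → h x * r) xs
  total-*ʳ h r []       = zeroˡ r
  total-*ʳ h r (x ∷ xs) = ≈-trans (distribʳ r _ _) (+-congˡ (total-*ʳ h r xs))

  total-*ˡ : ∀ {b} {B : Set b} (h : B → ∣k∣) r xs → r * total h xs ≈ total (λ x → r * h x) xs
  total-*ˡ h r []       = zeroʳ r
  total-*ˡ h r (x ∷ xs) = ≈-trans (distribˡ r _ _) (+-congˡ (total-*ˡ h r xs))

  total-+ : ∀ {b} {B : Set b} (h g : B → ∣k∣) xs → total (λ x → h x + g x) xs ≈ total h xs + total g xs
  total-+ h g []       = ≈-sym (+-identityˡ _)
  total-+ h g (x ∷ xs) = ≈-trans (+-congˡ (total-+ h g xs)) (interchange _ _ _ _)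
    where open import Algebra.Properties.CommutativeSemigroup +-commutativeSemigroup using (interchange)

-- Reduction of the sum axiom to two one-point extensions

record Multiplicative (k : CommutativeRing c ℓ) : Set (Level.suc 0ℓ ⊔ c ⊔ ℓ) where
  open CommutativeRing k using (_≈_; _*_; 1#) renaming (Carrier to ∣k∣)
  field
    value      : Embedding Y X → ∣k∣
    value-cong : {i j : Embedding Y X} → i ≐ j → value i ≈ value j
    value-iso  : (i : Embedding Y X) → IsIso i → value i ≈ 1#
    value-∘    : (j : Embedding Y X) (i : Embedding Z Y) → value (j ∘ᴱ i) ≈ value j * value i

multiplicative : {k : CommutativeRing c ℓ} → Measure k → Multiplicative k
multiplicative μ = record { Measure μ }

module Balance {k : CommutativeRing c ℓ} (M : Multiplicative k) where

  open CommutativeRing k renaming (Carrier to ∣k∣; refl to ≈-refl; sym to ≈-sym; trans to ≈-trans)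
  open RawMonoidDefinitions +-rawMonoid using (sum)
  open SetoidReasoning setoid
  open Multiplicative M
  open Amalgamation using (i′; j′)
  open Totals k

  value-i′-cong : {i : Embedding Y X} {j : Embedding Y Y′} {A B : Amalgamation i j} → A ≅ B →
                  value (i′ A) ≈ value (i′ B)
  value-i′-cong {A = A} {B} (f , s , p , _) = begin
    value (i′ A)            ≈⟨ *-identityˡ _ ⟨
    1# * value (i′ A)       ≈⟨ *-congʳ (value-iso f s) ⟨
    value f * value (i′ A)  ≈⟨ value-∘ f (i′ A) ⟨
    value (f ∘ᴱ i′ A)       ≈⟨ value-cong p ⟩
    value (i′ B)            ∎

  module _ {i : Embedding Y X} {j : Embedding Y Y′} where
    open AllAmalgamations

    -- Completeness and distinctness put two systems of representatives in bijection, and isomorphic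
    -- amalgamations have equal values. Hence the sum axiom may be checked on a single enumeration.
    all-sums-agree : (As Bs : AllAmalgamations i j) →
      sum (λ α → value (i′ (member As α))) ≈ sum (λ β → value (i′ (member Bs β)))
    all-sums-agree As Bs = begin
      sum (λ α → value (i′ (member As α)))
        ≈⟨ Sum.sum-cong-≋ +-commutativeMonoid
             (λ α → value-i′-cong {A = member As α} {member Bs (f α)} (proj₂ (complete Bs (member As α)))) ⟩
      sum (λ α → value (i′ (member Bs (f α))))
        ≈⟨ Sum.sum-permute +-commutativeMonoid (λ β → value (i′ (member Bs β))) π ⟨
      sum (λ β → value (i′ (member Bs β)))      ∎
      where
      f : Fin (count As) → Fin (count Bs)
      f α = proj₁ (complete Bs (member As α))

      g : Fin (count Bs) → Fin (count As)
      g β = proj₁ (complete As (member Bs β))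

      π : Fin (count As) ↔ Fin (count Bs)
      π = mk↔ₛ′ f g
        (λ β → sym (distinct Bs (≅-trans {A = member Bs β} {member As (g β)} {member Bs (f (g β))}
          (proj₂ (complete As (member Bs β))) (proj₂ (complete Bs (member As (g β)))))))
        (λ α → sym (distinct As (≅-trans {A = member As α} {member Bs (f α)} {member As (g (f α))}
          (proj₂ (complete Bs (member As α))) (proj₂ (complete As (member Bs (f α)))))))

  Balanced : Embedding Y X → Embedding Y Y′ → Set _
  Balanced i j = Σ[ E ∈ Enumeration i j ] value i ≈ total (value ∘ i′) (members E)

  balanced⇒sum : {i : Embedding Y X} {j : Embedding Y Y′} → Balanced i j → (As : AllAmalgamations i j) →
                 value i ≈ sum (λ α → value (i′ (AllAmalgamations.member As α)))
  balanced⇒sum (E , p) As = ≈-trans p (all-sums-agree (enumeration⇒all E) As)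

  resp-balanced : {i i₂ : Embedding Y X} {j j₂ : Embedding Y Y′} → i ≐ i₂ → j ≐ j₂ →
                  Balanced i j → Balanced i₂ j₂
  resp-balanced {i = i} {i₂} {j} {j₂} p q (E , s) = resp-enumeration {i = i} {i₂} {j} {j₂} p q E , (begin
    value i₂                                                             ≈⟨ value-cong p ⟨
    value i                                                              ≈⟨ s ⟩
    total (value ∘ i′) (members E)                                       ≈⟨ total-map (value ∘ i′) (resp-amalgamation {i = i} {i₂} {j} {j₂} p q) (members E) ⟨
    total (value ∘ i′) (members (resp-enumeration {i = i} {i₂} {j} {j₂} p q E)) ∎)

  isoˡ-balanced : (i : Embedding Y X) → IsIso i → (j : Embedding Y Y′) → Balanced i j
  isoˡ-balanced i s j = iso-enumeration i s j , (begin
    value i        ≈⟨ value-iso i s ⟩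
    1#             ≈⟨ value-iso idᴱ (idᴱ , (λ _ → refl) , λ _ → refl) ⟨
    value idᴱ      ≈⟨ +-identityʳ _ ⟨
    value idᴱ + 0# ∎)

  isoʳ-balanced : (i : Embedding Y X) (j : Embedding Y Y′) → IsIso j → Balanced i j
  isoʳ-balanced i j s@(j⁻¹ , r , l) = flip-enumeration (iso-enumeration j s i) , (begin
    value i                ≈⟨ *-identityʳ _ ⟨
    value i * 1#           ≈⟨ *-congˡ (value-iso j⁻¹ (j , l , r)) ⟨
    value i * value j⁻¹    ≈⟨ value-∘ i j⁻¹ ⟨
    value (i ∘ᴱ j⁻¹)       ≈⟨ +-identityʳ _ ⟨
    value (i ∘ᴱ j⁻¹) + 0#  ∎)

  module _ {x : Carrier X} {i : Embedding Y (X ∖ x)} {j : Embedding Y Y′} where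
    open Paste {x = x} {i} {j}

    -- Expanding both factors of `value (inclusion X x) * value i` gives one term for each pair of
    -- successive amalgamations, and these pairs are exactly the pasted ones.
    pasteˡ-balanced : Balanced i j → (∀ A → Balanced (inclusion X x) (j′ A)) →
                      Balanced (inclusion X x ∘ᴱ i) j
    pasteˡ-balanced (E , s) F = paste-enumeration E (proj₁ ∘ F) , (begin
      value (inclusion X x ∘ᴱ i)
        ≈⟨ value-∘ (inclusion X x) i ⟩
      value (inclusion X x) * value i
        ≈⟨ *-congˡ s ⟩
      value (inclusion X x) * total (value ∘ i′) (members E)
        ≈⟨ total-*ˡ (value ∘ i′) _ (members E) ⟩
      total (λ A → value (inclusion X x) * value (i′ A)) (members E)
        ≈⟨ total-cong inner (members E) ⟩
      total (λ A → total (value ∘ i′) (List.map (paste A) (members (proj₁ (F A))))) (members E)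
        ≈⟨ total-concatMap (value ∘ i′) (λ A → List.map (paste A) (members (proj₁ (F A)))) (members E) ⟨
      total (value ∘ i′) (members (paste-enumeration E (proj₁ ∘ F))) ∎)
      where
      inner : ∀ A → value (inclusion X x) * value (i′ A) ≈
                    total (value ∘ i′) (List.map (paste A) (members (proj₁ (F A))))
      inner A = begin
        value (inclusion X x) * value (i′ A)
          ≈⟨ *-congʳ (proj₂ (F A)) ⟩
        total (value ∘ i′) (members (proj₁ (F A))) * value (i′ A)
          ≈⟨ total-*ʳ (value ∘ i′) _ (members (proj₁ (F A))) ⟩
        total (λ B → value (i′ B) * value (i′ A)) (members (proj₁ (F A)))
          ≈⟨ total-cong (λ B → ≈-sym (value-∘ (i′ B) (i′ A))) (members (proj₁ (F A))) ⟩
        total (λ B → value (i′ (paste A B))) (members (proj₁ (F A)))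
          ≈⟨ total-map (value ∘ i′) (paste A) (members (proj₁ (F A))) ⟨
        total (value ∘ i′) (List.map (paste A) (members (proj₁ (F A)))) ∎

    -- Each term of the sum for the first step is itself a sum over the second step. The flips are
    -- there because `paste` enlarges the left leg.
    pasteʳ-balanced : Balanced j i → (∀ A → Balanced (i′ A) (inclusion X x)) →
                      Balanced j (inclusion X x ∘ᴱ i)
    pasteʳ-balanced (E , s) F = flip-enumeration (paste-enumeration (flip-enumeration E) G) , (begin
      value j
        ≈⟨ s ⟩
      total (value ∘ i′) (members E)
        ≈⟨ total-cong inner (members E) ⟩
      total (λ A → total (value ∘ j′) (List.map (paste (flip A)) (members (G (flip A))))) (members E)
        ≈⟨ total-map (λ A → total (value ∘ j′) (List.map (paste A) (members (G A)))) flip (members E) ⟨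
      total (λ A → total (value ∘ j′) (List.map (paste A) (members (G A)))) (List.map flip (members E))
        ≈⟨ total-concatMap (value ∘ j′) (λ A → List.map (paste A) (members (G A))) (List.map flip (members E)) ⟨
      total (value ∘ j′) (members (paste-enumeration (flip-enumeration E) G))
        ≈⟨ total-map (value ∘ i′) flip (members (paste-enumeration (flip-enumeration E) G)) ⟨
      total (value ∘ i′) (members (flip-enumeration (paste-enumeration (flip-enumeration E) G))) ∎)
      where
      G : ∀ A → Enumeration (inclusion X x) (j′ A)
      G A = flip-enumeration (proj₁ (F (flip A)))

      inner : ∀ A → value (i′ A) ≈ total (value ∘ j′) (List.map (paste (flip A)) (members (G (flip A))))
      inner A = begin
        value (i′ A)
          -- `flip (flip A)` differs from `A` in its proofs only, so the two have the same `i′`.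
          ≈⟨ proj₂ (F (flip (flip A))) ⟩
        total (value ∘ i′) (members (proj₁ (F (flip (flip A)))))
          ≈⟨ total-map (value ∘ j′) flip (members (proj₁ (F (flip (flip A))))) ⟨
        total (value ∘ j′) (members (G (flip A)))
          ≈⟨ total-map (value ∘ j′) (paste (flip A)) (members (G (flip A))) ⟨
        total (value ∘ j′) (List.map (paste (flip A)) (members (G (flip A)))) ∎

  -- The new point of `i` either falls onto an element of `Y′` or remains the only element outside
  -- of it.
  i′-onePoint : {i : Embedding Y X} {j : Embedding Y Y′} → OnePoint i → (A : Amalgamation i j) →
                IsIso (i′ A) ⊎ OnePoint (i′ A)
  i′-onePoint {i = i} {j} P A with inImage? (i′ A) (to (j′ A) (OnePoint.point P))
  ... | yes (y , e) = inj₁ (onto⇒iso (i′ A) λ w → s w (Amalgamation.jointly-surjective A w))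
    where
    open OnePoint P
    s : ∀ w → _ ⊎ _ → ∃ λ y → to (i′ A) y ≡ w
    s w (inj₁ q) = q
    s w (inj₂ (x , refl)) with cover x
    ... | inj₁ refl       = y , e
    ... | inj₂ (v , refl) = to j v , Amalgamation.commutes A v
  ... | no  q = inj₂ (record
    { point = to (j′ A) point ; fresh = λ y e → q (y , e)
    ; cover = λ w → s w (Amalgamation.jointly-surjective A w) })
    where
    open OnePoint P
    s : ∀ w → _ ⊎ _ → w ≡ to (j′ A) point ⊎ ∃ λ y → to (i′ A) y ≡ w
    s w (inj₁ r) = inj₂ r
    s w (inj₂ (x , refl)) with cover x
    ... | inj₁ refl       = inj₁ refl
    ... | inj₂ (v , refl) = inj₂ (to j v , Amalgamation.commutes A v)

  module _ (base : ∀ {Y X Y′} (i : Embedding Y X) (j : Embedding Y Y′) → OnePoint i → OnePoint j →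
                   Balanced i j) where

    onePoint-balanced : (j : Embedding Y Y′) (i : Embedding Y X) → OnePoint i → Balanced i j
    onePoint-balanced = λ j i P → embedding-induction
      (λ {Y} {Y′} j → ∀ {X} (i : Embedding Y X) → OnePoint i → Balanced i j)
      (λ {_} {_} {j} {j₂} p b i P → resp-balanced {i = i} {i} {j} {j₂} (λ _ → refl) p (b i P))
      (λ j s i P → isoʳ-balanced i j s)
      (λ x j b i P → pasteʳ-balanced (b i P) λ A →
        [ (λ s → isoˡ-balanced (i′ A) s _) , (λ Q → base (i′ A) _ Q (inclusion-onePoint _ x)) ]′
          (i′-onePoint P A))
      j i P

    -- Two nested inductions: `i` is built up point by point against an arbitrary embedding, and
    -- each of these single points is carried along that embedding point by point.
    balanced : (i : Embedding Y X) (j : Embedding Y Y′) → Balanced i j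
    balanced = λ i j → embedding-induction
      (λ {Y} {X} i → ∀ {Y′} (j : Embedding Y Y′) → Balanced i j)
      (λ {_} {_} {i} {i₂} p b j → resp-balanced {i = i} {i₂} {j} {j} p (λ _ → refl) (b j))
      (λ i s j → isoˡ-balanced i s j)
      (λ x i b j → pasteˡ-balanced (b j) λ A → onePoint-balanced (j′ A) _ (inclusion-onePoint _ x))
      i j

    measure : Measure k
    measure = record
      { Multiplicative M
      ; value-sum = λ i j → balanced⇒sum (balanced i j)
      }

-- Cells and one-point extensions

record Cell (Y : Permutation) : Set where
  field
    below  : Axis → Carrier Y → Bool
    closed : ∀ a {y z} → Order Y a y z → below a z ≡ true → below a y ≡ true

open Cell

data ExtOrder (Y : Permutation) (C : Cell Y) (a : Axis) : Rel (Maybe (Carrier Y)) 0ℓ where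
  old   : ∀ {y z} → Order Y a y z → ExtOrder Y C a (just y) (just z)
  lower : ∀ {y} → below C a y ≡ true → ExtOrder Y C a (just y) nothing
  upper : ∀ {y} → below C a y ≡ false → ExtOrder Y C a nothing (just y)

private
  true≢false : ∀ {b : Bool} → b ≡ true → b ≢ false
  true≢false refl ()

extend : (Y : Permutation) → Cell Y → Permutation
extend Y C = permutation (Maybe (Carrier Y)) (suc (size Y)) (mk↔ₛ′ f g f∘g g∘f) R sto
  where
  module e = Inverse (enumeration Y)
  R = ExtOrder Y C

  f : Maybe (Carrier Y) → Fin (suc (size Y))
  f (just y) = suc (e.to y)
  f nothing  = zero

  g : Fin (suc (size Y)) → Maybe (Carrier Y)
  g zero    = nothing
  g (suc k) = just (e.from k)

  f∘g : ∀ k → f (g k) ≡ k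
  f∘g zero    = refl
  f∘g (suc k) = cong suc (e.strictlyInverseˡ k)

  g∘f : ∀ y → g (f y) ≡ y
  g∘f (just y) = cong just (e.strictlyInverseʳ y)
  g∘f nothing  = refl

  R-trans : ∀ a {u v w} → R a u v → R a v w → R a u w
  R-trans a (old p)   (old q)   = old (ordTrans Y a p q)
  R-trans a (old p)   (lower q) = lower (closed C a p q)
  R-trans a (lower p) (upper {z} q) with compare Y a _ z
  ... | tri< r _ _    = old r
  ... | tri≈ _ refl _ = contradiction q (true≢false p)
  ... | tri> _ _ r    = contradiction q (true≢false (closed C a r p))
  R-trans a (upper {y} p) (old {z = z} q) with below C a z in eq
  ... | true  = contradiction p (true≢false (closed C a q eq))
  ... | false = upper eq
  R-trans a (upper p) (lower q) = contradiction p (true≢false q)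

  R-irrefl : ∀ a {u} → ¬ R a u u
  R-irrefl a (old p) = irrefl Y a p

  R-total : ∀ a u v → R a u v ⊎ u ≡ v ⊎ R a v u
  R-total a nothing nothing = inj₂ (inj₁ refl)
  R-total a nothing (just y) with below C a y in eq
  ... | true  = inj₂ (inj₂ (lower eq))
  ... | false = inj₁ (upper eq)
  R-total a (just y) nothing with below C a y in eq
  ... | true  = inj₁ (lower eq)
  ... | false = inj₂ (inj₂ (upper eq))
  R-total a (just y) (just z) with compare Y a y z
  ... | tri< r _ _    = inj₁ (old r)
  ... | tri≈ _ refl _ = inj₂ (inj₁ refl)
  ... | tri> _ _ r    = inj₂ (inj₂ (old r))

  tri : ∀ a u v → Tri (R a u v) (u ≡ v) (R a v u)
  tri a u v with R-total a u v
  ... | inj₁ r           = tri< r (λ { refl → R-irrefl a r }) (λ s → R-irrefl a (R-trans a r s))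
  ... | inj₂ (inj₁ refl) = tri≈ (R-irrefl a) refl (R-irrefl a)
  ... | inj₂ (inj₂ r)    = tri> (λ s → R-irrefl a (R-trans a r s)) (λ { refl → R-irrefl a r }) r

  sto : ∀ a → IsStrictTotalOrder _≡_ (R a)
  sto a = record
    { isStrictPartialOrder = record
      { isEquivalence = Relation.Binary.PropositionalEquality.isEquivalence
      ; irrefl        = λ { refl → R-irrefl a }
      ; trans         = R-trans a
      ; <-resp-≈      = (λ { refl p → p }) , (λ { refl p → p })
      }
    ; compare = tri a
    }

-- The identity, split on the axis because `Order` reduces only when the axis is a constructor.
extend-order : ∀ Y C a {u v} → ExtOrder Y C a u v → Order (extend Y C) a u v
extend-order Y C place  p = p
extend-order Y C height p = p

extend-order⁻ : ∀ Y C a {u v} → Order (extend Y C) a u v → ExtOrder Y C a u v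
extend-order⁻ Y C place  p = p
extend-order⁻ Y C height p = p

extension : (Y : Permutation) (C : Cell Y) → Embedding Y (extend Y C)
extension Y C = embedding just λ a p → extend-order Y C a (old p)

extension-onePoint : ∀ Y C → OnePoint (extension Y C)
extension-onePoint Y C = record
  { point = nothing ; fresh = λ _ ()
  ; cover = λ { nothing → inj₁ refl ; (just y) → inj₂ (y , refl) } }

module _ {Y W : Permutation} (C : Cell Y) (i : Embedding Y W) (w : Carrier W)
         (lo : ∀ a y → below C a y ≡ true  → Order W a (to i y) w)
         (hi : ∀ a y → below C a y ≡ false → Order W a w (to i y)) where

  extend-map : Embedding (extend Y C) W
  extend-map = embedding f λ a p → m a (extend-order⁻ Y C a p)
    where
    f : Maybe (Carrier Y) → Carrier W
    f (just y) = to i y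
    f nothing  = w

    m : ∀ a {u v} → ExtOrder Y C a u v → Order W a (f u) (f v)
    m a (old p)   = mono i a p
    m a (lower p) = lo a _ p
    m a (upper p) = hi a _ p

_<ᵇ_ : ∀ {X a} → Carrier X → Carrier X → Bool
_<ᵇ_ {X} {a} x y = does (_<?_ {X} {a} x y)

<ᵇ-true : ∀ X a {x y} → Order X a x y → _<ᵇ_ {X} {a} x y ≡ true
<ᵇ-true X a {x} {y} = dec-true (_<?_ {X} {a} x y)

<ᵇ-false : ∀ X a {x y} → ¬ Order X a x y → _<ᵇ_ {X} {a} x y ≡ false
<ᵇ-false X a {x} {y} = dec-false (_<?_ {X} {a} x y)

<ᵇ-true⁻ : ∀ X a {x y} → _<ᵇ_ {X} {a} x y ≡ true → Order X a x y
<ᵇ-true⁻ X a {x} {y} e with _<?_ {X} {a} x y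
... | yes p = p

<ᵇ-false⁻ : ∀ X a {x y} → _<ᵇ_ {X} {a} x y ≡ false → x ≢ y → Order X a y x
<ᵇ-false⁻ X a {x} {y} e x≢y with compare X a x y
... | tri> _ _ r = r
... | tri≈ _ r _ = contradiction r x≢y

cellOf : (i : Embedding Y X) (x : Carrier X) → Cell Y
cellOf {X = X} i x = record
  { below  = λ a y → _<ᵇ_ {X} {a} (to i y) x
  ; closed = λ a p q → <ᵇ-true X a (ordTrans X a (mono i a p) (<ᵇ-true⁻ X a q))
  }

-- This turns values of arbitrary one-point extensions into values of cells.
extend≅ : (i : Embedding Y X) (P : OnePoint i) →
          Σ[ f ∈ Embedding (extend Y (cellOf i (OnePoint.point P))) X ]
            IsIso f × f ∘ᴱ extension Y (cellOf i (OnePoint.point P)) ≐ i × to f nothing ≡ OnePoint.point P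
extend≅ {Y} {X} i P = f , onto⇒iso f s , (λ _ → refl) , refl
  where
  open OnePoint P
  C = cellOf i point

  f : Embedding (extend Y C) X
  f = extend-map C i point (λ a y → <ᵇ-true⁻ X a) (λ a y e → <ᵇ-false⁻ X a e (fresh y))

  s : Onto f
  s x with cover x
  ... | inj₁ refl       = nothing , refl
  ... | inj₂ (y , refl) = just y , refl

optional : ∀ {p b} {P : Set p} {B : Set b} → Dec P → (P → B) → List B
optional (yes p) f = f p ∷ []
optional (no _)  f = []

optional-any : ∀ {p b q} {P : Set p} {B : Set b} (P? : Dec P) (f : P → B) {Q : B → Set q} →
               P → (∀ p → Q (f p)) → Any Q (optional P? f)
optional-any (yes p) f _ q = here (q p)
optional-any (no ¬p) f p q = contradiction p ¬p

optional-all : ∀ {p b q} {P : Set p} {B : Set b} (P? : Dec P) (f : P → B) {Q : B → Set q} →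
               (∀ p → Q (f p)) → All Q (optional P? f)
optional-all (yes p) f q = q p ∷ []
optional-all (no ¬p) f q = []

optional-pairs : ∀ {p b q} {P : Set p} {B : Set b} (P? : Dec P) (f : P → B) {Q : B → B → Set q} →
                 AllPairs Q (optional P? f)
optional-pairs (yes p) f = [] ∷ []
optional-pairs (no ¬p) f = []

-- Amalgamations of two one-point extensions

module OnePointAmalgamations {Y X Y′ : Permutation} (i : Embedding Y X) (j : Embedding Y Y′)
                             (P : OnePoint i) (Q : OnePoint j) where

  open OnePoint P renaming (point to x; fresh to x-fresh; cover to X-cover)
  open OnePoint Q renaming (point to p; fresh to p-fresh; cover to Y′-cover)

  -- Allowed a true (false): on the axis a, some amalgamation places p below (above) x.

  Allowed : Axis → Bool → Set
  Allowed a true  = ∀ y → Order Y′ a (to j y) p → Order X a (to i y) x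
  Allowed a false = ∀ y → Order Y′ a p (to j y) → Order X a x (to i y)

  allowed? : ∀ a b → Dec (Allowed a b)
  allowed? a true  = all? Y λ y → _<?_ {Y′} {a} (to j y) p →-dec _<?_ {X} {a} (to i y) x
  allowed? a false = all? Y λ y → _<?_ {Y′} {a} p (to j y) →-dec _<?_ {X} {a} x (to i y)

  Option : Axis → Set
  Option a = Σ Bool (Allowed a)

  options : ∀ a → List (Option a)
  options a = optional (allowed? a true) (true ,_) ++ optional (allowed? a false) (false ,_)

  choice : Option place → Option height → ∀ a → Option a
  choice o₁ o₂ place  = o₁
  choice o₁ o₂ height = o₂

  -- The outcome of `Y′-cover z` is an argument, so that proofs can split on it.
  side : Axis → Bool → (z : Carrier Y′) → z ≡ p ⊎ (∃ λ y → to j y ≡ z) → Bool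
  side a b z (inj₁ _)       = b
  side a b z (inj₂ (y , _)) = _<ᵇ_ {X} {a} (to i y) x

  side-mono : ∀ a (o : Option a) {u v} → Order Y′ a u v → ∀ cu cv →
              side a (proj₁ o) v cv ≡ true → side a (proj₁ o) u cu ≡ true
  side-mono a o u<v (inj₁ refl) (inj₁ refl) e = e
  side-mono a (true  , A) u<v (inj₁ refl) (inj₂ (z , refl)) e = refl
  side-mono a (false , A) u<v (inj₁ refl) (inj₂ (z , refl)) e =
    contradiction (<ᵇ-true⁻ X a e) (asym X a (A z u<v))
  side-mono a (true  , A) u<v (inj₂ (y , refl)) (inj₁ refl) e = <ᵇ-true X a (A y u<v)
  side-mono a o u<v (inj₂ (y , refl)) (inj₂ (z , refl)) e =
    <ᵇ-true X a (ordTrans X a (mono i a (reflects j a u<v)) (<ᵇ-true⁻ X a e))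

  -- The cell of `Y′` which receives `x`. The sides of the old elements are dictated by `i`; only
  -- the side of `p` is a choice.
  cell : (∀ a → Option a) → Cell Y′
  cell o = record
    { below  = λ a z → side a (proj₁ (o a)) z (Y′-cover z)
    ; closed = λ a {u} {v} u<v → side-mono a (o a) u<v (Y′-cover u) (Y′-cover v)
    }

  below-old : ∀ o a y → below (cell o) a (to j y) ≡ _<ᵇ_ {X} {a} (to i y) x
  below-old o a y with Y′-cover (to j y)
  ... | inj₁ e       = contradiction e (p-fresh y)
  ... | inj₂ (z , e) = cong (λ y → _<ᵇ_ {X} {a} (to i y) x) (injective j e)

  below-new : ∀ o a → below (cell o) a p ≡ proj₁ (o a)
  below-new o a with Y′-cover p
  ... | inj₁ e       = refl
  ... | inj₂ (z , e) = contradiction e (p-fresh z)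

  private
    mapX : {W : Permutation} → Carrier W → (Carrier Y → Carrier W) → (v : Carrier X) →
           v ≡ x ⊎ (∃ λ y → to i y ≡ v) → Carrier W
    mapX w f v (inj₁ _)       = w
    mapX w f v (inj₂ (y , _)) = f y

    embX : {W : Permutation} (f : Embedding Y W) (w : Carrier W) →
           (∀ a y → Order X a (to i y) x → Order W a (to f y) w) →
           (∀ a y → Order X a x (to i y) → Order W a w (to f y)) → Embedding X W
    embX {W} f w lo hi = embedding (λ v → mapX {W} w (to f) v (X-cover v))
      λ a {u} {v} u<v → m a u<v (X-cover u) (X-cover v)
      where
      m : ∀ a {u v} → Order X a u v → ∀ cu cv → Order W a (mapX {W} w (to f) u cu) (mapX {W} w (to f) v cv)
      m a u<v (inj₁ refl)       (inj₁ refl)       = contradiction u<v (irrefl X a)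
      m a u<v (inj₁ refl)       (inj₂ (z , refl)) = hi a z u<v
      m a u<v (inj₂ (y , refl)) (inj₁ refl)       = lo a y u<v
      m a u<v (inj₂ (y , refl)) (inj₂ (z , refl)) = mono f a (reflects i a u<v)

    mapX-old : ∀ {W} w f y → mapX {W} w f (to i y) (X-cover (to i y)) ≡ f y
    mapX-old w f y with X-cover (to i y)
    ... | inj₁ e       = contradiction e (x-fresh y)
    ... | inj₂ (z , e) = cong f (injective i e)

    mapX-new : ∀ {W} w f → mapX {W} w f x (X-cover x) ≡ w
    mapX-new w f with X-cover x
    ... | inj₁ e       = refl
    ... | inj₂ (z , e) = contradiction e (x-fresh z)

  separate : Option place → Option height → Amalgamation i j
  separate o₁ o₂ = record
    { X′ = extend Y′ C
    ; i′ = extension Y′ C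
    ; j′ = j₂
    ; commutes = λ y → sym (mapX-old {extend Y′ C} nothing (λ y → just (to j y)) y)
    ; jointly-surjective = λ where
        (just z) → inj₁ (z , refl)
        nothing  → inj₂ (x , mapX-new {extend Y′ C} nothing (λ y → just (to j y)))
    }
    where
    o = choice o₁ o₂
    C = cell o

    j₂ : Embedding X (extend Y′ C)
    j₂ = embX (extension Y′ C ∘ᴱ j) nothing
      (λ a y q → extend-order Y′ C a (lower (trans (below-old o a y) (<ᵇ-true X a q))))
      (λ a y q → extend-order Y′ C a (upper (trans (below-old o a y) (<ᵇ-false X a (asym X a q)))))

  -- The four conditions together say that `x` and `p` lie in the same cell of `Y`, which is when
  -- they can be identified.
  AllAllowed : Set
  AllAllowed = (Allowed place true × Allowed place false) × (Allowed height true × Allowed height false)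

  allAllowed? : Dec AllAllowed
  allAllowed? = (allowed? place true ×-dec allowed? place false) ×-dec
                (allowed? height true ×-dec allowed? height false)

  merge : AllAllowed → Amalgamation i j
  merge A = record
    { X′ = Y′ ; i′ = idᴱ ; j′ = j₂
    ; commutes = λ y → sym (mapX-old {Y′} p (to j) y)
    ; jointly-surjective = λ z → inj₁ (z , refl) }
    where
    allowed : ∀ a b → Allowed a b
    allowed place  true  = proj₁ (proj₁ A)
    allowed place  false = proj₂ (proj₁ A)
    allowed height true  = proj₁ (proj₂ A)
    allowed height false = proj₂ (proj₂ A)

    lo : ∀ a y → Order X a (to i y) x → Order Y′ a (to j y) p
    lo a y q with compare Y′ a (to j y) p
    ... | tri< r _ _ = r
    ... | tri≈ _ e _ = contradiction e (p-fresh y)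
    ... | tri> _ _ r = contradiction q (asym X a (allowed a false y r))

    hi : ∀ a y → Order X a x (to i y) → Order Y′ a p (to j y)
    hi a y q with compare Y′ a (to j y) p
    ... | tri< r _ _ = contradiction q (asym X a (allowed a true y r))
    ... | tri≈ _ e _ = contradiction e (p-fresh y)
    ... | tri> _ _ r = r

    j₂ : Embedding X Y′
    j₂ = embX j p lo hi

  separateFrom : Option place → List (Amalgamation i j)
  separateFrom o₁ = List.map (separate o₁) (options height)

  separateAll : List (Amalgamation i j)
  separateAll = concatMap separateFrom (options place)

  private
    old′ new′ : (A : Amalgamation i j) → Carrier (Amalgamation.X′ A)
    old′ A = to (Amalgamation.i′ A) p
    new′ A = to (Amalgamation.j′ A) x

    ≅-lower : ∀ {A B} a → A ≅ B → Order (Amalgamation.X′ A) a (old′ A) (new′ A) →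
              Order (Amalgamation.X′ B) a (old′ B) (new′ B)
    ≅-lower {A} {B} a (f , _ , q , r) s =
      subst₂ (Order (Amalgamation.X′ B) a) (q p) (r x) (mono f a s)

    ≅-equal : ∀ {A B} → A ≅ B → old′ A ≡ new′ A → old′ B ≡ new′ B
    ≅-equal (f , _ , q , r) s = trans (sym (q p)) (trans (cong (to f) s) (r x))

    separate-lower : ∀ o₁ o₂ a → proj₁ (choice o₁ o₂ a) ≡ true →
      Order (Amalgamation.X′ (separate o₁ o₂)) a (old′ (separate o₁ o₂)) (new′ (separate o₁ o₂))
    separate-lower o₁ o₂ a e =
      subst (Order (extend Y′ C) a (just p)) (sym (mapX-new {extend Y′ C} nothing (λ y → just (to j y))))
        (extend-order Y′ C a (lower (trans (below-new (choice o₁ o₂) a) e)))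
      where C = cell (choice o₁ o₂)

    separate-lower⁻ : ∀ o₁ o₂ a →
      Order (Amalgamation.X′ (separate o₁ o₂)) a (old′ (separate o₁ o₂)) (new′ (separate o₁ o₂)) →
      proj₁ (choice o₁ o₂ a) ≡ true
    separate-lower⁻ o₁ o₂ a q with extend-order⁻ Y′ C a
      (subst (Order (extend Y′ C) a (just p)) (mapX-new {extend Y′ C} nothing (λ y → just (to j y))) q)
      where C = cell (choice o₁ o₂)
    ... | lower e = trans (sym (below-new (choice o₁ o₂) a)) e

    separate-unequal : ∀ o₁ o₂ → old′ (separate o₁ o₂) ≢ new′ (separate o₁ o₂)
    separate-unequal o₁ o₂ e with trans e (mapX-new {extend Y′ (cell (choice o₁ o₂))} nothing (λ y → just (to j y)))
    ... | ()

    bool-ext : ∀ {b d : Bool} → (b ≡ true → d ≡ true) → (d ≡ true → b ≡ true) → b ≡ d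
    bool-ext {true}  {d}     f g = sym (f refl)
    bool-ext {false} {true}  f g = g refl
    bool-ext {false} {false} f g = refl

    -- The options are read off from the order between the images of `p` and `x`, and isomorphisms
    -- of amalgamations preserve that order.
    separate-choice : ∀ {o₁ o₂ q₁ q₂} → separate o₁ o₂ ≅ separate q₁ q₂ →
                      ∀ a → proj₁ (choice o₁ o₂ a) ≡ proj₁ (choice q₁ q₂ a)
    separate-choice {o₁} {o₂} {q₁} {q₂} e a = bool-ext
      (λ t → separate-lower⁻ q₁ q₂ a (≅-lower {separate o₁ o₂} {separate q₁ q₂} a e (separate-lower o₁ o₂ a t)))
      (λ t → separate-lower⁻ o₁ o₂ a (≅-lower {separate q₁ q₂} {separate o₁ o₂} a
        (≅-sym {A = separate o₁ o₂} {separate q₁ q₂} e) (separate-lower q₁ q₂ a t)))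

    options-distinct : ∀ a → AllPairs (λ o q → proj₁ o ≢ proj₁ q) (options a)
    options-distinct a = AllPairs.++⁺ (optional-pairs (allowed? a true) (true ,_))
      (optional-pairs (allowed? a false) (false ,_))
      (optional-all (allowed? a true) (true ,_) λ _ → optional-all (allowed? a false) (false ,_) λ _ ())

    option-any : ∀ a b → Allowed a b → ∀ {r} {R : Option a → Set r} → (∀ A → R (b , A)) → Any R (options a)
    option-any a true  A r = Any.++⁺ˡ (optional-any (allowed? a true) (true ,_) A r)
    option-any a false A r =
      Any.++⁺ʳ (optional (allowed? a true) (true ,_)) (optional-any (allowed? a false) (false ,_) A r)

    module _ (V : Amalgamation i j) where
      open Amalgamation V using (i′; j′; commutes) renaming (X′ to V′)

      lift-lo : ∀ a y → Order X a (to i y) x → Order V′ a (to i′ (to j y)) (new′ V)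
      lift-lo a y q = subst (λ v → Order V′ a v (new′ V)) (sym (commutes y)) (mono j′ a q)

      lift-hi : ∀ a y → Order X a x (to i y) → Order V′ a (new′ V) (to i′ (to j y))
      lift-hi a y q = subst (Order V′ a (new′ V)) (sym (commutes y)) (mono j′ a q)

      -- If `x` were below such a `y`, its image in `V` would be below the image of `p`.
      lower-allowed : ∀ a → Order V′ a (old′ V) (new′ V) ⊎ old′ V ≡ new′ V → Allowed a true
      lower-allowed a q y jy<p with compare X a (to i y) x
      ... | tri< r _ _ = r
      ... | tri≈ _ e _ = contradiction e (x-fresh y)
      ... | tri> _ _ r = contradiction (ordTrans V′ a (lift-hi a y r) (mono i′ a jy<p))
        ([ (λ s → asym V′ a s) , (λ e s → irrefl V′ a (subst (Order V′ a (new′ V)) e s)) ]′ q)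

      upper-allowed : ∀ a → Order V′ a (new′ V) (old′ V) ⊎ old′ V ≡ new′ V → Allowed a false
      upper-allowed a q y p<jy with compare X a (to i y) x
      ... | tri> _ _ r = r
      ... | tri≈ _ e _ = contradiction e (x-fresh y)
      ... | tri< r _ _ = contradiction (ordTrans V′ a (mono i′ a p<jy) (lift-lo a y r))
        ([ (λ s → asym V′ a s) , (λ e s → irrefl V′ a (subst (λ v → Order V′ a v (new′ V)) e s)) ]′ q)

      Placed : Axis → Bool → Set
      Placed a true  = Order V′ a (old′ V) (new′ V)
      Placed a false = Order V′ a (new′ V) (old′ V)

      placed : old′ V ≢ new′ V → ∀ a → ∃ λ b → Placed a b × Allowed a b
      placed ne a with compare V′ a (old′ V) (new′ V)
      ... | tri< r _ _ = true , r , lower-allowed a (inj₁ r)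
      ... | tri≈ _ e _ = contradiction e ne
      ... | tri> _ _ r = false , r , upper-allowed a (inj₁ r)

      separate≅ : ∀ o₁ o₂ → (∀ a → Placed a (proj₁ (choice o₁ o₂ a))) → V ≅ separate o₁ o₂
      separate≅ o₁ o₂ pl = ≅-sym {A = separate o₁ o₂} {V}
        (amalgamation-map⇒≅ (separate o₁ o₂) V f (λ _ → refl) comm)
        where
        o = choice o₁ o₂

        lo : ∀ a z (cz : z ≡ p ⊎ ∃ λ y → to j y ≡ z) → side a (proj₁ (o a)) z cz ≡ true →
             Order V′ a (to i′ z) (new′ V)
        lo a z (inj₁ refl) e = subst (Placed a) e (pl a)
        lo a z (inj₂ (y , refl)) e = lift-lo a y (<ᵇ-true⁻ X a e)

        hi : ∀ a z (cz : z ≡ p ⊎ ∃ λ y → to j y ≡ z) → side a (proj₁ (o a)) z cz ≡ false →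
             Order V′ a (new′ V) (to i′ z)
        hi a z (inj₁ refl) e = subst (Placed a) e (pl a)
        hi a z (inj₂ (y , refl)) e = lift-hi a y (<ᵇ-false⁻ X a e (x-fresh y))

        f : Embedding (extend Y′ (cell o)) V′
        f = extend-map (cell o) i′ (new′ V) (λ a z → lo a z (Y′-cover z)) (λ a z → hi a z (Y′-cover z))

        comm : ∀ v → to f (to (Amalgamation.j′ (separate o₁ o₂)) v) ≡ to j′ v
        comm v with X-cover v
        ... | inj₁ refl       = refl
        ... | inj₂ (y , refl) = commutes y

      merge≅ : ∀ A → old′ V ≡ new′ V → V ≅ merge A
      merge≅ A e = ≅-sym {A = merge A} {V} (amalgamation-map⇒≅ (merge A) V i′ (λ _ → refl) comm)
        where
        comm : ∀ v → to i′ (to (Amalgamation.j′ (merge A)) v) ≡ to j′ v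
        comm v with X-cover v
        ... | inj₁ refl       = e
        ... | inj₂ (y , refl) = commutes y

      locate : Any (V ≅_) (separateAll ++ optional allAllowed? merge)
      locate with _≟_ {V′} (old′ V) (new′ V)
      ... | yes e = Any.++⁺ʳ separateAll (optional-any allAllowed? merge
        ((lower-allowed place (inj₂ e) , upper-allowed place (inj₂ e)) ,
         (lower-allowed height (inj₂ e) , upper-allowed height (inj₂ e)))
        (λ A → merge≅ A e))
      ... | no ne with placed ne place | placed ne height
      ...   | b₁ , r₁ , A₁ | b₂ , r₂ , A₂ = Any.++⁺ˡ (concatMap⁺ separateFrom
        (option-any place b₁ A₁ λ A₁ → Any.map⁺ {f = separate (b₁ , A₁)} (option-any height b₂ A₂ λ A₂ →
          separate≅ (b₁ , A₁) (b₂ , A₂) λ { place → r₁ ; height → r₂ })))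

  onePoint-enumeration : Enumeration i j
  onePoint-enumeration = record
    { members  = separateAll ++ optional allAllowed? merge
    ; complete = locate
    ; distinct = AllPairs.++⁺
        (AllPairs.concat⁺
          (All.map⁺ {f = separateFrom} (All.tabulate λ {o₁} _ →
            AllPairs.map⁺ {f = separate o₁} (AllPairs.map
              (λ {o₂} {q₂} ne e → ne (separate-choice {o₁} {o₂} {o₁} {q₂} e height)) (options-distinct height))))
          (AllPairs.map⁺ {f = separateFrom} (AllPairs.map (λ {o₁} {q₁} ne →
            All.map⁺ {f = separate o₁} (All.tabulate λ {o₂} _ →
              All.map⁺ {f = separate q₁} (All.tabulate λ {q₂} _ e →
                ne (separate-choice {o₁} {o₂} {q₁} {q₂} e place))))
            (options-distinct place))))
        (optional-pairs allAllowed? merge)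
        (All.concat⁺ (All.map⁺ {f = separateFrom} (All.tabulate {xs = options place} λ {o₁} _ →
          All.map⁺ {f = separate o₁} (All.tabulate λ {o₂} _ →
            optional-all allAllowed? merge λ A e → separate-unequal o₁ o₂
              (≅-equal {merge A} {separate o₁ o₂} (≅-sym {A = separate o₁ o₂} {merge A} e)
                (sym (mapX-new {Y′} p (to j))))))))
    }

-- Values of cells

open Cell

-- Reversing the order by a Boolean makes the neighbour on either side of a cell a greatest element,
-- so the same proofs serve all four neighbours.
Ord : (X : Permutation) → Axis → Bool → Rel (Carrier X) 0ℓ
Ord X a true  x y = Order X a x y
Ord X a false x y = Order X a y x

Ord-trans : ∀ X a d {x y z} → Ord X a d x y → Ord X a d y z → Ord X a d x z
Ord-trans X a true  p q = ordTrans X a p q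
Ord-trans X a false p q = ordTrans X a q p

Ord-asym : ∀ X a d {x y} → Ord X a d x y → ¬ Ord X a d y x
Ord-asym X a true  = asym X a
Ord-asym X a false = asym X a

Ord-compare : ∀ X a d x y → Tri (Ord X a d x y) (x ≡ y) (Ord X a d y x)
Ord-compare X a true x y = compare X a x y
Ord-compare X a false x y with compare X a x y
... | tri< p q r = tri> r q p
... | tri≈ p q r = tri≈ r q p
... | tri> p q r = tri< r q p

Ord-mono : (i : Embedding Y X) → ∀ a d {y z} → Ord Y a d y z → Ord X a d (to i y) (to i z)
Ord-mono i a true  = mono i a
Ord-mono i a false = mono i a

module _ (X : Permutation) (a : Axis) (d : Bool) where

  Greatest : (Carrier X → Set) → Maybe (Carrier X) → Set
  Greatest U nothing  = ∀ s → ¬ U s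
  Greatest U (just m) = U m × ∀ s → U s → s ≡ m ⊎ Ord X a d s m

  -- Equalities between neighbours are proved from their specification through this lemma, not by
  -- following the recursion of `greatest`.
  Greatest-unique : ∀ {U V} m n → Greatest U m → Greatest V n →
                    (∀ s → U s → V s) → (∀ s → V s → U s) → m ≡ n
  Greatest-unique nothing  nothing  p q f g = refl
  Greatest-unique nothing  (just n) p q f g = contradiction (g n (proj₁ q)) (p n)
  Greatest-unique (just m) nothing  p q f g = contradiction (f m (proj₁ p)) (q m)
  Greatest-unique (just m) (just n) p q f g with proj₂ p n (g n (proj₁ q)) | proj₂ q m (f m (proj₁ p))
  ... | inj₁ e | _      = cong just (sym e)
  ... | _      | inj₁ e = cong just e
  ... | inj₂ r | inj₂ s = contradiction s (Ord-asym X a d r)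

  greatest : List (Carrier X) → Maybe (Carrier X)
  greatest [] = nothing
  greatest (x ∷ xs) with greatest xs
  ... | nothing = just x
  ... | just m with Ord-compare X a d m x
  ...   | tri< _ _ _ = just x
  ...   | _          = just m

  greatest-spec : ∀ xs → Greatest (_∈ xs) (greatest xs)
  greatest-spec [] s ()
  greatest-spec (x ∷ xs) with greatest xs | greatest-spec xs
  ... | nothing | p = here refl , λ { s (here e) → inj₁ e ; s (there q) → contradiction q (p s) }
  ... | just m  | p , q with Ord-compare X a d m x
  ...   | tri< r _ _ = here refl , λ where
            s (here e)  → inj₁ e
            s (there t) → inj₂ ([ (λ { refl → r }) , (λ u → Ord-trans X a d u r) ]′ (q s t))
  ...   | tri≈ _ e _ = there p , λ where
            s (here refl) → inj₁ (sym e)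
            s (there t)   → q s t
  ...   | tri> _ _ r = there p , λ where
            s (here refl) → inj₂ r
            s (there t)   → q s t

Cut : Permutation → Set
Cut X = Axis → Carrier X → Bool

neighbour : (X : Permutation) → List (Carrier X) → Cut X → Axis → Bool → Maybe (Carrier X)
neighbour X S C a d = greatest X a d (filter (λ s → C a s Bool.≟ d) S)

Beside : (X : Permutation) → List (Carrier X) → Cut X → Axis → Bool → Carrier X → Set
Beside X S C a d s = s ∈ S × C a s ≡ d

neighbour-spec : ∀ X S C a d → Greatest X a d (Beside X S C a d) (neighbour X S C a d)
neighbour-spec X S C a d with neighbour X S C a d | greatest-spec X a d (filter (λ s → C a s Bool.≟ d) S)
... | nothing | p     = λ s (q , e) → p s (∈.∈-filter⁺ (λ s → C a s Bool.≟ d) q e)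
... | just m  | p , q = ∈.∈-filter⁻ (λ s → C a s Bool.≟ d) p ,
  λ s (r , e) → q s (∈.∈-filter⁺ (λ s → C a s Bool.≟ d) r e)

-- The relative position of two elements p and q, either of which may be absent:
-- apart w s says whether q is to the left of p, and whether q is below p.

data Position : Set where
  none first second same : Position
  apart                  : Bool → Bool → Position

position : (X : Permutation) → Maybe (Carrier X) → Maybe (Carrier X) → Position
position X nothing  nothing  = none
position X nothing  (just q) = second
position X (just p) nothing  = first
position X (just p) (just q) with _≟_ {X} p q
... | yes _ = same
... | no  _ = apart (_<ᵇ_ {X} {place} q p) (_<ᵇ_ {X} {height} q p)

position-same : ∀ X p → position X (just p) (just p) ≡ same
position-same X p with _≟_ {X} p p
... | yes _ = refl
... | no  n = contradiction refl n

position-apart : ∀ X {p q} → p ≢ q →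
  position X (just p) (just q) ≡ apart (_<ᵇ_ {X} {place} q p) (_<ᵇ_ {X} {height} q p)
position-apart X {p} {q} p≢q with _≟_ {X} p q
... | yes e = contradiction e p≢q
... | no  _ = refl

<ᵇ-embed : (e : Embedding X Z) → ∀ a x y → _<ᵇ_ {Z} {a} (to e x) (to e y) ≡ _<ᵇ_ {X} {a} x y
<ᵇ-embed {X} {Z} e a x y with _<?_ {X} {a} x y
... | yes p = <ᵇ-true Z a (mono e a p)
... | no  p = <ᵇ-false Z a λ q → p (reflects e a q)

position-embed : (e : Embedding X Z) → ∀ p q →
                position Z (Maybe.map (to e) p) (Maybe.map (to e) q) ≡ position X p q
position-embed e nothing  nothing  = refl
position-embed e nothing  (just q) = refl
position-embed e (just p) nothing  = refl
position-embed {X} {Z} e (just p) (just q) with _≟_ {X} p q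
... | yes refl = position-same Z (to e p)
... | no  n    = trans (position-apart Z (λ r → n (injective e r)))
  (cong₂ apart (<ᵇ-embed e place q p) (<ᵇ-embed e height q p))

neighbour-embed : (e : Embedding X Z) → ∀ S S₂ (C : Cut X) (D : Cut Z) →
  (∀ {s} → s ∈ S → to e s ∈ S₂) → (∀ {z} → z ∈ S₂ → ∃ λ s → s ∈ S × to e s ≡ z) →
  (∀ a {s} → s ∈ S → C a s ≡ D a (to e s)) →
  ∀ a d → neighbour Z S₂ D a d ≡ Maybe.map (to e) (neighbour X S C a d)
neighbour-embed {X} {Z} e S S₂ C D f g h a d = Greatest-unique Z a d _ _
  (neighbour-spec Z S₂ D a d) (image (neighbour X S C a d) (neighbour-spec X S C a d))
  (λ s u → u) (λ s u → u)
  where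
  image : ∀ m → Greatest X a d (Beside X S C a d) m →
          Greatest Z a d (Beside Z S₂ D a d) (Maybe.map (to e) m)
  image nothing p z (q , r) with g q
  ... | s , t , refl = p s (t , trans (h a t) r)
  image (just m) ((p , r) , q) = (f p , trans (sym (h a p)) r) , λ z (u , v) → aux z u v
    where
    aux : ∀ z → z ∈ S₂ → D a z ≡ d → z ≡ to e m ⊎ Ord Z a d z (to e m)
    aux z u v with g u
    ... | s , t , refl with q s (t , trans (h a t) v)
    ...   | inj₁ refl = inj₁ refl
    ...   | inj₂ o    = inj₂ (Ord-mono e a d o)

-- A weight gives, for each corner of a cell, the contribution to the value of that
-- cell; the corner is named by its neighbours' sides: true is left, respectively below.

Weight : ∀ {c} → Set c → Set c
Weight A = Bool → Bool → Position → A

module LocalValue (k : CommutativeRing c ℓ) (φ : Weight (CommutativeRing.Carrier k)) where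

  open CommutativeRing k renaming (Carrier to ∣k∣; refl to ≈-refl; sym to ≈-sym; trans to ≈-trans)

  corners : (Bool → Bool → Position) → ∣k∣
  corners π = (φ true true (π true true) + φ false true (π false true)) +
              (φ true false (π true false) + φ false false (π false false))

  corners-cong : ∀ {π ρ} → (∀ h v → π h v ≡ ρ h v) → corners π ≡ corners ρ
  corners-cong e = cong₂ _+_
    (cong₂ _+_ (cong (φ true true) (e true true)) (cong (φ false true) (e false true)))
    (cong₂ _+_ (cong (φ true false) (e true false)) (cong (φ false false) (e false false)))

  -- The points that cut the plane form a list inside a fixed `X`. Thus all cells met while points
  -- are added one by one live in the same permutation.
  localValue : (X : Permutation) → List (Carrier X) → Cut X → ∣k∣
  localValue X S C = corners λ h v → position X (neighbour X S C place h) (neighbour X S C height v)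

  localValue-embed : (e : Embedding X Z) → ∀ S S₂ (C : Cut X) (D : Cut Z) →
    (∀ {s} → s ∈ S → to e s ∈ S₂) → (∀ {z} → z ∈ S₂ → ∃ λ s → s ∈ S × to e s ≡ z) →
    (∀ a {s} → s ∈ S → C a s ≡ D a (to e s)) →
    localValue X S C ≡ localValue Z S₂ D
  localValue-embed {X} {Z} e S S₂ C D f g h = corners-cong λ u v → sym (trans
    (cong₂ (position Z) (neighbour-embed e S S₂ C D f g h place u) (neighbour-embed e S S₂ C D f g h height v))
    (position-embed e (neighbour X S C place u) (neighbour X S C height v)))

  cutAt : (X : Permutation) → Carrier X → Cut X
  cutAt X x a s = _<ᵇ_ {X} {a} s x

  valueAtPoint : (X : Permutation) → List (Carrier X) → Carrier X → ∣k∣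
  valueAtPoint X S x = localValue X S (cutAt X x)

  cellValue : (Y : Permutation) → Cell Y → ∣k∣
  cellValue Y C = localValue Y (elements Y) (below C)

  path : (X : Permutation) → List (Carrier X) → List (Carrier X) → ∣k∣
  path X S []       = 1#
  path X S (x ∷ xs) = valueAtPoint X S x * path X (x ∷ S) xs

  -- Only the relative positions of the elements of `S` matter, not their listing. The case
  -- `e = idᴱ` serves below to replace `S` by another list with the same elements.
  path-embed : (e : Embedding X Z) → ∀ S S₂ xs →
    (∀ {s} → s ∈ S → to e s ∈ S₂) → (∀ {z} → z ∈ S₂ → ∃ λ s → s ∈ S × to e s ≡ z) →
    path X S xs ≈ path Z S₂ (List.map (to e) xs)
  path-embed e S S₂ [] f g = ≈-refl
  path-embed {X} {Z} e S S₂ (x ∷ xs) f g = *-cong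
    (reflexive (localValue-embed e S S₂ (cutAt X x) (cutAt Z (to e x)) f g λ a {s} _ → sym (<ᵇ-embed e a s x)))
    (path-embed e (x ∷ S) (to e x ∷ S₂) xs
      (λ { (here refl) → here refl ; (there p) → there (f p) })
      (λ { (here refl) → x , here refl , refl
         ; (there p) → let s , q , r = g p in s , there q , r }))

  path-++ : ∀ X S xs ys → path X S (xs ++ ys) ≈ path X S xs * path X (xs ++ S) ys
  path-++ X S []       ys = ≈-sym (*-identityˡ _)
  path-++ X S (x ∷ xs) ys = ≈-trans (*-congˡ (path-++ X (x ∷ S) xs ys))
    (≈-trans (≈-sym (*-assoc _ _ _)) (*-congˡ (≈-trans
      (path-embed idᴱ (xs ++ x ∷ S) (x ∷ xs ++ S) ys
        (λ p → [ (λ q → there (∈.∈-++⁺ˡ q)) , (λ { (here e) → here e ; (there q) → there (∈.∈-++⁺ʳ xs q) }) ]′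
          (∈.∈-++⁻ xs p))
        (λ { (here refl) → x , ∈.∈-++⁺ʳ xs (here refl) , refl
           ; (there p) → _ , [ ∈.∈-++⁺ˡ , (λ q → ∈.∈-++⁺ʳ xs (there q)) ]′ (∈.∈-++⁻ xs p) , refl }))
      (reflexive (cong (path X (x ∷ xs ++ S)) (map-id ys))))))

-- The multiplicative function defined by cell values

module Product (k : CommutativeRing c ℓ) (φ : Weight (CommutativeRing.Carrier k)) where

  open CommutativeRing k renaming (Carrier to ∣k∣; refl to ≈-refl; sym to ≈-sym; trans to ≈-trans)
  open SetoidReasoning setoid
  open LocalValue k φ

  Exchange : Set _
  Exchange = ∀ X S {x y} → x ≢ y → x ∉ S → y ∉ S →
    valueAtPoint X S x * valueAtPoint X (x ∷ S) y ≈ valueAtPoint X S y * valueAtPoint X (y ∷ S) x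

  missing : Embedding Y X → List (Carrier X)
  missing {X = X} i = filter (λ x → ¬? (inImage? i x)) (elements X)

  ∈-missing⁺ : (i : Embedding Y X) → ∀ {x} → (∀ y → to i y ≢ x) → x ∈ missing i
  ∈-missing⁺ {X = X} i {x} q = ∈.∈-filter⁺ (λ x → ¬? (inImage? i x)) (∈-elements X x) λ (y , e) → q y e

  ∈-missing⁻ : (i : Embedding Y X) → ∀ {x} → x ∈ missing i → ∀ y → to i y ≢ x
  ∈-missing⁻ {X = X} i p y e =
    proj₂ (∈.∈-filter⁻ (λ x → ¬? (inImage? i x)) {xs = elements X} p) (y , e)

  missing-unique : (i : Embedding Y X) → AllPairs _≢_ (missing i)
  missing-unique {X = X} i = AllPairs.filter⁺ (λ x → ¬? (inImage? i x)) (elements-unique X)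

  image : Embedding Y X → List (Carrier X)
  image {Y} i = List.map (to i) (elements Y)

  ∈-image⁺ : (i : Embedding Y X) → ∀ y → to i y ∈ image i
  ∈-image⁺ {Y} i y = ∈.∈-map⁺ (to i) (∈-elements Y y)

  ∈-image⁻ : (i : Embedding Y X) → ∀ {x} → x ∈ image i → ∃ λ y → to i y ≡ x
  ∈-image⁻ i p = let y , _ , e = ∈.∈-map⁻ (to i) p in y , sym e

  missing∉image : (i : Embedding Y X) → All (_∉ image i) (missing i)
  missing∉image i = All.tabulate λ p q → let y , e = ∈-image⁻ i q in ∈-missing⁻ i p y e

  value : Embedding Y X → ∣k∣
  value {X = X} i = path X (image i) (missing i)

  value-onePoint : (i : Embedding Y X) (P : OnePoint i) → value i ≈ cellValue Y (cellOf i (OnePoint.point P))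
  value-onePoint {Y} {X} i P = begin
    path X (image i) (missing i)                 ≡⟨ cong (path X (image i)) (singleton (missing i)
                                                      (∈-missing⁺ i fresh) only (missing-unique i)) ⟩
    valueAtPoint X (image i) point * 1#          ≈⟨ *-identityʳ _ ⟩
    valueAtPoint X (image i) point               ≡⟨ localValue-embed i (elements Y) (image i) (below (cellOf i point))
                                                      (cutAt X point) (λ {y} _ → ∈-image⁺ i y)
                                                      (λ p → let y , e = ∈-image⁻ i p in y , ∈-elements Y y , e)
                                                      (λ _ _ → refl) ⟨
    cellValue Y (cellOf i point)                 ∎
    where
    open OnePoint P

    only : ∀ {x} → x ∈ missing i → x ≡ point
    only {x} p with cover x
    ... | inj₁ e       = e
    ... | inj₂ (y , e) = contradiction e (∈-missing⁻ i p y)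

    singleton : ∀ xs → point ∈ xs → (∀ {x} → x ∈ xs → x ≡ point) → AllPairs _≢_ xs → xs ≡ point ∷ []
    singleton (x ∷ [])     _ f _ = cong (_∷ []) (f (here refl))
    singleton (x ∷ y ∷ xs) _ f ((x≢y ∷ _) ∷ _) =
      contradiction (trans (f (here refl)) (sym (f (there (here refl))))) x≢y

  module _ (exchange : Exchange) where

    -- A rearrangement is composed of exchanges of consecutive points. The side conditions keep the
    -- points distinct and outside of `S`, as `Exchange` demands.
    path-↭ : ∀ X S {xs ys} → xs ↭ ys → AllPairs _≢_ xs → All (_∉ S) xs → path X S xs ≈ path X S ys
    path-↭ X S Perm.refl u d = ≈-refl
    path-↭ X S (Perm.prep x p) (x≢ ∷ u) (_ ∷ d) = *-congˡ (path-↭ X (x ∷ S) p u (outside x≢ d))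
      where
      outside : ∀ {xs} → All (x ≢_) xs → All (_∉ S) xs → All (_∉ x ∷ S) xs
      outside []       []       = []
      outside (q ∷ qs) (r ∷ rs) = (λ { (here e) → q (sym e) ; (there t) → r t }) ∷ outside qs rs
    path-↭ X S {_ ∷ _ ∷ xs} {_ ∷ _ ∷ ys} (Perm.swap x y p) ((x≢y ∷ x≢) ∷ (y≢ ∷ u)) (x∉ ∷ y∉ ∷ d) = begin
      at S x * (at (x ∷ S) y * path X (y ∷ x ∷ S) xs)  ≈⟨ *-assoc _ _ _ ⟨
      at S x * at (x ∷ S) y * path X (y ∷ x ∷ S) xs    ≈⟨ *-cong (exchange X S x≢y x∉ y∉) (begin
        path X (y ∷ x ∷ S) xs                             ≈⟨ path-embed idᴱ (y ∷ x ∷ S) (x ∷ y ∷ S) xs swapped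
                                                             (λ q → _ , swapped q , refl) ⟩
        path X (x ∷ y ∷ S) (List.map (λ x → x) xs)        ≡⟨ cong (path X (x ∷ y ∷ S)) (map-id xs) ⟩
        path X (x ∷ y ∷ S) xs                             ≈⟨ path-↭ X (x ∷ y ∷ S) p u (outside x≢ y≢ d) ⟩
        path X (x ∷ y ∷ S) ys                             ∎) ⟩
      at S y * at (y ∷ S) x * path X (x ∷ y ∷ S) ys    ≈⟨ *-assoc _ _ _ ⟩
      at S y * (at (y ∷ S) x * path X (x ∷ y ∷ S) ys)  ∎
      where
      at = valueAtPoint X

      swapped : ∀ {x y z} → z ∈ x ∷ y ∷ S → z ∈ y ∷ x ∷ S
      swapped (here e)          = there (here e)
      swapped (there (here e))  = here e
      swapped (there (there q)) = there (there q)

      outside : ∀ {xs} → All (x ≢_) xs → All (y ≢_) xs → All (_∉ S) xs → All (_∉ x ∷ y ∷ S) xs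
      outside []       []       []       = []
      outside (q ∷ qs) (r ∷ rs) (t ∷ ts) =
        (λ { (here e) → q (sym e) ; (there (here e)) → r (sym e) ; (there (there e)) → t e }) ∷ outside qs rs ts
    path-↭ X S (Perm.trans p q) u d = ≈-trans (path-↭ X S p u d)
      (path-↭ X S q (PermSetoid.Unique-resp-↭ (Relation.Binary.PropositionalEquality.setoid (Carrier X)) (↭⇒↭ₛ p) u) (Perm.All-resp-↭ p d))

    path-set : ∀ X S {xs ys} → AllPairs _≢_ xs → AllPairs _≢_ ys → All (_∉ S) xs →
               (∀ {x} → x ∈ xs → x ∈ ys) → (∀ {x} → x ∈ ys → x ∈ xs) → path X S xs ≈ path X S ys
    path-set X S u v d f g = path-↭ X S (∼bag⇒↭ (unique∧set⇒bag u v (mk⇔ f g))) u d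

    value-cong : {i j : Embedding Y X} → i ≐ j → value i ≈ value j
    value-cong {Y} {X} {i} {j} p = begin
      path X (image i) (missing i)
        ≈⟨ path-set X (image i) (missing-unique i) (missing-unique j) (missing∉image i)
             (λ q → ∈-missing⁺ j λ y e → ∈-missing⁻ i q y (trans (p y) e))
             (λ q → ∈-missing⁺ i λ y e → ∈-missing⁻ j q y (trans (sym (p y)) e)) ⟩
      path X (image i) (missing j)
        ≈⟨ path-embed idᴱ (image i) (image j) (missing j)
             (λ q → let y , e = ∈-image⁻ i q in subst (_∈ image j) (trans (sym (p y)) e) (∈-image⁺ j y))
             (λ q → let y , e = ∈-image⁻ j q in
               _ , subst (_∈ image i) (trans (p y) e) (∈-image⁺ i y) , refl) ⟩
      path X (image j) (List.map (λ x → x) (missing j))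
        ≡⟨ cong (path X (image j)) (map-id (missing j)) ⟩
      path X (image j) (missing j) ∎

    value-iso : (i : Embedding Y X) → IsIso i → value i ≈ 1#
    value-iso {Y} {X} i s = reflexive (cong (path X (image i)) (empty (missing i)
      λ {x} p → let y , e = iso⇒onto i s x in ∈-missing⁻ i p y e))
      where
      empty : ∀ xs → (∀ {x} → x ∉ xs) → xs ≡ []
      empty []       f = refl
      empty (x ∷ xs) f = contradiction (here refl) (f {x})

    -- Up to order, the points missed by `j ∘ᴱ i` are the images of those missed by `i`, followed by
    -- those missed by `j`; the path then breaks in two.
    value-∘ : (j : Embedding Y X) (i : Embedding Z Y) → value (j ∘ᴱ i) ≈ value j * value i
    value-∘ {Y} {X} {Z} j i = begin
      path X (image (j ∘ᴱ i)) (missing (j ∘ᴱ i))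
        ≈⟨ path-set X (image (j ∘ᴱ i)) (missing-unique (j ∘ᴱ i)) both-unique (missing∉image (j ∘ᴱ i)) split join ⟩
      path X (image (j ∘ᴱ i)) (List.map (to j) (missing i) ++ missing j)
        ≈⟨ path-++ X (image (j ∘ᴱ i)) (List.map (to j) (missing i)) (missing j) ⟩
      path X (image (j ∘ᴱ i)) (List.map (to j) (missing i)) *
        path X (List.map (to j) (missing i) ++ image (j ∘ᴱ i)) (missing j)
        ≈⟨ *-cong first-part second-part ⟩
      value i * value j
        ≈⟨ *-comm _ _ ⟩
      value j * value i ∎
      where
      first-part : path X (image (j ∘ᴱ i)) (List.map (to j) (missing i)) ≈ value i
      first-part = ≈-sym (path-embed j (image i) (image (j ∘ᴱ i)) (missing i)
        (λ p → let z , e = ∈-image⁻ i p in subst (_∈ image (j ∘ᴱ i)) (cong (to j) e) (∈-image⁺ (j ∘ᴱ i) z))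
        (λ p → let z , e = ∈-image⁻ (j ∘ᴱ i) p in to i z , ∈-image⁺ i z , e))

      covered : ∀ y → to j y ∈ List.map (to j) (missing i) ++ image (j ∘ᴱ i)
      covered y with inImage? i y
      ... | yes (z , refl) = ∈.∈-++⁺ʳ (List.map (to j) (missing i)) (∈-image⁺ (j ∘ᴱ i) z)
      ... | no  q          = ∈.∈-++⁺ˡ (∈.∈-map⁺ (to j) (∈-missing⁺ i λ z e → q (z , e)))

      second-part : path X (List.map (to j) (missing i) ++ image (j ∘ᴱ i)) (missing j) ≈ value j
      second-part = ≈-trans (path-embed idᴱ _ (image j) (missing j)
        (λ p → [ (λ q → let y , _ , e = ∈.∈-map⁻ (to j) q in subst (_∈ image j) (sym e) (∈-image⁺ j y))
               , (λ q → let z , e = ∈-image⁻ (j ∘ᴱ i) q in subst (_∈ image j) e (∈-image⁺ j (to i z))) ]′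
               (∈.∈-++⁻ (List.map (to j) (missing i)) p))
        (λ p → let y , e = ∈-image⁻ j p in
          _ , subst (_∈ List.map (to j) (missing i) ++ image (j ∘ᴱ i)) e (covered y) , refl))
        (reflexive (cong (path X (image j)) (map-id (missing j))))

      both-unique : AllPairs _≢_ (List.map (to j) (missing i) ++ missing j)
      both-unique = AllPairs.++⁺
        (AllPairs.map⁺ (AllPairs.map (λ ne e → ne (injective j e)) (missing-unique i)))
        (missing-unique j)
        (All.map⁺ (All.tabulate λ {y} _ → All.tabulate λ q e → ∈-missing⁻ j q y e))

      split : ∀ {x} → x ∈ missing (j ∘ᴱ i) → x ∈ List.map (to j) (missing i) ++ missing j
      split {x} p with inImage? j x
      ... | no  q = ∈.∈-++⁺ʳ (List.map (to j) (missing i)) (∈-missing⁺ j λ y e → q (y , e))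
      ... | yes (y , refl) = ∈.∈-++⁺ˡ (∈.∈-map⁺ (to j)
        (∈-missing⁺ i λ z e → ∈-missing⁻ (j ∘ᴱ i) p z (cong (to j) e)))

      join : ∀ {x} → x ∈ List.map (to j) (missing i) ++ missing j → x ∈ missing (j ∘ᴱ i)
      join p with ∈.∈-++⁻ (List.map (to j) (missing i)) p
      ... | inj₂ q = ∈-missing⁺ (j ∘ᴱ i) λ z e → ∈-missing⁻ j q (to i z) e
      ... | inj₁ q with ∈.∈-map⁻ (to j) q
      ...   | y , r , refl = ∈-missing⁺ (j ∘ᴱ i) λ z e → ∈-missing⁻ i r z (injective j e)

    product : Multiplicative k
    product = record
      { value = value ; value-cong = λ {_} {_} {i} {j} → value-cong {i = i} {j} ; value-iso = value-iso ; value-∘ = value-∘ }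

module _ {k : CommutativeRing c ℓ} where

  open CommutativeRing k renaming (Carrier to ∣k∣)

  -- κ is the value of the quadrant above and to the right of the pair of elements in a
  -- given position, and the four corner contributions are the inclusion–exclusion
  -- formula for a rectangle; the missing quadrants at infinity contribute nothing, and
  -- the quadrants to the right and above a common corner count the corner itself once.

  weight : (Position → ∣k∣) → Weight ∣k∣
  weight κ true  true  π           = κ π
  weight κ false true  none        = 0#
  weight κ false true  second      = 0#
  weight κ false true  π           = - κ π
  weight κ true  false none        = 0#
  weight κ true  false first       = 0#
  weight κ true  false π           = - κ π
  weight κ false false (apart w s) = κ (apart w s)
  weight κ false false same        = κ same - 1#
  weight κ false false _           = 0#

-- Additivity of the cell formula

module Additivity (k : CommutativeRing c ℓ) (κ : Position → CommutativeRing.Carrier k) where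

  open CommutativeRing k renaming (Carrier to ∣k∣; refl to ≈-refl; sym to ≈-sym; trans to ≈-trans)
  open SetoidReasoning setoid
  open LocalValue k (weight {k = k} κ)
  open Totals k
  open import Algebra.Properties.CommutativeSemigroup +-commutativeSemigroup using (interchange; x∙yz≈y∙xz)

  private
    φ : Weight ∣k∣
    φ = weight {k = k} κ

    -x+x : ∀ x → - x + x ≈ 0#
    -x+x = -‿inverseˡ

    x-x : ∀ x → x + - x ≈ 0#
    x-x = -‿inverseʳ

    drop : ∀ {a b e f z} → e + f ≈ z → (a + e) + (f + b) ≈ (a + b) + z
    drop {a} {b} {e} {f} {z} p = begin
      (a + e) + (f + b)  ≈⟨ +-congˡ (+-comm f b) ⟩
      (a + e) + (b + f)  ≈⟨ interchange a e b f ⟩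
      (a + b) + (e + f)  ≈⟨ +-congˡ p ⟩
      (a + b) + z        ∎

  module _ (X : Permutation) where

    pick : ∀ {A : Set} → A → A → Bool → A
    pick a b true  = a
    pick a b false = b

    rectangle : (l r b t : Maybe (Carrier X)) → ∣k∣
    rectangle l r b t = corners λ h v → position X (pick l r h) (pick b t v)

    vertical-lower : ∀ p b → φ false true (position X (just p) b) + φ true true (position X (just p) b) ≈ 0#
    vertical-lower p nothing = -x+x _
    vertical-lower p (just b) with _≟_ {X} p b
    ... | yes _ = -x+x _
    ... | no  _ = -x+x _

    vertical-upper : ∀ p t → just p ≢ t →
      φ false false (position X (just p) t) + φ true false (position X (just p) t) ≈ 0#
    vertical-upper p nothing ne = +-identityˡ _
    vertical-upper p (just t) ne with _≟_ {X} p t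
    ... | yes e = contradiction (cong just e) ne
    ... | no  _ = x-x _

    -- The one case in which the contributions on a dividing line do not cancel: the dividing point
    -- is also the top neighbour.
    vertical-corner : ∀ p →
      φ false false (position X (just p) (just p)) + φ true false (position X (just p) (just p)) ≈ - 1#
    vertical-corner p rewrite position-same X p = begin
      (κ same - 1#) + - κ same  ≈⟨ +-congʳ (+-comm _ _) ⟩
      (- 1# + κ same) - κ same  ≈⟨ +-assoc _ _ _ ⟩
      - 1# + (κ same - κ same)  ≈⟨ +-congˡ (x-x _) ⟩
      - 1# + 0#                 ≈⟨ +-identityʳ _ ⟩
      - 1#                      ∎

    horizontal-left : ∀ p l → φ true false (position X l (just p)) + φ true true (position X l (just p)) ≈ 0#
    horizontal-left p nothing = -x+x _
    horizontal-left p (just l) with _≟_ {X} l p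
    ... | yes _ = -x+x _
    ... | no  _ = -x+x _

    horizontal-right : ∀ p r → just p ≢ r →
      φ false false (position X r (just p)) + φ false true (position X r (just p)) ≈ 0#
    horizontal-right p nothing ne = +-identityˡ _
    horizontal-right p (just r) ne with _≟_ {X} r p
    ... | yes e = contradiction (cong just (sym e)) ne
    ... | no  _ = x-x _

    -- On the vertical line of `p` the two bottom corners cancel, and the two top corners leave `z`.
    vertical-split : ∀ l r b t p {z} →
      φ false false (position X (just p) t) + φ true false (position X (just p) t) ≈ z →
      rectangle l (just p) b t + rectangle (just p) r b t ≈ rectangle l r b t + z
    vertical-split l r b t p {z} e = begin
      rectangle l (just p) b t + rectangle (just p) r b t
        ≈⟨ interchange _ _ _ _ ⟩
      _ ≈⟨ +-cong (≈-trans (drop (vertical-lower p b)) (+-identityʳ _)) (drop e) ⟩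
      _ ≈⟨ +-assoc _ _ _ ⟨
      rectangle l r b t + z ∎

    horizontal-split : ∀ l r b t p → just p ≢ r →
      rectangle l r b (just p) + rectangle l r (just p) t ≈ rectangle l r b t
    horizontal-split l r b t p ne = begin
      rectangle l r b (just p) + rectangle l r (just p) t
        ≈⟨ +-congʳ (interchange _ _ _ _) ⟩
      _ ≈⟨ +-congˡ (interchange _ _ _ _) ⟩
      _ ≈⟨ interchange _ _ _ _ ⟩
      _ ≈⟨ +-cong (drop (horizontal-left p l)) (drop (horizontal-right p r ne)) ⟩
      _ ≈⟨ +-cong (+-identityʳ _) (+-identityʳ _) ⟩
      _ ≈⟨ interchange _ _ _ _ ⟩
      rectangle l r b t ∎

    -- The lower left quarter has `p` as right and as top neighbour, hence the correction `- 1#`.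
    -- The added `1#`, which is the contribution of the merged amalgamation, makes up for it.
    quarters : ∀ l r b t p → just p ≢ r → just p ≢ t →
      (rectangle (just p) r (just p) t + rectangle (just p) r b (just p)) +
      (rectangle l (just p) (just p) t + rectangle l (just p) b (just p)) + 1# ≈ rectangle l r b t
    quarters l r b t p p≢r p≢t = begin
      (rectangle (just p) r (just p) t + rectangle (just p) r b (just p)) +
      (rectangle l (just p) (just p) t + rectangle l (just p) b (just p)) + 1#
        ≈⟨ +-congʳ (≈-trans (+-comm _ _) (interchange _ _ _ _)) ⟩
      (rectangle l (just p) (just p) t + rectangle (just p) r (just p) t) +
      (rectangle l (just p) b (just p) + rectangle (just p) r b (just p)) + 1#
        ≈⟨ +-congʳ (+-cong (vertical-split l r (just p) t p (vertical-upper p t p≢t))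
                           (vertical-split l r b (just p) p (vertical-corner p))) ⟩
      (rectangle l r (just p) t + 0#) + (rectangle l r b (just p) - 1#) + 1#
        ≈⟨ +-congʳ (+-congʳ (+-identityʳ _)) ⟩
      rectangle l r (just p) t + (rectangle l r b (just p) - 1#) + 1#
        ≈⟨ +-assoc _ _ _ ⟩
      rectangle l r (just p) t + ((rectangle l r b (just p) - 1#) + 1#)
        ≈⟨ +-congˡ (≈-trans (+-assoc _ _ _) (≈-trans (+-congˡ (-x+x _)) (+-identityʳ _))) ⟩
      rectangle l r (just p) t + rectangle l r b (just p)
        ≈⟨ +-comm _ _ ⟩
      rectangle l r b (just p) + rectangle l r (just p) t
        ≈⟨ horizontal-split l r b t p p≢r ⟩
      rectangle l r b t ∎

  rectangle-cong : ∀ X {l l₂ r r₂ b b₂ t t₂} → l ≡ l₂ → r ≡ r₂ → b ≡ b₂ → t ≡ t₂ →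
                   rectangle X l r b t ≈ rectangle X l₂ r₂ b₂ t₂
  rectangle-cong X refl refl refl refl = ≈-refl

  cellValue-rectangle : ∀ Y C → let n = neighbour Y (elements Y) (below C) in
    cellValue Y C ≈ rectangle Y (n place true) (n place false) (n height true) (n height false)
  cellValue-rectangle Y C = ≈-refl

  module _ {Y X Y′ : Permutation} (i : Embedding Y X) (j : Embedding Y Y′)
           (P : OnePoint i) (Q : OnePoint j) where

    open OnePointAmalgamations i j P Q
    open OnePoint P renaming (point to x; fresh to x-fresh)
    open OnePoint Q renaming (point to p; fresh to p-fresh; cover to Y′-cover)

    n : Axis → Bool → Maybe (Carrier Y)
    n = neighbour Y (elements Y) (below (cellOf i x))

    N : Axis → Bool → Maybe (Carrier Y′)
    N a d = Maybe.map (to j) (n a d)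

    M : (∀ a → Option a) → Axis → Bool → Maybe (Carrier Y′)
    M o = neighbour Y′ (elements Y′) (below (cell o))

    M-spec : ∀ o a d → Greatest Y′ a d (Beside Y′ (elements Y′) (below (cell o)) a d) (M o a d)
    M-spec o = neighbour-spec Y′ (elements Y′) (below (cell o))

    side⇒Ord : ∀ a d {y} → _<ᵇ_ {X} {a} (to i y) x ≡ d → Ord X a d (to i y) x
    side⇒Ord a true  e = <ᵇ-true⁻ X a e
    side⇒Ord a false e = <ᵇ-false⁻ X a e (x-fresh _)

    Ord⇒side : ∀ a d {y} → Ord X a d (to i y) x → _<ᵇ_ {X} {a} (to i y) x ≡ d
    Ord⇒side a true  r = <ᵇ-true X a r
    Ord⇒side a false r = <ᵇ-false X a (asym X a r)

    allowed⇒ : ∀ a d → Allowed a d → ∀ y → Ord Y′ a d (to j y) p → Ord X a d (to i y) x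
    allowed⇒ a true  A = A
    allowed⇒ a false A = A

    ⇒allowed : ∀ a d → (∀ y → Ord Y′ a d (to j y) p → Ord X a d (to i y) x) → Allowed a d
    ⇒allowed a true  A = A
    ⇒allowed a false A = A

    Ord-not : ∀ Z a d {u v} → Ord Z a (not d) u v → Ord Z a d v u
    Ord-not Z a true  r = r
    Ord-not Z a false r = r

    Ord-not⁻ : ∀ Z a d {u v} → Ord Z a d v u → Ord Z a (not d) u v
    Ord-not⁻ Z a true  r = r
    Ord-not⁻ Z a false r = r

    -- An element of `Y` that is beyond `p` is also beyond `y`, and `y` is already on the side `d`
    -- of `x`.
    blocked : ∀ a d y → Ord X a d (to i y) x → Ord Y′ a d p (to j y) → Allowed a d
    blocked a d y iy<x p<jy = ⇒allowed a d λ z jz<p →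
      Ord-trans X a d (Ord-mono i a d (Ord-reflects (Ord-trans Y′ a d jz<p p<jy))) iy<x
      where
      Ord-reflects : ∀ {u v} → Ord Y′ a d (to j u) (to j v) → Ord Y a d u v
      Ord-reflects {u} {v} r with Ord-compare Y a d u v
      ... | tri< q _ _    = q
      ... | tri≈ _ refl _ = contradiction r (Ord-asym Y′ a d r)
      ... | tri> _ _ q    = contradiction r (Ord-asym Y′ a d (Ord-mono j a d q))

    allowed-or : ∀ a → ¬ Allowed a true → Allowed a false
    allowed-or a ¬A y p<jy with compare X a (to i y) x
    ... | tri> _ _ r = r
    ... | tri≈ _ e _ = contradiction e (x-fresh y)
    ... | tri< r _ _ = contradiction (blocked a true y r p<jy) ¬A

    image-greatest : ∀ a d (U : Carrier Y′ → Set) →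
      (∀ y → U (to j y) → Ord X a d (to i y) x) → (∀ y → Ord X a d (to i y) x → U (to j y)) →
      (U p → ∃ λ m → n a d ≡ just m × Ord Y′ a d p (to j m)) → Greatest Y′ a d U (N a d)
    image-greatest a d U f g h with n a d | neighbour-spec Y (elements Y) (below (cellOf i x)) a d
    ... | nothing | q = λ z u → aux z u (Y′-cover z)
      where
      aux : ∀ z → U z → z ≡ p ⊎ (∃ λ y → to j y ≡ z) → ⊥
      aux z u (inj₁ refl) with h u
      ... | _ , () , _
      aux z u (inj₂ (y , refl)) = q y (∈-elements Y y , Ord⇒side a d (f y u))
    ... | just m | (_ , r) , q = g m (side⇒Ord a d r) , λ z u → aux z u (Y′-cover z)
      where
      aux : ∀ z → U z → z ≡ p ⊎ (∃ λ y → to j y ≡ z) → z ≡ to j m ⊎ Ord Y′ a d z (to j m)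
      aux z u (inj₁ refl) with h u
      ... | _ , refl , r = inj₂ r
      aux z u (inj₂ (y , refl)) with q y (∈-elements Y y , Ord⇒side a d (f y u))
      ... | inj₁ refl = inj₁ refl
      ... | inj₂ s    = inj₂ (Ord-mono j a d s)

    module _ (o : ∀ a → Option a) (a : Axis) where

      U : Bool → Carrier Y′ → Set
      U d = Beside Y′ (elements Y′) (below (cell o)) a d

      U⇒ : ∀ d y → U d (to j y) → Ord X a d (to i y) x
      U⇒ d y (_ , e) = side⇒Ord a d (trans (sym (below-old o a y)) e)

      ⇒U : ∀ d y → Ord X a d (to i y) x → U d (to j y)
      ⇒U d y r = ∈-elements Y′ _ , trans (below-old o a y) (Ord⇒side a d r)

      far-side : ∀ d → proj₁ (o a) ≢ d → M o a d ≡ N a d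
      far-side d ne = Greatest-unique Y′ a d _ _ (M-spec o a d)
        (image-greatest a d (U d) (U⇒ d) (⇒U d) λ (_ , e) → contradiction (trans (sym (below-new o a)) e) ne)
        (λ _ u → u) (λ _ u → u)

      near-side : ∀ d → proj₁ (o a) ≡ d → Allowed a (not d) → M o a d ≡ just p
      near-side d e A = Greatest-unique Y′ a d _ (just p) (M-spec o a d)
        ((∈-elements Y′ p , trans (below-new o a) e) , λ z u → aux z u (Y′-cover z))
        (λ _ u → u) (λ _ u → u)
        where
        aux : ∀ z → U d z → z ≡ p ⊎ (∃ λ y → to j y ≡ z) → z ≡ p ⊎ Ord Y′ a d z p
        aux z u (inj₁ e) = inj₁ e
        aux z u (inj₂ (y , refl)) with Ord-compare Y′ a d (to j y) p
        ... | tri< r _ _ = inj₂ r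
        ... | tri≈ _ e _ = inj₁ e
        ... | tri> _ _ r = contradiction (U⇒ d y u)
          (Ord-asym X a d (Ord-not X a d (allowed⇒ a (not d) A y (Ord-not⁻ Y′ a d r))))

      -- If `p` is confined to the side `d`, some element of `Y` separates it from `x`. So `p` is
      -- hidden, and the neighbour of the cell is the old one.
      only-side : ∀ d → ¬ Allowed a (not d) → M o a d ≡ N a d
      only-side d ¬A = Greatest-unique Y′ a d _ _ (M-spec o a d)
        (image-greatest a d (U d) (U⇒ d) (⇒U d) λ _ → bound (n a d) refl)
        (λ _ u → u) (λ _ u → u)
        where
        spec : Greatest Y a d _ (n a d)
        spec = neighbour-spec Y (elements Y) (below (cellOf i x)) a d

        other-side : (∀ y → Ord X a d (to i y) x → ¬ Ord Y′ a d p (to j y)) → Allowed a (not d)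
        other-side f = ⇒allowed a (not d) λ y r → aux y (Ord-not Y′ a d r)
          where
          aux : ∀ y → Ord Y′ a d p (to j y) → Ord X a (not d) (to i y) x
          aux y r with Ord-compare X a d (to i y) x
          ... | tri< s _ _ = contradiction r (f y s)
          ... | tri≈ _ e _ = contradiction e (x-fresh y)
          ... | tri> _ _ s = Ord-not⁻ X a d s

        bound : ∀ m → n a d ≡ m → ∃ λ m → n a d ≡ just m × Ord Y′ a d p (to j m)
        bound nothing e = contradiction (other-side λ y s _ →
          subst (Greatest Y a d _) e spec y (∈-elements Y y , Ord⇒side a d s)) ¬A
        bound (just m) e with Ord-compare Y′ a d p (to j m)
        ... | tri< r _ _ = m , e , r
        ... | tri≈ _ q _ = contradiction (sym q) (p-fresh m)
        ... | tri> _ _ r = contradiction (other-side λ y s t → absurd y s t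
                             (proj₂ (subst (Greatest Y a d _) e spec) y (∈-elements Y y , Ord⇒side a d s))) ¬A
          where
          absurd : ∀ y → Ord X a d (to i y) x → Ord Y′ a d p (to j y) → y ≡ m ⊎ Ord Y a d y m → ⊥
          absurd y s t (inj₁ refl) = Ord-asym Y′ a d t r
          absurd y s t (inj₂ u)    = Ord-asym Y′ a d t (Ord-trans Y′ a d (Ord-mono j a d u) r)

    -- Each case carries the sum over `options a` which it implies, so that `sum-cases` need not
    -- inspect the decisions behind `options`.
    data Options (a : Axis) : Set (c ⊔ ℓ) where
      both : (A : Allowed a true) (B : Allowed a false) →
             ((g : Option a → ∣k∣) → total g (options a) ≈ g (true , A) + g (false , B)) → Options a
      one  : (o : Option a) → ¬ Allowed a (not (proj₁ o)) →
             ((g : Option a → ∣k∣) → total g (options a) ≈ g o) → Options a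

    optionsOf : ∀ a → Options a
    optionsOf a = go (allowed? a true) (allowed? a false) refl
      where
      go : ∀ d₁ d₂ → optional d₁ (true ,_) ++ optional d₂ (false ,_) ≡ options a → Options a
      go (yes A) (yes B) e = both A B λ g → ≈-trans (reflexive (cong (total g) (sym e))) (+-congˡ (+-identityʳ _))
      go (yes A) (no ¬B) e = one (true , A) ¬B λ g → ≈-trans (reflexive (cong (total g) (sym e))) (+-identityʳ _)
      go (no ¬A) (yes B) e = one (false , B) ¬A λ g → ≈-trans (reflexive (cong (total g) (sym e))) (+-identityʳ _)
      go (no ¬A) (no ¬B) e = contradiction (allowed-or a ¬A) ¬B

    p≢N : ∀ a d → just p ≢ N a d
    p≢N a d e with n a d
    p≢N a d e | just y = p-fresh y (sym (Maybe.just-injective e))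

    R : (l r b t : Maybe (Carrier Y′)) → ∣k∣
    R = rectangle Y′

    G : Option place → Option height → ∣k∣
    G o₁ o₂ = cellValue Y′ (cell (choice o₁ o₂))

    one-side : ∀ o a → ¬ Allowed a (not (proj₁ (o a))) → ∀ d → M o a d ≡ N a d
    one-side o a ¬A d with proj₁ (o a) Bool.≟ d
    ... | yes refl = only-side o a d ¬A
    ... | no  ne   = far-side o a d ne

    G-rectangle : ∀ o₁ o₂ {l r b t} → M (choice o₁ o₂) place true ≡ l → M (choice o₁ o₂) place false ≡ r →
                  M (choice o₁ o₂) height true ≡ b → M (choice o₁ o₂) height false ≡ t → G o₁ o₂ ≈ R l r b t
    G-rectangle o₁ o₂ e₁ e₂ e₃ e₄ =
      ≈-trans (cellValue-rectangle Y′ (cell (choice o₁ o₂))) (rectangle-cong Y′ e₁ e₂ e₃ e₄)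

    merged : Dec AllAllowed → ∣k∣
    merged (yes _) = 1#
    merged (no _)  = 0#

    merged-no : ¬ AllAllowed → merged allAllowed? ≈ 0#
    merged-no n with allAllowed?
    ... | yes q = contradiction q n
    ... | no  _ = ≈-refl

    merged-yes : AllAllowed → merged allAllowed? ≈ 1#
    merged-yes q with allAllowed?
    ... | yes _ = ≈-refl
    ... | no  n = contradiction q n

    L Rt B T : Maybe (Carrier Y′)
    L  = N place true
    Rt = N place false
    B  = N height true
    T  = N height false

    rows : Option place → ∣k∣
    rows o₁ = total (G o₁) (options height)

    -- Both options remain on an axis exactly if the corresponding line through `p` meets the cell.
    -- The cell is then left whole, halved by one line, or quartered with `p` inside it.
    sum-cases : Options place → Options height →
      total rows (options place) + merged allAllowed? ≈ R L Rt B T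
    sum-cases (one o₁ n₁ s₁) (one o₂ n₂ s₂) = begin
      _ ≈⟨ +-cong (≈-trans (s₁ rows) (s₂ (G o₁))) (merged-no λ ((A , A₂) , _) → absurd A A₂) ⟩
      G o₁ o₂ + 0# ≈⟨ +-identityʳ _ ⟩
      G o₁ o₂      ≈⟨ G-rectangle o₁ o₂ (one-side o place n₁ true) (one-side o place n₁ false)
                                        (one-side o height n₂ true) (one-side o height n₂ false) ⟩
      R L Rt B T   ∎
      where
      o = choice o₁ o₂
      absurd : Allowed place true → Allowed place false → ⊥
      absurd A A₂ with proj₁ o₁
      ... | true  = n₁ A₂
      ... | false = n₁ A
    sum-cases (both A₁ B₁ s₁) (one o₂ n₂ s₂) = begin
      _ ≈⟨ +-cong (≈-trans (s₁ rows) (+-cong (s₂ (G (true , A₁))) (s₂ (G (false , B₁))))) (merged-no λ (_ , (A , A₂)) → absurd A A₂) ⟩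
      G (true , A₁) o₂ + G (false , B₁) o₂ + 0#  ≈⟨ +-identityʳ _ ⟩
      G (true , A₁) o₂ + G (false , B₁) o₂       ≈⟨ +-comm _ _ ⟩
      G (false , B₁) o₂ + G (true , A₁) o₂
        ≈⟨ +-cong (G-rectangle (false , B₁) o₂ (far-side f place true λ ()) (near-side f place false refl A₁)
                     (one-side f height n₂ true) (one-side f height n₂ false))
                  (G-rectangle (true , A₁) o₂ (near-side t place true refl B₁) (far-side t place false λ ())
                     (one-side t height n₂ true) (one-side t height n₂ false)) ⟩
      R L (just p) B T + R (just p) Rt B T
        ≈⟨ vertical-split Y′ L Rt B T p (vertical-upper Y′ p T (p≢N height false)) ⟩
      R L Rt B T + 0#                            ≈⟨ +-identityʳ _ ⟩
      R L Rt B T                                 ∎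
      where
      t = choice (true , A₁) o₂
      f = choice (false , B₁) o₂
      absurd : Allowed height true → Allowed height false → ⊥
      absurd A A₂ with proj₁ o₂
      ... | true  = n₂ A₂
      ... | false = n₂ A
    sum-cases (one o₁ n₁ s₁) (both A₂ B₂ s₂) = begin
      _ ≈⟨ +-cong (≈-trans (s₁ rows) (s₂ (G o₁))) (merged-no λ ((A , A₂) , _) → absurd A A₂) ⟩
      G o₁ (true , A₂) + G o₁ (false , B₂) + 0#  ≈⟨ +-identityʳ _ ⟩
      G o₁ (true , A₂) + G o₁ (false , B₂)       ≈⟨ +-comm _ _ ⟩
      G o₁ (false , B₂) + G o₁ (true , A₂)
        ≈⟨ +-cong (G-rectangle o₁ (false , B₂) (one-side f place n₁ true) (one-side f place n₁ false)
                     (far-side f height true λ ()) (near-side f height false refl A₂))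
                  (G-rectangle o₁ (true , A₂) (one-side t place n₁ true) (one-side t place n₁ false)
                     (near-side t height true refl B₂) (far-side t height false λ ())) ⟩
      R L Rt B (just p) + R L Rt (just p) T
        ≈⟨ horizontal-split Y′ L Rt B T p (p≢N place false) ⟩
      R L Rt B T                                 ∎
      where
      t = choice o₁ (true , A₂)
      f = choice o₁ (false , B₂)
      absurd : Allowed place true → Allowed place false → ⊥
      absurd A A₂ with proj₁ o₁
      ... | true  = n₁ A₂
      ... | false = n₁ A
    sum-cases (both A₁ B₁ s₁) (both A₂ B₂ s₂) = begin
      _ ≈⟨ +-cong (≈-trans (s₁ rows) (+-cong (s₂ (G (true , A₁))) (s₂ (G (false , B₁))))) (merged-yes ((A₁ , B₁) , (A₂ , B₂))) ⟩
      (G (true , A₁) (true , A₂) + G (true , A₁) (false , B₂)) +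
      (G (false , B₁) (true , A₂) + G (false , B₁) (false , B₂)) + 1#
        ≈⟨ +-congʳ (+-cong
             (+-cong
               (G-rectangle (true , A₁) (true , A₂) (near-side tt place true refl B₁) (far-side tt place false λ ())
                  (near-side tt height true refl B₂) (far-side tt height false λ ()))
               (G-rectangle (true , A₁) (false , B₂) (near-side tf place true refl B₁) (far-side tf place false λ ())
                  (far-side tf height true λ ()) (near-side tf height false refl A₂)))
             (+-cong
               (G-rectangle (false , B₁) (true , A₂) (far-side ft place true λ ()) (near-side ft place false refl A₁)
                  (near-side ft height true refl B₂) (far-side ft height false λ ()))
               (G-rectangle (false , B₁) (false , B₂) (far-side ff place true λ ()) (near-side ff place false refl A₁)
                  (far-side ff height true λ ()) (near-side ff height false refl A₂)))) ⟩
      (R (just p) Rt (just p) T + R (just p) Rt B (just p)) +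
      (R L (just p) (just p) T + R L (just p) B (just p)) + 1#
        ≈⟨ quarters Y′ L Rt B T p (p≢N place false) (p≢N height false) ⟩
      R L Rt B T ∎
      where
      tt = choice (true , A₁) (true , A₂)
      tf = choice (true , A₁) (false , B₂)
      ft = choice (false , B₁) (true , A₂)
      ff = choice (false , B₁) (false , B₂)

    -- Stated for arbitrary `h` because the values of an unknown measure are summed in the same way
    -- later.
    members-total : (h : Amalgamation i j → ∣k∣) (g : Option place → Option height → ∣k∣) →
      (∀ o₁ o₂ → h (separate o₁ o₂) ≈ g o₁ o₂) → (∀ A → h (merge A) ≈ 1#) →
      total h (Enumeration.members onePoint-enumeration) ≈
      total (λ o₁ → total (g o₁) (options height)) (options place) + merged allAllowed?
    members-total h g hs hm = begin
      total h (separateAll ++ optional allAllowed? merge)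
        ≈⟨ total-++ h separateAll _ ⟩
      total h separateAll + total h (optional allAllowed? merge)
        ≈⟨ +-cong (total-concatMap h separateFrom (options place)) (last allAllowed?) ⟩
      total (λ o₁ → total h (separateFrom o₁)) (options place) + merged allAllowed?
        ≈⟨ +-congʳ (total-cong (λ o₁ → ≈-trans (total-map h (separate o₁) (options height))
             (total-cong (hs o₁) (options height))) (options place)) ⟩
      total (λ o₁ → total (g o₁) (options height)) (options place) + merged allAllowed? ∎
      where
      last : (d : Dec AllAllowed) → total h (optional d merge) ≈ merged d
      last (yes A) = ≈-trans (+-identityʳ _) (hm A)
      last (no  _) = ≈-refl

    cellValue-total : total rows (options place) + merged allAllowed? ≈ cellValue Y (cellOf i x)
    cellValue-total = begin
      total rows (options place) + merged allAllowed?
        ≈⟨ sum-cases (optionsOf place) (optionsOf height) ⟩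
      R L Rt B T
        ≈⟨ reflexive (corners-cong {λ u v → position Y′ (pick Y′ L Rt u) (pick Y′ B T v)}
             {λ u v → position Y (n place u) (n height v)} λ where
             true  true  → position-embed j (n place true) (n height true)
             true  false → position-embed j (n place true) (n height false)
             false true  → position-embed j (n place false) (n height true)
             false false → position-embed j (n place false) (n height false)) ⟩
      cellValue Y (cellOf i x) ∎

    additivity :
      (h : Amalgamation i j → ∣k∣) → (∀ o₁ o₂ → h (separate o₁ o₂) ≈ cellValue Y′ (cell (choice o₁ o₂))) →
      (∀ A → h (merge A) ≈ 1#) →
      cellValue Y (cellOf i x) ≈ total h (Enumeration.members onePoint-enumeration)
    additivity h hs hm = ≈-sym (≈-trans (members-total h G hs hm) cellValue-total)

-- The exchange law

other : Axis → Axis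
other place  = height
other height = place

-- Here `s` is the height side of the neighbour on the axis `place`, and `w` the place side of the
-- neighbour on the axis `height`, both relative to the cell. No element lies between a cell and its
-- neighbour, so these are also the sides of the two neighbours relative to each other; the first is
-- seen from the opposite end, whence `not s`.
viewPosition : Maybe Bool → Maybe Bool → Bool → Position
viewPosition nothing  nothing  c     = none
viewPosition nothing  (just w) c     = second
viewPosition (just s) nothing  c     = first
viewPosition (just s) (just w) true  = same
viewPosition (just s) (just w) false = apart w (not s)

module _ (X : Permutation) where

  private
    nb : List (Carrier X) → Carrier X → Axis → Bool → Maybe (Carrier X)
    nb S z = neighbour X S (λ a s → _<ᵇ_ {X} {a} s z)

    nb-spec : ∀ S z a d → Greatest X a d (Beside X S (λ a s → _<ᵇ_ {X} {a} s z) a d) (nb S z a d)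
    nb-spec S z = neighbour-spec X S _

  side⇒Ord : ∀ a d {s z} → s ≢ z → _<ᵇ_ {X} {a} s z ≡ d → Ord X a d s z
  side⇒Ord a true  ne e = <ᵇ-true⁻ X a e
  side⇒Ord a false ne e = <ᵇ-false⁻ X a e ne

  Ord⇒side : ∀ a d {s z} → Ord X a d s z → _<ᵇ_ {X} {a} s z ≡ d
  Ord⇒side a true  r = <ᵇ-true X a r
  Ord⇒side a false r = <ᵇ-false X a (asym X a r)

  Ord-≢ : ∀ a d {s z} → Ord X a d s z → s ≢ z
  Ord-≢ a d r refl = Ord-asym X a d r r

  Ord-reverse : ∀ a d {s z} → Ord X a d s z → Ord X a (not d) z s
  Ord-reverse a true  r = r
  Ord-reverse a false r = r

  Ord-reverse⁻ : ∀ a d {s z} → Ord X a (not d) z s → Ord X a d s z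
  Ord-reverse⁻ a true  r = r
  Ord-reverse⁻ a false r = r

  ∈-≢ : ∀ {S : List (Carrier X)} {s z} → s ∈ S → z ∉ S → s ≢ z
  ∈-≢ p q refl = q p

  nb-∈ : ∀ S z a d {m} → nb S z a d ≡ just m → m ∈ S
  nb-∈ S z a d e = proj₁ (proj₁ (subst (Greatest X a d _) e (nb-spec S z a d)))

  nb-side : ∀ S z a d {m} → nb S z a d ≡ just m → _<ᵇ_ {X} {a} m z ≡ d
  nb-side S z a d e = proj₂ (proj₁ (subst (Greatest X a d _) e (nb-spec S z a d)))

  nb-exists : ∀ S z a d {s} → s ∈ S → _<ᵇ_ {X} {a} s z ≡ d → nb S z a d ≢ nothing
  nb-exists S z a d p q e = subst (Greatest X a d _) e (nb-spec S z a d) _ (p , q)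

  -- No element lies between a cell and its neighbour, so any other element is on the same side of
  -- both.
  nb-separates : ∀ S z a d {m s} → z ∉ S → nb S z a d ≡ just m → s ∈ S → s ≢ m →
                 _<ᵇ_ {X} {a} s m ≡ _<ᵇ_ {X} {a} s z
  nb-separates S z a d {m} {s} z∉S e s∈S s≢m with subst (Greatest X a d _) e (nb-spec S z a d)
  ... | (m∈S , mz) , q with Ord-compare X a d s z
  ...   | tri≈ _ r _ = contradiction r (∈-≢ s∈S z∉S)
  ...   | tri> _ _ r = trans (Ord⇒side a (not d) (Ord-reverse a d (Ord-trans X a d m<z r)))
                             (sym (Ord⇒side a (not d) (Ord-reverse a d r)))
    where m<z = side⇒Ord a d (∈-≢ m∈S z∉S) mz
  ...   | tri< r _ _ with q s (s∈S , Ord⇒side a d r)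
  ...     | inj₁ u = contradiction u s≢m
  ...     | inj₂ u = trans (Ord⇒side a d u) (sym (Ord⇒side a d r))

  Between : List (Carrier X) → Axis → Bool → Carrier X → Carrier X → Set
  Between S a d x y = ∃ λ s → s ∈ S × Ord X a d x s × Ord X a d s y

  module _ (S : List (Carrier X)) {x y : Carrier X} (a : Axis) (d : Bool) (x<y : Ord X a d x y) where

    nb-cons-far : nb (x ∷ S) y a (not d) ≡ nb S y a (not d)
    nb-cons-far = Greatest-unique X a (not d) _ _ (nb-spec (x ∷ S) y a (not d)) (nb-spec S y a (not d))
      (λ { s (here refl , e) → contradiction (trans (sym (Ord⇒side a d x<y)) e) (Bool.not-¬ refl)
         ; s (there p , e) → p , e })
      (λ { s (p , e) → there p , e })

    nb-cons-hit : y ∉ S → ¬ Between S a d x y → nb (x ∷ S) y a d ≡ just x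
    nb-cons-hit y∉S clear = Greatest-unique X a d _ (just x) (nb-spec (x ∷ S) y a d)
      ((here refl , Ord⇒side a d x<y) , beyond) (λ _ u → u) (λ _ u → u)
      where
      beyond : ∀ s → s ∈ x ∷ S × _<ᵇ_ {X} {a} s y ≡ d → s ≡ x ⊎ Ord X a d s x
      beyond s (here e , _) = inj₁ e
      beyond s (there p , e) with Ord-compare X a d s x
      ... | tri< r _ _ = inj₂ r
      ... | tri≈ _ r _ = inj₁ r
      ... | tri> _ _ r = contradiction (s , p , r , side⇒Ord a d (∈-≢ p y∉S) e) clear

    nb-cons-miss : Between S a d x y → nb (x ∷ S) y a d ≡ nb S y a d
    nb-cons-miss (s , s∈S , x<s , s<y) = sym (Greatest-unique X a d (nb S y a d) _
      (extend-to (nb S y a d) (nb-spec S y a d)) (nb-spec (x ∷ S) y a d) (λ _ u → u) (λ _ u → u))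
      where
      extend-to : ∀ m → Greatest X a d (Beside X S (λ a s → _<ᵇ_ {X} {a} s y) a d) m →
                        Greatest X a d (Beside X (x ∷ S) (λ a s → _<ᵇ_ {X} {a} s y) a d) m
      extend-to nothing  p = contradiction (s∈S , Ord⇒side a d s<y) (p s)
      extend-to (just m) ((p , e) , q) = (there p , e) , λ where
        z (there r , t)   → q z (r , t)
        z (here refl , _) → inj₂ ([ (λ { refl → x<s }) , (λ r → Ord-trans X a d x<s r) ]′
                                    (q s (s∈S , Ord⇒side a d s<y)))

    shared-side : x ∉ S → y ∉ S → ¬ Between S a d x y → ∀ {s} → s ∈ S →
                  _<ᵇ_ {X} {a} s x ≡ _<ᵇ_ {X} {a} s y
    shared-side x∉S y∉S clear {s} p with Ord-compare X a d s x
    ... | tri< r _ _ = trans (Ord⇒side a d r) (sym (Ord⇒side a d (Ord-trans X a d r x<y)))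
    ... | tri≈ _ r _ = contradiction r (∈-≢ p x∉S)
    ... | tri> _ _ r with Ord-compare X a d s y
    ...   | tri< t _ _ = contradiction (s , p , r , t) clear
    ...   | tri≈ _ t _ = contradiction t (∈-≢ p y∉S)
    ...   | tri> _ _ t = trans (Ord⇒side a (not d) (Ord-reverse a d r))
                               (sym (Ord⇒side a (not d) (Ord-reverse a d t)))

    shared-nb : x ∉ S → y ∉ S → ¬ Between S a d x y → ∀ h → nb S x a h ≡ nb S y a h
    shared-nb x∉S y∉S clear h = Greatest-unique X a h _ _ (nb-spec S x a h) (nb-spec S y a h)
      (λ { s (p , e) → p , trans (sym (shared-side x∉S y∉S clear p)) e })
      (λ { s (p , e) → p , trans (shared-side x∉S y∉S clear p) e })

  between? : ∀ S a d x y → Dec (Between S a d x y)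
  between? S a d x y = map′ (λ p → let s , q , r = find p in s , q , r) (λ (s , q , r) → lose q r)
    (Any.any? (λ s → ord? a d x s ×-dec ord? a d s y) S)
    where
    ord? : ∀ a d u v → Dec (Ord X a d u v)
    ord? a true  u v = _<?_ {X} {a} u v
    ord? a false u v = _<?_ {X} {a} v u

  views : List (Carrier X) → Carrier X → Axis → Bool → Maybe Bool
  views S z a d = Maybe.map (λ s → _<ᵇ_ {X} {other a} s z) (nb S z a d)

  coincide′ : Maybe (Carrier X) → Maybe (Carrier X) → Bool
  coincide′ (just p) (just q) = does (_≟_ {X} p q)
  coincide′ _        _        = false

  coincide : List (Carrier X) → Carrier X → Axis → Bool → Bool → Bool
  coincide S z a h d = coincide′ (nb S z (other a) h) (nb S z a d)

  <ᵇ-flip : ∀ a {s z} → s ≢ z → _<ᵇ_ {X} {a} s z ≡ not (_<ᵇ_ {X} {a} z s)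
  <ᵇ-flip a {s} {z} ne = go (compare X a s z)
    where
    go : Tri _ _ _ → _<ᵇ_ {X} {a} s z ≡ not (_<ᵇ_ {X} {a} z s)
    go (tri< r _ _) = trans (<ᵇ-true X a r) (cong not (sym (<ᵇ-false X a (asym X a r))))
    go (tri≈ _ e _) = contradiction e ne
    go (tri> _ _ r) = trans (<ᵇ-false X a (asym X a r)) (cong not (sym (<ᵇ-true X a r)))

  position-view : ∀ S z → z ∉ S → ∀ h v →
    position X (nb S z place h) (nb S z height v) ≡
    viewPosition (views S z place h) (views S z height v) (coincide S z height h v)
  position-view S z z∉S h v with nb S z place h in e | nb S z height v in f
  ... | nothing | nothing = refl
  ... | nothing | just q  = refl
  ... | just p  | nothing = refl
  ... | just p  | just q with _≟_ {X} p q
  ...   | yes _ = refl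
  ...   | no ne = cong₂ apart
    (nb-separates S z place h z∉S e (nb-∈ S z height v f) (λ r → ne (sym r)))
    (trans (<ᵇ-flip height (λ r → ne (sym r)))
      (cong not (nb-separates S z height v z∉S f (nb-∈ S z place h e) ne)))

  coincide-view : ∀ S z a h d → coincide S z a h d ≡ true →
                  views S z (other a) h ≡ just d × views S z a d ≡ just h
  coincide-view S z a h d c with nb S z (other a) h in e | nb S z a d in f
  ... | just p | just q with _≟_ {X} p q
  ...   | yes refl = cong just (trans (cong-side a) (nb-side S z a d f)) , cong just (nb-side S z (other a) h e)
    where
    cong-side : ∀ a → _<ᵇ_ {X} {other (other a)} p z ≡ _<ᵇ_ {X} {a} p z
    cong-side place  = refl
    cong-side height = refl

  view-present : ∀ S z a h s → views S z (other a) h ≡ just s → views S z a s ≢ nothing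
  view-present S z a h s e n with nb S z (other a) h in f
  ... | just p with nb S z a s in g
  ...   | nothing = nb-exists S z a s (nb-∈ S z (other a) h f) (cong-side a (Maybe.just-injective e)) g
    where
    cong-side : ∀ a → _<ᵇ_ {X} {other (other a)} p z ≡ s → _<ᵇ_ {X} {a} p z ≡ s
    cong-side place  q = q
    cong-side height q = q

-- One bit suffices for coincidence: an element on the side `s` of a cell can only be the neighbour
-- in the direction `s`.
State : Set
State = Maybe (Bool × Bool)

stateSide : State → Maybe Bool
stateSide = Maybe.map proj₁

coincidesAt : State → Bool → Bool
coincidesAt nothing        d = false
coincidesAt (just (s , c)) d = if does (s Bool.≟ d) then c else false

-- A new element that becomes the neighbour in the direction `d` ends any coincidence in that
-- direction.
separate-from : Bool → State → State
separate-from d nothing        = nothing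
separate-from d (just (s , c)) = just (s , (if does (s Bool.≟ d) then false else c))

_[_≔_] : {A : Set} → (Bool → A) → Bool → A → Bool → A
(f [ d ≔ v ]) h = if does (h Bool.≟ d) then v else f h

-- The view from a cell relative to an axis a consists of the sides of its neighbours on a
-- and of a state for each of its neighbours on the other axis: its side on a (true is the
-- lower side), and whether it coincides with the neighbour of the cell in that direction.

module _ (X : Permutation) where

  private
    nb : List (Carrier X) → Carrier X → Axis → Bool → Maybe (Carrier X)
    nb S z = neighbour X S (λ a s → _<ᵇ_ {X} {a} s z)

    lt : Axis → Carrier X → Carrier X → Bool
    lt a s z = _<ᵇ_ {X} {a} s z

  stateOf : List (Carrier X) → Carrier X → Axis → Carrier X → Bool × Bool
  stateOf S z a p = lt a p z , coincide′ X (just p) (nb S z a (lt a p z))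

  state : List (Carrier X) → Carrier X → Axis → Bool → State
  state S z a h = Maybe.map (stateOf S z a) (nb S z (other a) h)

  state-side : ∀ S z a h → stateSide (state S z a h) ≡ views X S z (other a) h
  state-side S z a h with nb S z (other a) h
  state-side S z a      h | nothing = refl
  state-side S z place  h | just p  = refl
  state-side S z height h | just p  = refl

  coincides-state : ∀ S z a h d → coincidesAt (state S z a h) d ≡ coincide X S z a h d
  coincides-state S z a h d with nb S z (other a) h in f
  ... | nothing = refl
  ... | just p with lt a p z Bool.≟ d
  ...   | yes refl = refl
  ...   | no  ne   = sym (Bool.¬-not λ c → ne (side-eq a p f (proj₁ (coincide-view X S z a h d
            (trans (cong (λ m → coincide′ X m (nb S z a d)) f) c)))))
    where
    side-eq : ∀ a p → nb S z (other a) h ≡ just p → views X S z (other a) h ≡ just d → lt a p z ≡ d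
    side-eq place  p f v = Maybe.just-injective (trans (cong (Maybe.map _) (sym f)) v)
    side-eq height p f v = Maybe.just-injective (trans (cong (Maybe.map _) (sym f)) v)

  coincide′-sym : ∀ p q → coincide′ X p q ≡ coincide′ X q p
  coincide′-sym nothing  nothing  = refl
  coincide′-sym nothing  (just q) = refl
  coincide′-sym (just p) nothing  = refl
  coincide′-sym (just p) (just q) with _≟_ {X} p q
  ... | yes refl = sym (dec-true (_≟_ {X} p p) refl)
  ... | no  ne   = sym (dec-false (_≟_ {X} q p) λ r → ne (sym r))

  module _ (S : List (Carrier X)) {w z : Carrier X} (a : Axis) (d e : Bool) (w∉S : w ∉ S) (z∉S : z ∉ S)
           (w<z : Ord X a d w z) (w<z₂ : Ord X (other a) e w z) (clear : ¬ Between X S a d w z) where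

    hit-views : ∀ h → views X (w ∷ S) z a h ≡ (views X S z a [ d ≔ just e ]) h
    hit-views h with h Bool.≟ d
    ... | yes refl rewrite nb-cons-hit X S a d w<z z∉S clear = cong just (Ord⇒side X (other a) e w<z₂)
    ... | no  ne   = trans (cong (λ d → views X (w ∷ S) z a d) (Bool.¬-not ne))
      (trans (cong (Maybe.map _) (nb-cons-far X S a d w<z)) (cong (views X S z a) (sym (Bool.¬-not ne))))

    hit-state : ∀ {p} → p ∈ S → just (stateOf (w ∷ S) z a p) ≡ separate-from d (just (stateOf S z a p))
    hit-state {p} p∈S with lt a p z in f
    ... | s with s Bool.≟ d
    ...   | yes refl rewrite nb-cons-hit X S a d w<z z∉S clear =
      cong (λ c → just (d , c)) (dec-false (_≟_ {X} p w) (∈-≢ X p∈S w∉S))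
    ...   | no  ne   = cong (λ c → just (s , c)) (cong (coincide′ X (just p))
      (trans (cong (nb (w ∷ S) z a) (Bool.¬-not ne))
        (trans (nb-cons-far X S a d w<z) (cong (nb S z a) (sym (Bool.¬-not ne))))))

    far-state : ∀ h → nb (w ∷ S) z (other a) h ≡ nb S z (other a) h →
                state (w ∷ S) z a h ≡ separate-from d (state S z a h)
    far-state h e rewrite e with nb S z (other a) h in f
    ... | nothing = refl
    ... | just p  = hit-state (nb-∈ X S z (other a) h f)

-- Finitely many local configurations of two cells

module Views (φ : Weight ℤ) where

  open LocalValue ℤ-ring φ

  viewValue : Axis → (Bool → State) → (Bool → Maybe Bool) → ℤ
  viewValue height st q = corners λ h v → viewPosition (stateSide (st h)) (q v) (coincidesAt (st h) v)
  viewValue place  st q = corners λ h v → viewPosition (q h) (stateSide (st v)) (coincidesAt (st v) h)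

  viewValue-cong : ∀ a {st st₂ q q₂} → (∀ h → st h ≡ st₂ h) → (∀ h → q h ≡ q₂ h) →
                   viewValue a st q ≡ viewValue a st₂ q₂
  viewValue-cong height {st} {st₂} {q} {q₂} e f =
    corners-cong {λ h v → viewPosition (stateSide (st h)) (q v) (coincidesAt (st h) v)}
                 {λ h v → viewPosition (stateSide (st₂ h)) (q₂ v) (coincidesAt (st₂ h) v)}
      λ h v → cong₂ (λ s q → viewPosition (stateSide s) q (coincidesAt s v)) (e h) (f v)
  viewValue-cong place {st} {st₂} {q} {q₂} e f =
    corners-cong {λ h v → viewPosition (q h) (stateSide (st v)) (coincidesAt (st v) h)}
                 {λ h v → viewPosition (q₂ h) (stateSide (st₂ v)) (coincidesAt (st₂ v) h)}
      λ h v → cong₂ (λ s q → viewPosition q (stateSide s) (coincidesAt s h)) (e v) (f h)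

  value-view : ∀ X S z a → z ∉ S → valueAtPoint X S z ≡ viewValue a (state X S z a) (views X S z a)
  value-view X S z height z∉S =
    corners-cong {λ h v → position X (neighbour X S (cutAt X z) place h) (neighbour X S (cutAt X z) height v)}
                 {λ h v → viewPosition (stateSide (state X S z height h)) (views X S z height v)
                                       (coincidesAt (state X S z height h) v)}
      λ h v → trans (position-view X S z z∉S h v) (cong₂ (λ s c → viewPosition s (views X S z height v) c)
        (sym (state-side X S z height h)) (sym (coincides-state X S z height h v)))
  value-view X S z place z∉S =
    corners-cong {λ h v → position X (neighbour X S (cutAt X z) place h) (neighbour X S (cutAt X z) height v)}
                 {λ h v → viewPosition (views X S z place h) (stateSide (state X S z place v))
                                       (coincidesAt (state X S z place v) h)}
      λ h v → trans (position-view X S z z∉S h v) (cong₂ (λ s c → viewPosition (views X S z place h) s c)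
        (sym (state-side X S z place v))
        (sym (trans (coincides-state X S z place v h) (coincide′-sym X (neighbour X S (cutAt X z) height v) _))))

private
  _≟ᵐ_ : (u v : Maybe Bool) → Dec (u ≡ v)
  _≟ᵐ_ = Maybe.≡-dec Bool._≟_

_≟ᵛ_ : (u v : ℤ × ℤ) → Dec (u ≡ v)
_≟ᵛ_ = ×.≡-dec ℤ._≟_ ℤ._≟_

-- The lists of configurations hold pairs in place of functions on `Bool`; `sel-η` relates the two
-- pointwise.
sel : {A : Set} → A × A → Bool → A
sel (u , v) true  = u
sel (u , v) false = v

sel-η : {A : Set} (f : Bool → A) → ∀ h → sel (f true , f false) h ≡ f h
sel-η f true  = refl
sel-η f false = refl

-- A state of the h-th neighbour is consistent with the sides T of the neighbours on the
-- other axis; it faces a cell with sides T if it separates that cell from its own.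

Consistent : (Bool → Maybe Bool) → Bool → State → Set
Consistent T h nothing            = ⊤
Consistent T h (just (s , true))  = T s ≡ just h
Consistent T h (just (s , false)) = T s ≢ nothing

Facing : (Bool → Maybe Bool) → Bool → State → Set
Facing T e nothing            = ⊥
Facing T e (just (s , true))  = T s ≡ just e
Facing T e (just (s , false)) = ⊤

consistent? : ∀ T h st → Dec (Consistent T h st)
consistent? T h nothing            = yes _
consistent? T h (just (s , true))  = T s ≟ᵐ just h
consistent? T h (just (s , false)) = ¬? (T s ≟ᵐ nothing)

facing? : ∀ T e st → Dec (Facing T e st)
facing? T e nothing            = no λ ()
facing? T e (just (s , true))  = T s ≟ᵐ just e
facing? T e (just (s , false)) = yes _

states : List State
states = nothing ∷ just (true , true) ∷ just (true , false) ∷ just (false , true) ∷ just (false , false) ∷ []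

∈-states : ∀ st → st ∈ states
∈-states nothing                = here refl
∈-states (just (true , true))   = there (here refl)
∈-states (just (true , false))  = there (there (here refl))
∈-states (just (false , true))  = there (there (there (here refl)))
∈-states (just (false , false)) = there (there (there (there (here refl))))

sides : List (Maybe Bool)
sides = nothing ∷ just true ∷ just false ∷ []

∈-sides : ∀ q → q ∈ sides
∈-sides nothing      = here refl
∈-sides (just true)  = there (here refl)
∈-sides (just false) = there (there (here refl))

-- If x lies on the side e of y, the possible sides of one element relative to x and to y.

joints : Bool → List (Maybe Bool × Maybe Bool)
joints e = (nothing , nothing) ∷ (just e , just e) ∷ (just (not e) , just e) ∷ (just (not e) , just (not e)) ∷ []

module Checks (φ : Weight ℤ) where

  open LocalValue ℤ-ring φ
  open Views φ

  module Row (a : Axis) (e : Bool) (Tx Ty : Bool → Maybe Bool) where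

    ValidX ValidY : (Bool → State) → Set
    ValidX st = (Consistent Tx true (st true) × Consistent Tx false (st false)) × Facing Ty e (st (not e))
    ValidY st = (Consistent Ty true (st true) × Consistent Ty false (st false)) × Facing Tx (not e) (st e)

    validX? : ∀ st → Dec (ValidX st)
    validX? st = (consistent? Tx true (st true) ×-dec consistent? Tx false (st false)) ×-dec facing? Ty e (st (not e))

    validY? : ∀ st → Dec (ValidY st)
    validY? st = (consistent? Ty true (st true) ×-dec consistent? Ty false (st false)) ×-dec facing? Tx (not e) (st e)

    -- The values of one cell before and after the other point is added. The added point becomes a
    -- neighbour on the axis `a`: this sets one side and ends the coincidences with the former
    -- neighbour there.
    vectorX vectorY : (Bool → State) → ℤ × ℤ
    vectorX st = viewValue a st Tx ,
                 viewValue a (separate-from false ∘ st) (Tx [ false ≔ just (not e) ])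
    vectorY st = viewValue a st Ty ,
                 viewValue a (separate-from true ∘ st) (Ty [ true ≔ just e ])

    -- Validity collects necessary conditions, and every configuration that satisfies them is
    -- listed. Duplicate vectors are removed to shorten the pairwise check.
    vectorsX vectorsY : List (ℤ × ℤ)
    vectorsX = List.deduplicate _≟ᵛ_ (List.map (vectorX ∘ sel) (filter (validX? ∘ sel) (List.cartesianProduct states states)))
    vectorsY = List.deduplicate _≟ᵛ_ (List.map (vectorY ∘ sel) (filter (validY? ∘ sel) (List.cartesianProduct states states)))

    ∈-vectorsX : ∀ st → ValidX st → vectorX st ∈ vectorsX
    ∈-vectorsX st v = subst (_∈ vectorsX)
      (cong₂ _,_ (viewValue-cong a {sel (st true , st false)} {st} (sel-η st) (λ _ → refl))
                 (viewValue-cong a {separate-from false ∘ sel (st true , st false)} {separate-from false ∘ st}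
                    (λ h → cong (separate-from false) (sel-η st h)) (λ _ → refl)))
      (∈.∈-deduplicate⁺ _≟ᵛ_ (∈.∈-map⁺ (vectorX ∘ sel) {x = st true , st false} (∈.∈-filter⁺ (validX? ∘ sel) (∈.∈-cartesianProduct⁺ (∈-states (st true)) (∈-states (st false))) (valid e v))))
      where
      valid : ∀ e → (Consistent Tx true (st true) × Consistent Tx false (st false)) × Facing Ty e (st (not e)) →
              (Consistent Tx true (st true) × Consistent Tx false (st false)) ×
              Facing Ty e (sel (st true , st false) (not e))
      valid true  v = v
      valid false v = v

    ∈-vectorsY : ∀ st → ValidY st → vectorY st ∈ vectorsY
    ∈-vectorsY st v = subst (_∈ vectorsY)
      (cong₂ _,_ (viewValue-cong a {sel (st true , st false)} {st} (sel-η st) (λ _ → refl))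
                 (viewValue-cong a {separate-from true ∘ sel (st true , st false)} {separate-from true ∘ st}
                    (λ h → cong (separate-from true) (sel-η st h)) (λ _ → refl)))
      (∈.∈-deduplicate⁺ _≟ᵛ_ (∈.∈-map⁺ (vectorY ∘ sel) {x = st true , st false} (∈.∈-filter⁺ (validY? ∘ sel) (∈.∈-cartesianProduct⁺ (∈-states (st true)) (∈-states (st false))) (valid e v))))
      where
      valid : ∀ e → (Consistent Ty true (st true) × Consistent Ty false (st false)) × Facing Tx (not e) (st e) →
              (Consistent Ty true (st true) × Consistent Ty false (st false)) ×
              Facing Tx (not e) (sel (st true , st false) e)
      valid true  v = v
      valid false v = v

  Parallel : ℤ × ℤ → ℤ × ℤ → Set
  Parallel (p , q) (r , s) = p ℤ.* s ≡ r ℤ.* q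

  parallel? : ∀ u v → Dec (Parallel u v)
  parallel? (p , q) (r , s) = p ℤ.* s ℤ.≟ r ℤ.* q

  AllParallel : List (ℤ × ℤ) → List (ℤ × ℤ) → Set
  AllParallel us vs = All (λ u → All (Parallel u) vs) us

  -- Two cells between the same neighbours on `a` interact only through the sides of these
  -- neighbours. Once the sides are fixed, the states of both cells range independently, and the
  -- exchange equation says that every vector of one is parallel to every vector of the other.
  RowLaw : Axis → Bool → Set
  RowLaw a e = All (λ J → AllParallel
      (Row.vectorsX a e (proj₁ ∘ sel J) (proj₂ ∘ sel J))
      (Row.vectorsY a e (proj₁ ∘ sel J) (proj₂ ∘ sel J)))
    (List.cartesianProduct (joints e) (joints e))

  rowLaw? : ∀ a e → Dec (RowLaw a e)
  rowLaw? a e = All.all? (λ J → All.all? (λ u → All.all? (parallel? u) _) _) _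

  Present : (Bool → Maybe Bool) → Bool → State → Set
  Present q h nothing  = q true ≢ just h × q false ≢ just h
  Present q h (just _) = ⊤

  present? : ∀ q h st → Dec (Present q h st)
  present? q h nothing  = ¬? (q true ≟ᵐ just h) ×-dec ¬? (q false ≟ᵐ just h)
  present? q h (just _) = yes _

  ValidCell : (Bool → State) → (Bool → Maybe Bool) → Set
  ValidCell st q = (Consistent q true (st true) × Consistent q false (st false)) ×
                   (Present q true (st true) × Present q false (st false))

  validCell? : ∀ st q → Dec (ValidCell st q)
  validCell? st q = (consistent? q true (st true) ×-dec consistent? q false (st false)) ×-dec
                    (present? q true (st true) ×-dec present? q false (st false))

  -- The cells of y and of x after the other one, which lies in the same cell and on
  -- the side e, has been added.

  afterX afterY : Bool → (Bool → State) → (Bool → Maybe Bool) → ℤ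
  afterX e st q = viewValue height ((separate-from e ∘ st) [ true ≔ just (e , true) ]) (q [ e ≔ just true ])
  afterY e st q = viewValue height ((separate-from (not e) ∘ st) [ false ≔ just (not e , true) ])
                                   (q [ not e ≔ just false ])

  -- The two cells coincide at first. Their common value stays as a factor, so the later values have
  -- to agree only where it does not vanish.
  CellLaw : Bool → Set
  CellLaw e = All (λ J → let st = sel (proj₁ J) ; q = sel (proj₂ J) in
                         viewValue height st q ℤ.* afterX e st q ≡ viewValue height st q ℤ.* afterY e st q)
    (filter (λ J → validCell? (sel (proj₁ J)) (sel (proj₂ J)))
      (List.cartesianProduct (List.cartesianProduct states states) (List.cartesianProduct sides sides)))

  cellLaw? : ∀ e → Dec (CellLaw e)
  cellLaw? e = All.all? (λ J → _ ℤ.≟ _) _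

  Lawful : Set
  Lawful = ((RowLaw height true × RowLaw height false) × (RowLaw place true × RowLaw place false)) ×
           (CellLaw true × CellLaw false)

  lawful? : Dec Lawful
  lawful? = ((rowLaw? height true ×-dec rowLaw? height false) ×-dec (rowLaw? place true ×-dec rowLaw? place false)) ×-dec
            (cellLaw? true ×-dec cellLaw? false)

module ExchangeLaw (φ : Weight ℤ) (lawful : Checks.Lawful φ) where

  open LocalValue ℤ-ring φ
  open Views φ
  open Checks φ
  open Product ℤ-ring φ using (Exchange)

  consistent : ∀ T h st → (∀ d → coincidesAt st d ≡ true → T d ≡ just h) →
               (∀ s → stateSide st ≡ just s → T s ≢ nothing) → Consistent T h st
  consistent T h nothing f g = _
  consistent T h (just (s , true)) f g = f s (cong (if_then true else false) (dec-true (s Bool.≟ s) refl))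
  consistent T h (just (s , false)) f g = g s refl

  facing : ∀ T e st → stateSide st ≢ nothing → (∀ d → coincidesAt st d ≡ true → T d ≡ just e) → Facing T e st
  facing T e nothing f g = f refl
  facing T e (just (s , true)) f g = g s (cong (if_then true else false) (dec-true (s Bool.≟ s) refl))
  facing T e (just (s , false)) f g = _

  joint-∈ : ∀ e u w → (u ≡ e → w ≡ e) → (just u , just w) ∈ joints e
  joint-∈ true  true  true  f = there (here refl)
  joint-∈ true  true  false f = contradiction (f refl) λ ()
  joint-∈ true  false true  f = there (there (here refl))
  joint-∈ true  false false f = there (there (there (here refl)))
  joint-∈ false false false f = there (here refl)
  joint-∈ false false true  f = contradiction (f refl) λ ()
  joint-∈ false true  false f = there (there (here refl))
  joint-∈ false true  true  f = there (there (there (here refl)))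

  module _ (X : Permutation) (S : List (Carrier X)) where

    private
      nb : List (Carrier X) → Carrier X → Axis → Bool → Maybe (Carrier X)
      nb S z = neighbour X S (cutAt X z)

    between-reverse : ∀ b d {x y} → Between X S b d x y → Between X S b (not d) y x
    between-reverse b d (s , p , q , r) = s , p , Ord-reverse X b d r , Ord-reverse X b d q

    between-reverse⁻ : ∀ b d {x y} → Between X S b (not d) y x → Between X S b d x y
    between-reverse⁻ b d (s , p , q , r) = s , p , Ord-reverse⁻ X b d r , Ord-reverse⁻ X b d q

    apart-nb : ∀ {w z} b d → Ord X b d w z → Between X S b d w z → ∀ h → nb (w ∷ S) z b h ≡ nb S z b h
    apart-nb {w} {z} b d w<z btw h with h Bool.≟ d
    ... | yes refl = nb-cons-miss X S b h w<z btw
    ... | no  ne   = subst (λ h → nb (w ∷ S) z b h ≡ nb S z b h) (sym (Bool.¬-not ne)) (nb-cons-far X S b d w<z)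

    state-consistent : ∀ z a T → (∀ d → T d ≡ views X S z a d) → ∀ h → Consistent T h (state X S z a h)
    state-consistent z a T e h = consistent T h (state X S z a h)
      (λ d c → trans (e d) (proj₂ (coincide-view X S z a h d (trans (sym (coincides-state X S z a h d)) c))))
      (λ s q n → view-present X S z a h s (trans (sym (state-side X S z a h)) q) (trans (sym (e s)) n))

    -- The element between `x` and `y` forces the neighbour of `x` towards `y` to come before `y`.
    -- If it is also the neighbour on `a`, which both cells share, its side relative to `y` is
    -- thereby known.
    state-facing : ∀ {x y} a h T → (∀ d → T d ≡ views X S y a d) → x ∉ S →
      (∀ d → nb S x a d ≡ nb S y a d) → Ord X (other a) h y x → Between X S (other a) h y x →
      Facing T (not h) (state X S x a h)
    state-facing {x} {y} a h T e x∉S shared y<x (s , s∈S , y<s , s<x) =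
      facing T (not h) (state X S x a h) (λ n → present (trans (sym (state-side X S x a h)) n)) faces
      where
      b = other a

      present : views X S x b h ≢ nothing
      present n with nb S x b h in f
      ... | nothing = nb-exists X S x b h s∈S (Ord⇒side X b h s<x) f

      near : ∀ {p} → nb S x b h ≡ just p → Ord X b h y p
      near f with proj₂ (subst (Greatest X b h _) f (neighbour-spec X S (cutAt X x) b h)) s
                    (s∈S , Ord⇒side X b h s<x)
      ... | inj₁ refl = y<s
      ... | inj₂ r    = Ord-trans X b h y<s r

      faces : ∀ d → coincidesAt (state X S x a h) d ≡ true → T d ≡ just (not h)
      faces d c = trans (e d) (go (trans (sym (coincides-state X S x a h d)) c))
        where
        go : coincide X S x a h d ≡ true → views X S y a d ≡ just (not h)
        go c with nb S x b h in f | nb S x a d in g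
        ... | just p | just q with _≟_ {X} p q
        ...   | yes refl rewrite trans (sym (shared d)) g =
          cong just (Ord⇒side X b (not h) (Ord-reverse X b h (near f)))

    module _ (a : Axis) (e : Bool) (law : RowLaw a e) {x y : Carrier X} (x∉S : x ∉ S) (y∉S : y ∉ S)
             (x<y : Ord X a true x y) (x<y₂ : Ord X (other a) e x y)
             (clear : ¬ Between X S a true x y) (btw : Between X S (other a) e x y) where

      private
        b : Axis
        b = other a

        shared : ∀ d → nb S x a d ≡ nb S y a d
        shared = shared-nb X S a true x<y x∉S y∉S clear

        joint : Bool → Maybe Bool × Maybe Bool
        joint d = views X S x a d , views X S y a d

        J : (Maybe Bool × Maybe Bool) × (Maybe Bool × Maybe Bool)
        J = joint true , joint false

        joint∈ : ∀ d → joint d ∈ joints e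
        joint∈ d rewrite shared d with nb S y a d
        ... | nothing = here refl
        ... | just q with Ord-compare X b e q x
        ...   | tri< r _ _ = joint-∈ e _ _ λ _ → Ord⇒side X b e (Ord-trans X b e r x<y₂)
        ...   | tri≈ _ refl _ = joint-∈ e _ _ λ _ → Ord⇒side X b e x<y₂
        ...   | tri> _ _ r = joint-∈ e _ _ λ u →
          contradiction (trans (sym u) (Ord⇒side X b (not e) (Ord-reverse X b e r))) (Bool.not-¬ refl)

        Tx Ty : Bool → Maybe Bool
        Tx = proj₁ ∘ sel J
        Ty = proj₂ ∘ sel J

        Tx-η : ∀ d → Tx d ≡ views X S x a d
        Tx-η d = cong proj₁ (sel-η joint d)

        Ty-η : ∀ d → Ty d ≡ views X S y a d
        Ty-η d = cong proj₂ (sel-η joint d)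

        open Row a e Tx Ty

        stx sty : Bool → State
        stx = state X S x a
        sty = state X S y a

        validX : ValidX stx
        validX = (state-consistent x a Tx Tx-η true , state-consistent x a Tx Tx-η false) ,
          subst (λ e′ → Facing Ty e′ (stx (not e))) (Bool.not-involutive e)
            (state-facing a (not e) Ty Ty-η x∉S shared (Ord-reverse X b e x<y₂) (between-reverse b e btw))

        validY : ValidY sty
        validY = (state-consistent y a Ty Ty-η true , state-consistent y a Ty Ty-η false) ,
          state-facing a e Tx Tx-η y∉S (λ d → sym (shared d)) x<y₂ btw

        after : ∀ d e {w z} T → (∀ h → T h ≡ views X S z a h) → w ∉ S → z ∉ S → Ord X a d w z → Ord X b e w z →
          ¬ Between X S a d w z → Between X S b e w z →
          valueAtPoint X (w ∷ S) z ≡ viewValue a (separate-from d ∘ state X S z a) (T [ d ≔ just e ])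
        after d e {w} {z} T η w∉S z∉S w<z w<z₂ clear btw = trans
          (value-view X (w ∷ S) z a (λ { (here refl) → Ord-≢ X a d w<z refl ; (there p) → z∉S p }))
          (viewValue-cong a
            (λ h → far-state X S a d e w∉S z∉S w<z w<z₂ clear h (apart-nb b e w<z₂ btw h))
            (λ h → trans (hit-views X S a d e w∉S z∉S w<z w<z₂ clear h) (update h)))
          where
          update : ∀ h → (views X S z a [ d ≔ just e ]) h ≡ (T [ d ≔ just e ]) h
          update h with h Bool.≟ d
          ... | yes _ = refl
          ... | no  _ = sym (η h)

      row-exchange : valueAtPoint X S x ℤ.* valueAtPoint X (x ∷ S) y ≡
                     valueAtPoint X S y ℤ.* valueAtPoint X (y ∷ S) x
      row-exchange = begin
        valueAtPoint X S x ℤ.* valueAtPoint X (x ∷ S) y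
          ≡⟨ cong₂ ℤ._*_ (trans (value-view X S x a x∉S) (viewValue-cong a (λ _ → refl) (λ d → sym (Tx-η d))))
                         (after true e Ty Ty-η x∉S y∉S x<y x<y₂ clear btw) ⟩
        proj₁ (vectorX stx) ℤ.* proj₂ (vectorY sty)
          ≡⟨ All.lookup (All.lookup (All.lookup law (∈.∈-cartesianProduct⁺ (joint∈ true) (joint∈ false)))
               (∈-vectorsX stx validX)) (∈-vectorsY sty validY) ⟩
        proj₁ (vectorY sty) ℤ.* proj₂ (vectorX stx)
          ≡⟨ cong₂ ℤ._*_ (trans (value-view X S y a y∉S) (viewValue-cong a (λ _ → refl) (λ d → sym (Ty-η d))))
                         (after false (not e) Tx Tx-η y∉S x∉S x<y (Ord-reverse X b e x<y₂)
                           (λ q → clear (between-reverse⁻ a true q)) (between-reverse b e btw)) ⟨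
        valueAtPoint X S y ℤ.* valueAtPoint X (y ∷ S) x ∎
        where open ≡-Reasoning

    module _ (e : Bool) (law : CellLaw e) {x y : Carrier X} (x∉S : x ∉ S) (y∉S : y ∉ S)
             (x<y : Ord X place true x y) (x<y₂ : Ord X height e x y)
             (clear : ¬ Between X S place true x y) (clear₂ : ¬ Between X S height e x y) where

      private
        st : Bool → State
        st = state X S x height

        q : Bool → Maybe Bool
        q = views X S x height

        J : (State × State) × (Maybe Bool × Maybe Bool)
        J = (st true , st false) , (q true , q false)

        same-nb : ∀ a h → nb S x a h ≡ nb S y a h
        same-nb place  = shared-nb X S place true x<y x∉S y∉S clear
        same-nb height = shared-nb X S height e x<y₂ x∉S y∉S clear₂

        same-side : ∀ a {s} → s ∈ S → _<ᵇ_ {X} {a} s x ≡ _<ᵇ_ {X} {a} s y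
        same-side place  = shared-side X S place true x<y x∉S y∉S clear
        same-side height = shared-side X S height e x<y₂ x∉S y∉S clear₂

        same-views : ∀ h → views X S x height h ≡ views X S y height h
        same-views h with nb S x height h in f
        ... | nothing rewrite trans (sym (same-nb height h)) f = refl
        ... | just p  rewrite trans (sym (same-nb height h)) f =
          cong just (same-side place (nb-∈ X S x height h f))

        same-states : ∀ h → state X S x height h ≡ state X S y height h
        same-states h with nb S x place h in f
        ... | nothing rewrite trans (sym (same-nb place h)) f = refl
        ... | just p  rewrite trans (sym (same-nb place h)) f =
          cong just (cong₂ _,_ (same-side height (nb-∈ X S x place h f))
            (cong (coincide′ X (just p)) (trans (same-nb height _)
              (cong (nb S y height) (same-side height (nb-∈ X S x place h f))))))

        present : ∀ h → Present q h (st h)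
        present h = go (st h) refl
          where
          absent : ∀ v → st h ≡ nothing → q v ≢ just h
          absent v n r = view-present X S x place v h r
            (trans (sym (state-side X S x height h)) (cong stateSide n))
          go : ∀ s → st h ≡ s → Present q h s
          go nothing  n = absent true n , absent false n
          go (just _) _ = _

        valid : ValidCell (sel (proj₁ J)) (sel (proj₂ J))
        valid = transfer (state-consistent x height q (λ _ → refl)) present
          where
          consistent-η : ∀ h s → Consistent q h s → Consistent (sel (proj₂ J)) h s
          consistent-η h nothing c = _
          consistent-η h (just (s , true)) c = trans (sel-η q s) c
          consistent-η h (just (s , false)) c = λ n → c (trans (sym (sel-η q s)) n)
          present-η : ∀ h s → Present q h s → Present (sel (proj₂ J)) h s
          present-η h nothing  c = c
          present-η h (just _) c = _
          transfer : (∀ h → Consistent q h (st h)) → (∀ h → Present q h (st h)) →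
                     ValidCell (sel (proj₁ J)) (sel (proj₂ J))
          transfer c p = (consistent-η true _ (c true) , consistent-η false _ (c false)) ,
                         (present-η true _ (p true) , present-η false _ (p false))

        J∈ : J ∈ filter (λ J → validCell? (sel (proj₁ J)) (sel (proj₂ J)))
               (List.cartesianProduct (List.cartesianProduct states states) (List.cartesianProduct sides sides))
        J∈ = ∈.∈-filter⁺ (λ J → validCell? (sel (proj₁ J)) (sel (proj₂ J)))
          (∈.∈-cartesianProduct⁺ (∈.∈-cartesianProduct⁺ (∈-states _) (∈-states _))
                                 (∈.∈-cartesianProduct⁺ (∈-sides _) (∈-sides _))) valid

        cell-value : valueAtPoint X S x ≡ viewValue height (sel (proj₁ J)) (sel (proj₂ J))
        cell-value = trans (value-view X S x height x∉S)
          (viewValue-cong height (λ h → sym (sel-η st h)) (λ h → sym (sel-η q h)))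

        cell-value₂ : valueAtPoint X S y ≡ viewValue height (sel (proj₁ J)) (sel (proj₂ J))
        cell-value₂ = trans (value-view X S y height y∉S)
          (viewValue-cong height (λ h → trans (sym (same-states h)) (sym (sel-η st h)))
                                 (λ h → trans (sym (same-views h)) (sym (sel-η q h))))

        after : ∀ d e {w z} → w ∉ S → z ∉ S → Ord X place d w z → Ord X height e w z →
          ¬ Between X S place d w z → ¬ Between X S height e w z →
          (∀ h → state X S z height h ≡ st h) → (∀ h → views X S z height h ≡ q h) →
          valueAtPoint X (w ∷ S) z ≡
          viewValue height ((separate-from e ∘ sel (proj₁ J)) [ d ≔ just (e , true) ]) (sel (proj₂ J) [ e ≔ just d ])
        after d e {w} {z} w∉S z∉S w<z w<z₂ clear clear₂ est eq = trans
          (value-view X (w ∷ S) z height (λ { (here refl) → Ord-≢ X place d w<z refl ; (there p) → z∉S p }))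
          (viewValue-cong height states-after views-after)
          where
          views-after : ∀ h → views X (w ∷ S) z height h ≡ (sel (proj₂ J) [ e ≔ just d ]) h
          views-after h = trans (hit-views X S height e d w∉S z∉S w<z₂ w<z clear₂ h) (update h)
            where
            update : ∀ h → (views X S z height [ e ≔ just d ]) h ≡ (sel (proj₂ J) [ e ≔ just d ]) h
            update h with h Bool.≟ e
            ... | yes _ = refl
            ... | no  _ = trans (eq h) (sym (sel-η q h))

          states-after : ∀ h → state X (w ∷ S) z height h ≡ ((separate-from e ∘ sel (proj₁ J)) [ d ≔ just (e , true) ]) h
          states-after h with h Bool.≟ d
          ... | yes refl = trans (cong (Maybe.map (stateOf X (w ∷ S) z height)) (nb-cons-hit X S place d w<z z∉S clear))
            (cong just (cong₂ _,_ side (trans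
              (cong (coincide′ X (just w)) (trans (cong (nb (w ∷ S) z height) side) (nb-cons-hit X S height e w<z₂ z∉S clear₂)))
              (dec-true (_≟_ {X} w w) refl))))
            where
            side : _<ᵇ_ {X} {height} w z ≡ e
            side = Ord⇒side X height e w<z₂
          ... | no  ne = trans
            (far-state X S height e d w∉S z∉S w<z₂ w<z clear₂ h
              (subst (λ h → nb (w ∷ S) z place h ≡ nb S z place h) (sym (Bool.¬-not ne)) (nb-cons-far X S place d w<z)))
            (cong (separate-from e) (trans (est h) (sym (sel-η st h))))

      cell-exchange : valueAtPoint X S x ℤ.* valueAtPoint X (x ∷ S) y ≡
                      valueAtPoint X S y ℤ.* valueAtPoint X (y ∷ S) x
      cell-exchange = begin
        valueAtPoint X S x ℤ.* valueAtPoint X (x ∷ S) y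
          ≡⟨ cong₂ ℤ._*_ cell-value
               (after true e x∉S y∉S x<y x<y₂ clear clear₂ (λ h → sym (same-states h)) (λ h → sym (same-views h))) ⟩
        viewValue height (sel (proj₁ J)) (sel (proj₂ J)) ℤ.* afterX e (sel (proj₁ J)) (sel (proj₂ J))
          ≡⟨ All.lookup law J∈ ⟩
        viewValue height (sel (proj₁ J)) (sel (proj₂ J)) ℤ.* afterY e (sel (proj₁ J)) (sel (proj₂ J))
          ≡⟨ cong₂ ℤ._*_ cell-value₂
               (after false (not e) y∉S x∉S x<y (Ord-reverse X height e x<y₂)
                 (λ r → clear (between-reverse⁻ place true r)) (λ r → clear₂ (between-reverse⁻ height e r))
                 (λ _ → refl) (λ _ → refl)) ⟨
        valueAtPoint X S y ℤ.* valueAtPoint X (y ∷ S) x ∎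
        where open ≡-Reasoning

    -- On both axes an element of `S` stands between `w` and the cell of `z`, so `w` becomes no
    -- neighbour of that cell.
    apart-value : ∀ {w z} → w ∉ S → z ∉ S → (∀ a → ∃ λ d → Ord X a d w z × Between X S a d w z) →
                  valueAtPoint X (w ∷ S) z ≡ valueAtPoint X S z
    apart-value {w} {z} w∉S z∉S f = corners-cong
      {λ h v → position X (nb (w ∷ S) z place h) (nb (w ∷ S) z height v)}
      {λ h v → position X (nb S z place h) (nb S z height v)}
      λ h v → cong₂ (position X) (go place h) (go height v)
      where
      go : ∀ a h → nb (w ∷ S) z a h ≡ nb S z a h
      go a = let d , r , btw = f a in apart-nb a d r btw

    row-law : ∀ a e → RowLaw a e
    row-law height true  = proj₁ (proj₁ (proj₁ lawful))
    row-law height false = proj₂ (proj₁ (proj₁ lawful))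
    row-law place  true  = proj₁ (proj₂ (proj₁ lawful))
    row-law place  false = proj₂ (proj₂ (proj₁ lawful))

    cell-law : ∀ e → CellLaw e
    cell-law true  = proj₁ (proj₂ lawful)
    cell-law false = proj₂ (proj₂ lawful)

    ordered-exchange : ∀ {x y} → x ∉ S → y ∉ S → Order X place x y → ∀ e → Ord X height e x y →
      valueAtPoint X S x ℤ.* valueAtPoint X (x ∷ S) y ≡ valueAtPoint X S y ℤ.* valueAtPoint X (y ∷ S) x
    ordered-exchange {x} {y} x∉S y∉S x<y e x<y₂ with between? X S place true x y | between? X S height e x y
    ... | no  clear | no  clear₂ = cell-exchange e (cell-law e) x∉S y∉S x<y x<y₂ clear clear₂
    ... | no  clear | yes btw    = row-exchange place e (row-law place e) x∉S y∉S x<y x<y₂ clear btw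
    ... | yes btw   | yes btw₂   = trans
      (cong (valueAtPoint X S x ℤ.*_) (apart-value x∉S y∉S λ where
        place  → true , x<y , btw
        height → e , x<y₂ , btw₂))
      (trans (ℤ.*-comm (valueAtPoint X S x) (valueAtPoint X S y))
        (cong (valueAtPoint X S y ℤ.*_) (sym (apart-value y∉S x∉S λ where
          place  → false , x<y , between-reverse place true btw
          height → not e , Ord-reverse X height e x<y₂ , between-reverse height e btw₂))))
    ... | yes btw   | no  clear₂ = go e x<y₂ clear₂
      where
      go : ∀ e → Ord X height e x y → ¬ Between X S height e x y →
        valueAtPoint X S x ℤ.* valueAtPoint X (x ∷ S) y ≡ valueAtPoint X S y ℤ.* valueAtPoint X (y ∷ S) x
      go true r clear = row-exchange height true (row-law height true) x∉S y∉S r x<y clear btw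
      -- `row-exchange` expects its first point to be the lower one on the shared axis, so `x` and
      -- `y` change roles.
      go false r clear = sym (row-exchange height false (row-law height false) y∉S x∉S r x<y
        (λ q → clear (between-reverse height true q)) (between-reverse place true btw))

  exchange : Exchange
  exchange X S {x} {y} x≢y x∉S y∉S = go (compare X place x y) (compare X height x y)
    where
    go : Tri (Order X place x y) (x ≡ y) (Order X place y x) →
         Tri (Order X height x y) (x ≡ y) (Order X height y x) →
      valueAtPoint X S x ℤ.* valueAtPoint X (x ∷ S) y ≡ valueAtPoint X S y ℤ.* valueAtPoint X (y ∷ S) x
    go (tri≈ _ e _) _            = contradiction e x≢y
    go _            (tri≈ _ e _) = contradiction e x≢y
    go (tri< r _ _) (tri< s _ _) = ordered-exchange X S x∉S y∉S r true s
    go (tri< r _ _) (tri> _ _ s) = ordered-exchange X S x∉S y∉S r false s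
    go (tri> _ _ r) (tri> _ _ s) = sym (ordered-exchange X S y∉S x∉S r true s)
    go (tri> _ _ r) (tri< s _ _) = sym (ordered-exchange X S y∉S x∉S r false s)

module _ (k : CommutativeRing c ℓ) where

  open CommutativeRing k renaming (Carrier to ∣k∣)

  -- Here x lists the values on the ten marked permutations; x 0F and x 9F are determined
  -- by the others.

  quadrant : (Fin 10 → ∣k∣) → Position → ∣k∣
  quadrant x none                = 1# + ((x 1F + x 2F) + (x 3F + x 4F))
  quadrant x first               = x 2F + x 3F
  quadrant x second              = x 2F + x 4F
  quadrant x same                = x 2F
  quadrant x (apart true true)   = x 2F + x 5F
  quadrant x (apart true false)  = x 2F - x 8F
  quadrant x (apart false true)  = x 2F - (1# + x 7F)
  quadrant x (apart false false) = x 2F + x 6F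

  weights : (Fin 10 → ∣k∣) → Weight ∣k∣
  weights x = weight {k = k} (quadrant x)

cellOf-extension : ∀ Y (C : Cell Y) a y → below (cellOf (extension Y C) nothing) a y ≡ below C a y
cellOf-extension Y C a y with below C a y in e
... | true  = <ᵇ-true (extend Y C) a (extend-order Y C a (lower e))
... | false = <ᵇ-false (extend Y C) a λ r → contradiction (trans (sym e) (lower⁻ (extend-order⁻ Y C a r))) λ ()
  where
  lower⁻ : ExtOrder Y C a (just y) nothing → below C a y ≡ true
  lower⁻ (lower e) = e

module _ (k : CommutativeRing c ℓ) (φ : Weight (CommutativeRing.Carrier k)) where
  open LocalValue k φ

  cellValue-cong : ∀ Y {C D : Cell Y} → (∀ a y → below C a y ≡ below D a y) → cellValue Y C ≡ cellValue Y D
  cellValue-cong Y {C} {D} e = localValue-embed idᴱ (elements Y) (elements Y) (below C) (below D)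
    (λ p → p) (λ p → _ , p , refl) (λ a {y} _ → e a y)

unmarked marked : Fin 10 → Permutation
marked m   = proj₁ (lookup markedPermutations m)
unmarked m = marked m ∖ proj₂ (lookup markedPermutations m)

marked-inclusion : ∀ m → Embedding (unmarked m) (marked m)
marked-inclusion m = inclusion (marked m) (proj₂ (lookup markedPermutations m))

marked-onePoint : ∀ m → OnePoint (marked-inclusion m)
marked-onePoint m = inclusion-onePoint (marked m) (proj₂ (lookup markedPermutations m))

-- Every measure is given by cell values

module Moves (Y : Permutation) where

  Closed : Axis → (Carrier Y → Bool) → Set
  Closed a c = ∀ {y z} → Order Y a y z → c z ≡ true → c y ≡ true

  -- This says that `p` is a neighbour of the cell on the axis `a`: from `p` towards the cell, all
  -- further elements are on the other side. Toggling `p` then leaves a closed cut.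
  Movable : Axis → (Carrier Y → Bool) → Carrier Y → Set
  Movable a c p = ∀ y → Ord Y a (c p) p y → c y ≡ not (c p)

  movable? : ∀ a c p → Dec (Movable a c p)
  movable? a c p = all? Y λ y → ord? (c p) y →-dec (c y Bool.≟ not (c p))
    where
    ord? : ∀ d y → Dec (Ord Y a d p y)
    ord? true  y = _<?_ {Y} {a} p y
    ord? false y = _<?_ {Y} {a} y p

  closed-Ord : ∀ {a c} → Closed a c → ∀ d {y z} → Ord Y a d y z → c z ≡ d → c y ≡ d
  closed-Ord cl true r e = cl r e
  closed-Ord {c = c} cl false {y} r e with c y in f
  ... | false = refl
  ... | true  = trans (sym (cl r f)) e

  toggle : (Carrier Y → Bool) → Carrier Y → Carrier Y → Bool
  toggle c p y = if does (_≟_ {Y} y p) then not (c y) else c y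

  toggle-at : ∀ c p → toggle c p p ≡ not (c p)
  toggle-at c p = cong (if_then not (c p) else c p) (dec-true (_≟_ {Y} p p) refl)

  toggle-off : ∀ c {p y} → y ≢ p → toggle c p y ≡ c y
  toggle-off c {p} {y} ne = cong (if_then not (c y) else c y) (dec-false (_≟_ {Y} y p) ne)

  toggle-closed : ∀ {a c p} → Closed a c → Movable a c p → Closed a (toggle c p)
  toggle-closed {a} {c} {p} cl m {y} {z} r e with _≟_ {Y} y p | _≟_ {Y} z p
  ... | yes refl | yes refl = contradiction r (irrefl Y a)
  ... | no _     | no _     = cl r e
  ... | yes refl | no _     = below-p (c p) refl
    where
    below-p : ∀ d → c p ≡ d → not (c p) ≡ true
    below-p false f = cong not f
    below-p true  f = contradiction
      (trans (sym e) (trans (m z (subst (λ d → Ord Y a d p z) (sym f) r)) (cong not f))) λ ()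
  ... | no _     | yes refl = trans (m y (subst (λ d → Ord Y a d p y) (sym (Bool.not-injective e)) r)) e

  module _ {a : Axis} {c : Carrier Y → Bool} where

    blocked : ∀ {p q} → c q ≡ c p → Ord Y a (c p) p q → ¬ Movable a c p
    blocked e r m = Bool.not-¬ refl (trans (sym e) (m _ r))

    opposite : ∀ {p q} → p ≢ q → Movable a c p → Movable a c q → c q ≡ not (c p)
    opposite {p} {q} p≢q m n = Bool.¬-not λ e → case′ e (Ord-compare Y a (c p) p q)
      where
      case′ : c q ≡ c p → Tri (Ord Y a (c p) p q) (p ≡ q) (Ord Y a (c p) q p) → ⊥
      case′ e (tri< r _ _) = blocked e r m
      case′ e (tri≈ _ r _) = p≢q r
      case′ e (tri> _ _ r) = blocked (sym e) (subst (λ d → Ord Y a d q p) (sym e) r) n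

    -- Movable points lie pairwise on opposite sides of the cell, and there are only two sides.
    at-most-two : ∀ {p q r} → p ≢ q → p ≢ r → q ≢ r → Movable a c p → Movable a c q → ¬ Movable a c r
    at-most-two p≢q p≢r q≢r m n o = Bool.not-¬ (trans (opposite p≢r m o) (sym (opposite p≢q m n))) (opposite q≢r n o)

    module _ (cl : Closed a c) where

      facing-order : ∀ {p q} → p ≢ q → c q ≡ not (c p) → Ord Y a (c p) p q
      facing-order {p} {q} p≢q e with Ord-compare Y a (c p) p q
      ... | tri< r _ _ = r
      ... | tri≈ _ r _ = contradiction r p≢q
      ... | tri> _ _ r = contradiction (trans (sym (closed-Ord cl (c p) r refl)) e) (Bool.not-¬ refl)

      -- Once the cell has crossed the line of `q`, the point `q` stands between `p` and the cell.
      blocked-after : ∀ {p q} → p ≢ q → Movable a c p → Movable a c q → ¬ Movable a (toggle c q) p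
      blocked-after {p} {q} p≢q m n =
        blocked′ (trans (toggle-at c q) (trans (cong not (opposite p≢q m n)) (Bool.not-involutive (c p))))
                 (toggle-off c p≢q) (facing-order p≢q (opposite p≢q m n))
        where
        blocked′ : toggle c q q ≡ c p → toggle c q p ≡ c p → Ord Y a (c p) p q → ¬ Movable a (toggle c q) p
        blocked′ e f r m = Bool.not-¬ refl (trans (sym e) (trans
          (m q (subst (λ d → Ord Y a d p q) (sym f) r)) (cong not f)))

      movable-after : ∀ {q} → Movable a c q → Movable a (toggle c q) q
      movable-after {q} m y r = trans (toggle-off c ne)
        (trans (closed-Ord cl (c q) (reverse (c q) r′) refl) (sym (trans (cong not (toggle-at c q)) (Bool.not-involutive (c q)))))
        where
        reverse : ∀ d {y z} → Ord Y a (not d) z y → Ord Y a d y z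
        reverse true  r = r
        reverse false r = r
        r′ : Ord Y a (not (c q)) q y
        r′ = subst (λ d → Ord Y a d q y) (toggle-at c q) r
        ne : y ≢ q
        ne refl = Ord-asym Y a (not (c q)) r′ r′

  moved : Axis → Cut Y → Carrier Y → Cut Y
  moved place  c p place  = toggle (c place) p
  moved place  c p height = c height
  moved height c p place  = c place
  moved height c p height = toggle (c height) p

  CanMove : Cell Y → Axis → Carrier Y → Set
  CanMove C a p = Movable a (below C a) p

  move : (C : Cell Y) (a : Axis) (p : Carrier Y) → CanMove C a p → Cell Y
  move C a p m = record { below = moved a (below C) p ; closed = cl a m }
    where
    cl : ∀ a → CanMove C a p → ∀ b → Closed b (moved a (below C) p b)
    cl place  m place  = toggle-closed (λ {y} {z} → closed C place {y} {z}) m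
    cl place  m height = closed C height
    cl height m place  = closed C place
    cl height m height = toggle-closed (λ {y} {z} → closed C height {y} {z}) m

  moveBoth : (C : Cell Y) (p : Carrier Y) → CanMove C place p → CanMove C height p → Cell Y
  moveBoth C p m n = move (move C place p m) height p n

-- Functions on cells that change sign across lines

module Vanishing (k : CommutativeRing c ℓ) (Y : Permutation)
                 (D : Cell Y → CommutativeRing.Carrier k) where

  open CommutativeRing k renaming (Carrier to ∣k∣; refl to ≈-refl; sym to ≈-sym; trans to ≈-trans)
  open SetoidReasoning setoid
  open Moves Y

  module _
    -- Additivity under adding `p`, for a function that vanishes on the permutation without `p`: the
    -- one, two or four parts of a cell have sum zero.
    (far    : ∀ C p → (∀ a → ¬ CanMove C a p) → D C ≈ 0#)
    (cross  : ∀ C p a (m : CanMove C a p) → ¬ CanMove C (other a) p → D C + D (move C a p m) ≈ 0#)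
    (around : ∀ C p (m : CanMove C place p) (n : CanMove C height p) →
              (D C + D (move C place p m)) + (D (move C height p n) + D (moveBoth C p m n)) ≈ 0#)
    where

    far′ : ∀ C p → ¬ CanMove C place p → ¬ CanMove C height p → D C ≈ 0#
    far′ C p n o = far C p λ { place → n ; height → o }

    cross-zero : ∀ C p a (m : CanMove C a p) → ¬ CanMove C (other a) p → D (move C a p m) ≈ 0# → D C ≈ 0#
    cross-zero C p a m n z = begin
      D C                     ≈⟨ +-identityʳ _ ⟨
      D C + 0#                ≈⟨ +-congˡ z ⟨
      D C + D (move C a p m)  ≈⟨ cross C p a m n ⟩
      0#                      ∎

    around-zero : ∀ C p (m : CanMove C place p) (n : CanMove C height p) → D (move C place p m) ≈ 0# →
                  D (move C height p n) ≈ 0# → D (moveBoth C p m n) ≈ 0# → D C ≈ 0#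
    around-zero C p m n z₁ z₂ z₃ = begin
      D C                 ≈⟨ +-identityʳ _ ⟨
      D C + 0#            ≈⟨ +-identityʳ _ ⟨
      (D C + 0#) + 0#     ≈⟨ +-congˡ (+-identityʳ _) ⟨
      (D C + 0#) + (0# + 0#) ≈⟨ +-cong (+-congˡ z₁) (+-cong z₂ z₃) ⟨
      (D C + D (move C place p m)) + (D (move C height p n) + D (moveBoth C p m n)) ≈⟨ around C p m n ⟩
      0#                  ∎

    Only : Cell Y → Axis → Carrier Y → Set
    Only C a p = CanMove C a p × ¬ CanMove C (other a) p

    Corner : Cell Y → Carrier Y → Set
    Corner C p = CanMove C place p × CanMove C height p

    -- Across the line of `q`, the point `p` bounds the cell on neither axis.
    opposite-zero : ∀ C a {p q} → p ≢ q → Only C a p → Only C a q → D C ≈ 0#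
    opposite-zero C place {p} {q} p≢q (m , m′) (n , n′) = cross-zero C q place n n′
      (far′ (move C place q n) p (blocked-after (λ {y} {z} → closed C place {y} {z}) p≢q m n) m′)
    opposite-zero C height {p} {q} p≢q (m , m′) (n , n′) = cross-zero C q height n n′
      (far′ (move C height q n) p m′ (blocked-after (λ {y} {z} → closed C height {y} {z}) p≢q m n))

    module _ {p q s : Carrier Y} (p≢q : p ≢ q) (p≢s : p ≢ s) (q≢s : q ≢ s) where

      -- Across the line of `q`, the corner `p` bounds in height alone. Either `s` still does so as
      -- well, and the two are opposite, or `s` has become a corner; then in each of the other three
      -- cells around `s` one of `p` and `q` is hidden on both axes.
      mixed-zero : ∀ C → Corner C p → Only C place q → Only C height s → D C ≈ 0#
      mixed-zero C (pp , ph) (qp , qh) (sh , sp) = cross-zero C q place qp qh C₁-zero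
        where
        cl : Closed place (below C place)
        cl = closed C place

        clh : Closed height (below C height)
        clh = closed C height

        C₁ : Cell Y
        C₁ = move C place q qp

        c₁ : Carrier Y → Bool
        c₁ = below C₁ place

        cl₁ : Closed place c₁
        cl₁ = closed C₁ place

        ¬p₁ : ¬ CanMove C₁ place p
        ¬p₁ = blocked-after cl p≢q pp qp

        q₁ : CanMove C₁ place q
        q₁ = movable-after cl qp

        C₁-zero : D C₁ ≈ 0#
        C₁-zero with movable? place c₁ s
        ... | no  ¬s = opposite-zero C₁ height p≢s (ph , ¬p₁) (sh , ¬s)
        ... | yes s₁ = around-zero C₁ s s₁ sh
          (far′ (move C₁ place s s₁) q (blocked-after cl₁ q≢s q₁ s₁) qh)
          (far′ (move C₁ height s sh) p ¬p₁ (blocked-after clh p≢s ph sh))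
          (far′ (moveBoth C₁ s s₁ sh) p ¬p₂ (blocked-after clh p≢s ph sh))
          where
          -- q still lies on the side of p, beyond it.
          side-q : toggle c₁ s q ≡ toggle c₁ s p
          side-q = trans (toggle-off c₁ q≢s) (trans (toggle-at (below C place) q)
            (trans (cong not (opposite p≢q pp qp)) (trans (Bool.not-involutive _)
              (sym (trans (toggle-off c₁ p≢s) (toggle-off (below C place) p≢q))))))

          ¬p₂ : ¬ CanMove (move C₁ place s s₁) place p
          ¬p₂ = blocked side-q (subst (λ d → Ord Y place d p q)
            (sym (trans (toggle-off c₁ p≢s) (toggle-off (below C place) p≢q)))
            (facing-order cl p≢q (opposite p≢q pp qp)))

    data Status (C : Cell Y) (p : Carrier Y) : Set where
      unseen : (∀ a → ¬ CanMove C a p) → Status C p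
      only   : ∀ a → Only C a p → Status C p
      corner : Corner C p → Status C p

    status : ∀ C p → Status C p
    status C p with movable? place (below C place) p | movable? height (below C height) p
    ... | yes m | yes n = corner (m , n)
    ... | yes m | no  n = only place (m , n)
    ... | no  m | yes n = only height (n , m)
    ... | no  m | no  n = unseen λ { place → m ; height → n }

    -- As at most two points bound on each axis, three points that all bound the cell include two
    -- which bound on the same axis alone, or consist of a corner and one further point for each
    -- axis.
    three-zero : ∀ C {p q r} → p ≢ q → p ≢ r → q ≢ r → D C ≈ 0#
    three-zero C {p} {q} {r} p≢q p≢r q≢r = go (status C p) (status C q) (status C r)
      where
      q≢p : q ≢ p
      q≢p e = p≢q (sym e)
      r≢p : r ≢ p
      r≢p e = p≢r (sym e)
      r≢q : r ≢ q
      r≢q e = q≢r (sym e)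

      three : ∀ a → CanMove C a p → CanMove C a q → CanMove C a r → D C ≈ 0#
      three a m n o = contradiction o (at-most-two p≢q p≢r q≢r m n)

      go : Status C p → Status C q → Status C r → D C ≈ 0#
      go (unseen u) _ _ = far C p u
      go _ (unseen u) _ = far C q u
      go _ _ (unseen u) = far C r u
      go (only place m)  (only place n)  _ = opposite-zero C place p≢q m n
      go (only height m) (only height n) _ = opposite-zero C height p≢q m n
      go (only place m)  _ (only place n)  = opposite-zero C place p≢r m n
      go (only height m) _ (only height n) = opposite-zero C height p≢r m n
      go _ (only place m)  (only place n)  = opposite-zero C place q≢r m n
      go _ (only height m) (only height n) = opposite-zero C height q≢r m n
      go (only place m)  (only height n) (corner o) = mixed-zero r≢p r≢q p≢q C o m n
      go (only height m) (only place n)  (corner o) = mixed-zero r≢q r≢p q≢p C o n m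
      go (only place m)  (corner o) (only height n) = mixed-zero q≢p q≢r p≢r C o m n
      go (only height m) (corner o) (only place n)  = mixed-zero q≢r q≢p r≢p C o n m
      go (corner o) (only place m)  (only height n) = mixed-zero p≢q p≢r q≢r C o m n
      go (corner o) (only height m) (only place n)  = mixed-zero p≢r p≢q r≢q C o n m
      go (corner (m , _)) (corner (n , _)) (only place (o , _))  = three place m n o
      go (corner (_ , m)) (corner (_ , n)) (only height (o , _)) = three height m n o
      go (corner (m , _)) (only place (n , _)) (corner (o , _))  = three place m n o
      go (corner (_ , m)) (only height (n , _)) (corner (_ , o)) = three height m n o
      go (only place (m , _)) (corner (n , _)) (corner (o , _))  = three place m n o
      go (only height (m , _)) (corner (_ , n)) (corner (_ , o)) = three height m n o
      go (corner (m , _)) (corner (n , _)) (corner (o , _))      = three place m n o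

    module _ (base : ∀ C {p q} → p ≢ q → (∀ y → y ≡ p ⊎ y ≡ q) → Only C place p → Only C height q → D C ≈ 0#)
      where

      -- With two points, sign changes lead from the remaining cells to those where each point
      -- bounds on one axis only and the axes differ. These are left to `base`.
      two-zero : ∀ C {p q} → p ≢ q → (∀ y → y ≡ p ⊎ y ≡ q) → D C ≈ 0#
      two-zero C {p} {q} p≢q cov = go (status C p) (status C q)
        where
        q≢p : q ≢ p
        q≢p e = p≢q (sym e)

        cov′ : ∀ y → y ≡ q ⊎ y ≡ p
        cov′ y = [ inj₂ , inj₁ ]′ (cov y)

        corner-place : ∀ C {p q} → p ≢ q → (∀ y → y ≡ q ⊎ y ≡ p) → Corner C p → Only C place q → D C ≈ 0#
        corner-place C {p} {q} p≢q cov (m , n) (o , o′) = cross-zero C q place o o′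
          (base (move C place q o) (λ e → p≢q (sym e)) cov (movable-after cl o , o′) (n , blocked-after cl p≢q m o))
          where
          cl : Closed place (below C place)
          cl = closed C place

        corner-height : ∀ C {p q} → p ≢ q → (∀ y → y ≡ p ⊎ y ≡ q) → Corner C p → Only C height q → D C ≈ 0#
        corner-height C {p} {q} p≢q cov (m , n) (o , o′) = cross-zero C q height o o′
          (base (move C height q o) p≢q cov (m , blocked-after cl p≢q n o) (movable-after cl o , o′))
          where
          cl : Closed height (below C height)
          cl = closed C height

        go : Status C p → Status C q → D C ≈ 0#
        go (unseen u) _ = far C p u
        go _ (unseen u) = far C q u
        go (only place m)  (only place n)  = opposite-zero C place p≢q m n
        go (only height m) (only height n) = opposite-zero C height p≢q m n
        go (only place m)  (only height n) = base C p≢q cov m n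
        go (only height m) (only place n)  = base C q≢p cov′ n m
        go (corner o) (only place m)  = corner-place C p≢q cov′ o m
        go (corner o) (only height m) = corner-height C p≢q cov o m
        go (only place m)  (corner o) = corner-place C q≢p cov o m
        go (only height m) (corner o) = corner-height C q≢p cov′ o m
        go (corner (m , n)) (corner (o , r)) = around-zero C p m n
          (corner-height (move C place p m) p≢q cov (movable-after cl m , n) (r , blocked-after cl q≢p o m))
          (corner-place (move C height p n) p≢q cov′ (m , movable-after clh n) (o , blocked-after clh q≢p r n))
          (far′ (moveBoth C p m n) q (blocked-after cl q≢p o m) (blocked-after clh q≢p r n))
          where
          cl : Closed place (below C place)
          cl = closed C place
          clh : Closed height (below C height)
          clh = closed C height

-- Integers in a commutative ring and a polynomial solver

module Integers (k : CommutativeRing c ℓ) where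

  open CommutativeRing k renaming (Carrier to ∣k∣; refl to ≈-refl; sym to ≈-sym; trans to ≈-trans)
  open import Algebra.Properties.Semiring.Mult.TCOptimised semiring
    using (1+×; ×-homo-+; ×1-homo-*) renaming (_×_ to _·_)
  open import Algebra.Properties.Ring ring using (-‿distribˡ-*; -‿distribʳ-*)
  open import Algebra.Properties.AbelianGroup +-abelianGroup using (⁻¹-∙-comm; ⁻¹-involutive; ε⁻¹≈ε)
  open import Algebra.Properties.CommutativeSemigroup +-commutativeSemigroup using (interchange)
  open SetoidReasoning setoid

  -- With the optimised multiple, `1 · 1#` is `1#` by definition, so `ι` sends the constants 0, 1
  -- and -1 to `0#`, `1#` and `- 1#` by computation.
  ι : ℤ → ∣k∣
  ι (ℤ.+ n)    = n · 1#
  ι (ℤ.-[1+ n ]) = - (suc n · 1#)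

  ι-⊖ : ∀ m n → ι (m ℤ.⊖ n) ≈ m · 1# - n · 1#
  ι-⊖ m zero = ≈-sym (≈-trans (+-congˡ ε⁻¹≈ε) (+-identityʳ _))
  ι-⊖ zero (suc n) = ≈-sym (+-identityˡ _)
  ι-⊖ (suc m) (suc n) = begin
    ι (suc m ℤ.⊖ suc n)               ≡⟨ cong ι (ℤ.[1+m]⊖[1+n]≡m⊖n m n) ⟩
    ι (m ℤ.⊖ n)                       ≈⟨ ι-⊖ m n ⟩
    m · 1# - n · 1#                   ≈⟨ +-identityˡ _ ⟨
    0# + (m · 1# - n · 1#)            ≈⟨ +-congʳ (-‿inverseʳ 1#) ⟨
    (1# - 1#) + (m · 1# - n · 1#)     ≈⟨ interchange _ _ _ _ ⟩
    (1# + m · 1#) + (- 1# - n · 1#)   ≈⟨ +-congˡ (⁻¹-∙-comm 1# (n · 1#)) ⟩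
    (1# + m · 1#) - (1# + n · 1#)     ≈⟨ +-cong (1+× m 1#) (-‿cong (1+× n 1#)) ⟨
    suc m · 1# - suc n · 1#           ∎

  ι-+ : ∀ a b → ι (a ℤ.+ b) ≈ ι a + ι b
  ι-+ (ℤ.+ m)      (ℤ.+ n)      = ×-homo-+ 1# m n
  ι-+ (ℤ.+ m)      ℤ.-[1+ n ] = ι-⊖ m (suc n)
  ι-+ ℤ.-[1+ m ] (ℤ.+ n)      = ≈-trans (ι-⊖ n (suc m)) (+-comm _ _)
  ι-+ ℤ.-[1+ m ] ℤ.-[1+ n ] = begin
    - (suc (suc (m ℕ.+ n)) · 1#)          ≡⟨ cong (λ l → - (suc l · 1#)) (sym (ℕ.+-suc m n)) ⟩
    - ((suc m ℕ.+ suc n) · 1#)            ≈⟨ -‿cong (×-homo-+ 1# (suc m) (suc n)) ⟩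
    - (suc m · 1# + suc n · 1#)           ≈⟨ ⁻¹-∙-comm _ _ ⟨
    - (suc m · 1#) - suc n · 1#           ∎

  ι-neg : ∀ a → ι (ℤ.- a) ≈ - ι a
  ι-neg (ℤ.+ zero)   = ≈-sym ε⁻¹≈ε
  ι-neg (ℤ.+ suc n)  = ≈-refl
  ι-neg ℤ.-[1+ n ] = ≈-sym (⁻¹-involutive _)

  private
    ι-*⁺ : ∀ m b → ι (ℤ.+ m ℤ.* b) ≈ ι (ℤ.+ m) * ι b
    ι-*⁺ m (ℤ.+ n) = ≈-trans (reflexive (cong ι (sym (ℤ.pos-* m n)))) (×1-homo-* m n)
    ι-*⁺ m ℤ.-[1+ n ] = begin
      ι (ℤ.+ m ℤ.* ℤ.- (ℤ.+ suc n))       ≡⟨ cong ι (sym (ℤ.neg-distribʳ-* (ℤ.+ m) (ℤ.+ suc n))) ⟩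
      ι (ℤ.- (ℤ.+ m ℤ.* ℤ.+ suc n))       ≈⟨ ι-neg (ℤ.+ m ℤ.* ℤ.+ suc n) ⟩
      - ι (ℤ.+ m ℤ.* ℤ.+ suc n)         ≈⟨ -‿cong (ι-*⁺ m (ℤ.+ suc n)) ⟩
      - (m · 1# * (suc n · 1#))     ≈⟨ -‿distribʳ-* _ _ ⟩
      m · 1# * - (suc n · 1#)       ∎

  ι-* : ∀ a b → ι (a ℤ.* b) ≈ ι a * ι b
  ι-* (ℤ.+ m) b = ι-*⁺ m b
  ι-* ℤ.-[1+ m ] b = begin
    ι (ℤ.- (ℤ.+ suc m) ℤ.* b)       ≡⟨ cong ι (sym (ℤ.neg-distribˡ-* (ℤ.+ suc m) b)) ⟩
    ι (ℤ.- (ℤ.+ suc m ℤ.* b))       ≈⟨ ι-neg (ℤ.+ suc m ℤ.* b) ⟩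
    - ι (ℤ.+ suc m ℤ.* b)         ≈⟨ -‿cong (ι-*⁺ (suc m) b) ⟩
    - (suc m · 1# * ι b)      ≈⟨ -‿distribˡ-* _ _ ⟩
    - (suc m · 1#) * ι b      ∎

  ι-1 : ι 1ℤ ≈ 1#
  ι-1 = ≈-refl

  private
    ring′ : AlmostCommutativeRing c ℓ
    ring′ = fromCommutativeRing k

    morphism : ℤ.+-*-rawRing -Raw-AlmostCommutative⟶ ring′
    morphism = record
      { ⟦_⟧ = ι ; +-homo = ι-+ ; *-homo = ι-* ; -‿homo = ι-neg ; 0-homo = ≈-refl ; 1-homo = ι-1 }

    coefficient≟ : ∀ a b → Maybe (ι a ≈ ι b)
    coefficient≟ a b with a ℤ.≟ b
    ... | yes refl = just ≈-refl
    ... | no  _    = nothing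

  open import Algebra.Solver.Ring ℤ.+-*-rawRing ring′ morphism coefficient≟ public
    using (solve; prove; _:+_; _:*_; _:-_; :-_; _:^_; _:=_; con; var; op; [+]; [*]; Polynomial; ⟦_⟧; ⟦_⟧↓)

-- Deviation of a measure from the cell formula

module Deviation {k : CommutativeRing c ℓ} (ν : Measure k) where

  open CommutativeRing k renaming (Carrier to ∣k∣; refl to ≈-refl; sym to ≈-sym; trans to ≈-trans)
  open SetoidReasoning setoid
  open Measure ν
  open Balance (multiplicative ν) using (all-sums-agree)
  open Totals k
  open Integers k using (solve; _:+_; _:*_; _:-_; :-_; _:=_; con)
  open import Algebra.Properties.AbelianGroup +-abelianGroup using (⁻¹-∙-comm; ε⁻¹≈ε)
  open import Algebra.Properties.CommutativeSemigroup +-commutativeSemigroup using (interchange)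

  markedValue : Fin 10 → ∣k∣
  markedValue m = valueAt ν (lookup markedPermutations m)

  open LocalValue k (weights k markedValue)

  value-members : (i : Embedding Y X) (j : Embedding Y Y′) (E : Enumeration i j) →
                  value i ≈ total (λ A → value (Amalgamation.i′ A)) (Enumeration.members E)
  value-members i j E = value-sum i j (enumeration⇒all E)

  cancel-common : ∀ u v w → (u + w) - (v + w) ≈ u - v
  cancel-common = solve 3 (λ u v w → (u :+ w) :- (v :+ w) := u :- v) ≈-refl

  total-zero : ∀ {b} {B : Set b} {h : B → ∣k∣} → (∀ x → h x ≈ 0#) → ∀ xs → total h xs ≈ 0#
  total-zero p []       = ≈-refl
  total-zero p (x ∷ xs) = ≈-trans (+-cong (p x) (total-zero p xs)) (+-identityʳ 0#)

  total-neg : ∀ {b} {B : Set b} (h : B → ∣k∣) xs → total (λ x → - h x) xs ≈ - total h xs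
  total-neg h []       = ≈-sym ε⁻¹≈ε
  total-neg h (x ∷ xs) = ≈-trans (+-congˡ (total-neg h xs)) (⁻¹-∙-comm _ _)

  total-minus : ∀ {b} {B : Set b} (h g : B → ∣k∣) xs → total (λ x → h x - g x) xs ≈ total h xs - total g xs
  total-minus h g xs = ≈-trans (total-+ h (λ x → - g x) xs) (+-congˡ (total-neg g xs))

  -- δ is additive without a correction for the merged amalgamation.

  δ : ∀ Y → Cell Y → ∣k∣
  δ Y C = value (extension Y C) - cellValue Y C

  δ-iso : (e : Embedding Y Z) → IsIso e → (C : Cell Y) (D : Cell Z) →
          (∀ a y → below C a y ≡ below D a (to e y)) → δ Y C ≈ δ Z D
  δ-iso {Y} {Z} e s C D h = +-cong (begin
      value (extension Y C)                ≈⟨ *-identityˡ _ ⟨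
      1# * value (extension Y C)           ≈⟨ *-congʳ (value-iso E (onto⇒iso E onto)) ⟨
      value E * value (extension Y C)      ≈⟨ value-∘ E (extension Y C) ⟨
      value (E ∘ᴱ extension Y C)           ≈⟨ value-cong {i = E ∘ᴱ extension Y C} {extension Z D ∘ᴱ e} (λ _ → refl) ⟩
      value (extension Z D ∘ᴱ e)           ≈⟨ value-∘ (extension Z D) e ⟩
      value (extension Z D) * value e      ≈⟨ *-congˡ (value-iso e s) ⟩
      value (extension Z D) * 1#           ≈⟨ *-identityʳ _ ⟩
      value (extension Z D)                ∎)
    (-‿cong (reflexive (localValue-embed e (elements Y) (elements Z) (below C) (below D)
      (λ _ → ∈-elements Z _)
      (λ {z} _ → proj₁ (iso⇒onto e s z) , ∈-elements Y _ , proj₂ (iso⇒onto e s z))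
      (λ a {y} _ → h a y))))
    where
    E : Embedding (extend Y C) (extend Z D)
    E = extend-map C (extension Z D ∘ᴱ e) nothing
      (λ a y p → extend-order Z D a (lower (trans (sym (h a y)) p)))
      (λ a y p → extend-order Z D a (upper (trans (sym (h a y)) p)))

    onto : Onto E
    onto nothing  = nothing , refl
    onto (just z) = just (proj₁ (iso⇒onto e s z)) , cong just (proj₂ (iso⇒onto e s z))

  δ-cong : ∀ Y {C D : Cell Y} → (∀ a y → below C a y ≡ below D a y) → δ Y C ≈ δ Y D
  δ-cong Y {C} {D} = δ-iso idᴱ (idᴱ , (λ _ → refl) , λ _ → refl) C D

  value-extend : (i : Embedding Y X) (P : OnePoint i) → value i ≈ value (extension Y (cellOf i (OnePoint.point P)))
  value-extend {Y} i P = let f , s , p , _ = extend≅ i P ; C = cellOf i (OnePoint.point P) in begin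
    value i                              ≈⟨ value-cong {i = f ∘ᴱ extension Y C} {i} p ⟨
    value (f ∘ᴱ extension Y C)           ≈⟨ value-∘ f (extension Y C) ⟩
    value f * value (extension Y C)      ≈⟨ *-congʳ (value-iso f s) ⟩
    1# * value (extension Y C)           ≈⟨ *-identityˡ _ ⟩
    value (extension Y C)                ∎

  module Addition {Y X Y′ : Permutation} (i : Embedding Y X) (j : Embedding Y Y′)
                  (P : OnePoint i) (Q : OnePoint j) where

    open OnePointAmalgamations i j P Q
    open OnePoint P using () renaming (point to x)
    open OnePoint Q using () renaming (point to p; fresh to p-fresh; cover to Y′-cover)

    private
      module S = Additivity k (quadrant k markedValue)

      f : Option place → Option height → ∣k∣
      f = S.G i j P Q

      g : Option place → Option height → ∣k∣
      g o₁ o₂ = value (extension Y′ (cell (choice o₁ o₂)))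

      m : ∣k∣
      m = S.merged i j P Q allAllowed?

    δ-options : Option place → Option height → ∣k∣
    δ-options o₁ o₂ = δ Y′ (cell (choice o₁ o₂))

    δ-rows : Option place → ∣k∣
    δ-rows o₁ = total (δ-options o₁) (options height)

    -- The merged amalgamation contributes the same `m` to the measure and to the formula, and the
    -- two cancel.
    δ-additive : value i - cellValue Y (cellOf i x) ≈ total δ-rows (options place)
    δ-additive = begin
      value i - cellValue Y (cellOf i x)
        ≈⟨ +-cong (value-members i j onePoint-enumeration) (-‿cong (≈-sym (S.cellValue-total i j P Q))) ⟩
      total (λ B → value (Amalgamation.i′ B)) (Enumeration.members onePoint-enumeration) -
      (total (S.rows i j P Q) (options place) + m)
        ≈⟨ +-congʳ (S.members-total i j P Q (λ B → value (Amalgamation.i′ B)) g (λ _ _ → ≈-refl)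
             (λ _ → value-iso (idᴱ {X = Y′}) (idᴱ , (λ _ → refl) , λ _ → refl))) ⟩
      (total (λ o₁ → total (g o₁) (options height)) (options place) + m) -
      (total (S.rows i j P Q) (options place) + m)
        ≈⟨ cancel-common (total (λ o₁ → total (g o₁) (options height)) (options place))
             (total (S.rows i j P Q) (options place)) m ⟩
      total (λ o₁ → total (g o₁) (options height)) (options place) - total (S.rows i j P Q) (options place)
        ≈⟨ total-minus (λ o₁ → total (g o₁) (options height)) (S.rows i j P Q) (options place) ⟨
      total (λ o₁ → total (g o₁) (options height) - S.rows i j P Q o₁) (options place)
        ≈⟨ total-cong (λ o₁ → ≈-sym (total-minus (g o₁) (f o₁) (options height))) (options place) ⟩
      total δ-rows (options place) ∎

    δ-vanishes : (∀ C → δ Y′ C ≈ 0#) → value i - cellValue Y (cellOf i x) ≈ 0#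
    δ-vanishes z = ≈-trans δ-additive (total-zero
      (λ o₁ → total-zero (λ o₂ → z (cell (choice o₁ o₂))) (options height)) (options place))

    module _ (C : Cell Y′) (extends : ∀ a y → below C a (to j y) ≡ below (cellOf i x) a y) where

      open Moves Y′

      below-cell : ∀ o a z → z ≢ p → below (cell o) a z ≡ below C a z
      below-cell o a z ne = go (Y′-cover z)
        where
        go : z ≡ p ⊎ (∃ λ y → to j y ≡ z) → below (cell o) a z ≡ below C a z
        go (inj₁ e)          = contradiction e ne
        go (inj₂ (y , refl)) = trans (below-old o a y) (sym (extends a y))

      stay : ∀ o a → proj₁ (o a) ≡ below C a p → ∀ z → below (cell o) a z ≡ below C a z
      stay o a e z = go (_≟_ {Y′} z p)
        where
        go : Dec (z ≡ p) → below (cell o) a z ≡ below C a z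
        go (yes refl) = trans (below-new o a) e
        go (no ne)    = below-cell o a z ne

      turn : ∀ o a → proj₁ (o a) ≡ not (below C a p) → ∀ z → below (cell o) a z ≡ toggle (below C a) p z
      turn o a e z = go (_≟_ {Y′} z p)
        where
        go : Dec (z ≡ p) → below (cell o) a z ≡ toggle (below C a) p z
        go (yes refl) = trans (below-new o a) (trans e (sym (toggle-at (below C a) p)))
        go (no ne)    = trans (below-cell o a z ne) (sym (toggle-off (below C a) ne))

      allowed⇒ : ∀ a b → Allowed a b → ∀ z → z ≢ p → Ord Y′ a b z p → below C a z ≡ b
      allowed⇒ a b A z ne = go (Y′-cover z)
        where
        go : z ≡ p ⊎ (∃ λ y → to j y ≡ z) → Ord Y′ a b z p → below C a z ≡ b
        go (inj₁ e)          r = contradiction e ne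
        go (inj₂ (y , refl)) r = trans (extends a y) (S.Ord⇒side i j P Q a b (S.allowed⇒ i j P Q a b A y r))

      ⇒allowed : ∀ a b → (∀ z → z ≢ p → Ord Y′ a b z p → below C a z ≡ b) → Allowed a b
      ⇒allowed a b f = S.⇒allowed i j P Q a b λ y r →
        S.side⇒Ord i j P Q a b (trans (sym (extends a y)) (f (to j y) (p-fresh y) r))

      allowed-here : ∀ a → Allowed a (below C a p)
      allowed-here a = ⇒allowed a (below C a p) λ z ne r → closed-Ord (closed C a) (below C a p) r refl

      -- The new point may also go to the other side of `p` exactly if `p` bounds its cell. With the
      -- converse below, this turns the terms of an additive sum into moves of the cell.
      allowed⇒move : ∀ a → Allowed a (not (below C a p)) → CanMove C a p
      allowed⇒move a A z r = allowed⇒ a (not (below C a p)) A z ne (Ord-reverse Y′ a (below C a p) r)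
        where
        ne : z ≢ p
        ne refl = Ord-asym Y′ a (below C a p) r r

      move⇒allowed : ∀ a → CanMove C a p → Allowed a (not (below C a p))
      move⇒allowed a m = ⇒allowed a (not (below C a p)) λ z ne r → m z (Ord-reverse⁻ Y′ a (below C a p) r)

      options-far : ∀ a → ¬ CanMove C a p →
        Σ[ o ∈ Option a ] proj₁ o ≡ below C a p × (∀ (g : Option a → ∣k∣) → total g (options a) ≈ g o)
      options-far a ¬m = go (S.optionsOf i j P Q a)
        where
        go : S.Options i j P Q a →
          Σ[ o ∈ Option a ] proj₁ o ≡ below C a p × (∀ (g : Option a → ∣k∣) → total g (options a) ≈ g o)
        go (S.one (b , A) n t) = (b , A) , decidable-stable (b Bool.≟ below C a p)
          (λ ne → ¬m (allowed⇒move a (subst (Allowed a) (Bool.¬-not ne) A))) , t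
        go (S.both A B t) = ⊥-elim (¬m (allowed⇒move a (any (not (below C a p)))))
          where
          any : ∀ b → Allowed a b
          any true  = A
          any false = B

      options-cross : ∀ a → CanMove C a p →
        Σ[ o ∈ Option a ] Σ[ q ∈ Option a ] proj₁ o ≡ below C a p × proj₁ q ≡ not (below C a p) ×
          (∀ (g : Option a → ∣k∣) → total g (options a) ≈ g o + g q)
      options-cross a m = go (below C a p) (allowed-here a) (move⇒allowed a m) (S.optionsOf i j P Q a)
        where
        go : ∀ d → Allowed a d → Allowed a (not d) → S.Options i j P Q a →
          Σ[ o ∈ Option a ] Σ[ q ∈ Option a ] proj₁ o ≡ d × proj₁ q ≡ not d ×
            (∀ (g : Option a → ∣k∣) → total g (options a) ≈ g o + g q)
        go true  A′ B′ (S.one (true , _) n t)  = contradiction B′ n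
        go true  A′ B′ (S.one (false , _) n t) = contradiction A′ n
        go false A′ B′ (S.one (true , _) n t)  = contradiction A′ n
        go false A′ B′ (S.one (false , _) n t) = contradiction B′ n
        go true  A′ B′ (S.both A B t) = (true , A) , (false , B) , refl , refl , t
        go false A′ B′ (S.both A B t) = (false , B) , (true , A) , refl , refl , λ g → ≈-trans (t g) (+-comm _ _)

      module _ (vanish : value i - cellValue Y (cellOf i x) ≈ 0#) where

        δ-far : (∀ a → ¬ CanMove C a p) → δ Y′ C ≈ 0#
        δ-far n = let o₁ , e₁ , t₁ = options-far place (n place)
                      o₂ , e₂ , t₂ = options-far height (n height)
                      o = choice o₁ o₂ in begin
          δ Y′ C            ≈⟨ δ-cong Y′ (λ { place y → stay o place e₁ y ; height y → stay o height e₂ y }) ⟨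
          δ-options o₁ o₂  ≈⟨ t₂ (δ-options o₁) ⟨
          δ-rows o₁        ≈⟨ t₁ δ-rows ⟨
          total δ-rows (options place) ≈⟨ δ-additive ⟨
          value i - cellValue Y (cellOf i x) ≈⟨ vanish ⟩
          0#               ∎

        δ-cross : ∀ a (m : CanMove C a p) → ¬ CanMove C (other a) p → δ Y′ C + δ Y′ (move C a p m) ≈ 0#
        δ-cross place m n = let o₁ , q₁ , e₁ , f₁ , t₁ = options-cross place m
                                o₂ , e₂ , t₂ = options-far height n
                                o = choice o₁ o₂
                                q = choice q₁ o₂ in begin
          δ Y′ C + δ Y′ (move C place p m)
            ≈⟨ +-cong (δ-cong Y′ (λ { place y → stay o place e₁ y ; height y → stay o height e₂ y }))
                      (δ-cong Y′ (λ { place y → turn q place f₁ y ; height y → stay q height e₂ y })) ⟨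
          δ-options o₁ o₂ + δ-options q₁ o₂  ≈⟨ +-cong (t₂ (δ-options o₁)) (t₂ (δ-options q₁)) ⟨
          δ-rows o₁ + δ-rows q₁ ≈⟨ t₁ δ-rows ⟨
          total δ-rows (options place) ≈⟨ δ-additive ⟨
          value i - cellValue Y (cellOf i x) ≈⟨ vanish ⟩
          0#               ∎
        δ-cross height m n = let o₁ , e₁ , t₁ = options-far place n
                                 o₂ , q₂ , e₂ , f₂ , t₂ = options-cross height m
                                 o = choice o₁ o₂
                                 q = choice o₁ q₂ in begin
          δ Y′ C + δ Y′ (move C height p m)
            ≈⟨ +-cong (δ-cong Y′ (λ { place y → stay o place e₁ y ; height y → stay o height e₂ y }))
                      (δ-cong Y′ (λ { place y → stay q place e₁ y ; height y → turn q height f₂ y })) ⟨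
          δ-options o₁ o₂ + δ-options o₁ q₂  ≈⟨ t₂ (δ-options o₁) ⟨
          δ-rows o₁        ≈⟨ t₁ δ-rows ⟨
          total δ-rows (options place) ≈⟨ δ-additive ⟨
          value i - cellValue Y (cellOf i x) ≈⟨ vanish ⟩
          0#               ∎

        δ-around : (m : CanMove C place p) (n : CanMove C height p) →
          (δ Y′ C + δ Y′ (move C place p m)) + (δ Y′ (move C height p n) + δ Y′ (moveBoth C p m n)) ≈ 0#
        δ-around m n = let o₁ , q₁ , e₁ , f₁ , t₁ = options-cross place m
                           o₂ , q₂ , e₂ , f₂ , t₂ = options-cross height n
                           oo = choice o₁ o₂
                           oq = choice o₁ q₂
                           qo = choice q₁ o₂
                           qq = choice q₁ q₂ in begin
          (δ Y′ C + δ Y′ (move C place p m)) + (δ Y′ (move C height p n) + δ Y′ (moveBoth C p m n))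
            ≈⟨ interchange _ _ _ _ ⟩
          (δ Y′ C + δ Y′ (move C height p n)) + (δ Y′ (move C place p m) + δ Y′ (moveBoth C p m n))
            ≈⟨ +-cong
                 (+-cong (δ-cong Y′ (λ { place y → stay oo place e₁ y ; height y → stay oo height e₂ y }))
                         (δ-cong Y′ (λ { place y → stay oq place e₁ y ; height y → turn oq height f₂ y })))
                 (+-cong (δ-cong Y′ (λ { place y → turn qo place f₁ y ; height y → stay qo height e₂ y }))
                         (δ-cong Y′ (λ { place y → turn qq place f₁ y ; height y → turn qq height f₂ y }))) ⟨
          (δ-options o₁ o₂ + δ-options o₁ q₂) + (δ-options q₁ o₂ + δ-options q₁ q₂)
            ≈⟨ +-cong (t₂ (δ-options o₁)) (t₂ (δ-options q₁)) ⟨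
          δ-rows o₁ + δ-rows q₁ ≈⟨ t₁ δ-rows ⟨
          total δ-rows (options place) ≈⟨ δ-additive ⟨
          value i - cellValue Y (cellOf i x) ≈⟨ vanish ⟩
          0#               ∎

  module Removal (Y : Permutation) (C : Cell Y) (p : Carrier Y) where

    open Moves Y

    -- `C` is one of the parts into which `p` cuts this cell, so additivity under adding `p` says
    -- something about `δ` at `C`.
    restrict : Cell (Y ∖ p)
    restrict = record
      { below  = λ a z → below C a (proj₁ z)
      ; closed = λ a {y} {z} r → closed C a (mono (inclusion Y p) a {y} {z} r) }

    private
      i : Embedding (Y ∖ p) (extend (Y ∖ p) restrict)
      i = extension (Y ∖ p) restrict

      module A = Addition i (inclusion Y p) (extension-onePoint (Y ∖ p) restrict) (inclusion-onePoint Y p)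

      extends : ∀ a y → below C a (proj₁ y) ≡ below (cellOf i nothing) a y
      extends a y = sym (cellOf-extension (Y ∖ p) restrict a y)

      restricted : δ (Y ∖ p) restrict ≈ value i - cellValue (Y ∖ p) (cellOf i nothing)
      restricted = +-congˡ (-‿cong (reflexive
        (cellValue-cong k (weights k markedValue) (Y ∖ p) {restrict} {cellOf i nothing} extends)))

    δ-removed : (∀ C → δ Y C ≈ 0#) → δ (Y ∖ p) restrict ≈ 0#
    δ-removed z = ≈-trans restricted (A.δ-vanishes z)

    module _ (vanish : δ (Y ∖ p) restrict ≈ 0#) where

      private
        vanish′ : value i - cellValue (Y ∖ p) (cellOf i nothing) ≈ 0#
        vanish′ = ≈-trans (≈-sym restricted) vanish

      δ-far : (∀ a → ¬ CanMove C a p) → δ Y C ≈ 0#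
      δ-far = A.δ-far C extends vanish′

      δ-cross : ∀ a (m : CanMove C a p) → ¬ CanMove C (other a) p → δ Y C + δ Y (move C a p m) ≈ 0#
      δ-cross = A.δ-cross C extends vanish′

      δ-around : (m : CanMove C place p) (n : CanMove C height p) →
        (δ Y C + δ Y (move C place p m)) + (δ Y (move C height p n) + δ Y (moveBoth C p m n)) ≈ 0#
      δ-around = A.δ-around C extends vanish′

wordCell : ∀ m → Cell (unmarked m)
wordCell m = cellOf (marked-inclusion m) (OnePoint.point (marked-onePoint m))

column : Fin 8 → Fin 10
column i = suc (Fin.inject₁ i)

-- The cell formula with symbolic parameters

module Symbolic (k : CommutativeRing c ℓ) (x : Fin 10 → CommutativeRing.Carrier k) where

  open CommutativeRing k renaming (Carrier to ∣k∣; refl to ≈-refl; sym to ≈-sym; trans to ≈-trans)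
  open LocalValue k (weights k x)
  open Integers k

  z : Vec ∣k∣ 8
  z = Vec.tabulate (λ i → x (column i))

  -- For two points the formulas arise by cutting along their lines. With `q` below and left of `p`,
  -- add to the quadrant of `p` the cell right of `p` between the heights. With `q` above and right,
  -- add to the quadrant of `q` the cell above `q` between the places; with `q` above and left,
  -- subtract that cell instead. With `q` below and right, the half-plane above `q` loses its part
  -- left of `p` and the point `p` itself, which accounts for the constant 1.
  quadrantᴾ : Position → Polynomial 8
  quadrantᴾ none                = con 1ℤ :+ ((var 0F :+ var 1F) :+ (var 2F :+ var 3F))
  quadrantᴾ first               = var 1F :+ var 2F
  quadrantᴾ second              = var 1F :+ var 3F
  quadrantᴾ same                = var 1F
  quadrantᴾ (apart true true)   = var 1F :+ var 4F
  quadrantᴾ (apart true false)  = var 1F :- var 7F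
  quadrantᴾ (apart false true)  = var 1F :- (con 1ℤ :+ var 6F)
  quadrantᴾ (apart false false) = var 1F :+ var 5F

  weightᴾ : Weight (Polynomial 8)
  weightᴾ true  true  π           = quadrantᴾ π
  weightᴾ false true  none        = con 0ℤ
  weightᴾ false true  second      = con 0ℤ
  weightᴾ false true  π           = :- quadrantᴾ π
  weightᴾ true  false none        = con 0ℤ
  weightᴾ true  false first       = con 0ℤ
  weightᴾ true  false π           = :- quadrantᴾ π
  weightᴾ false false (apart w s) = quadrantᴾ (apart w s)
  weightᴾ false false same        = quadrantᴾ same :- con 1ℤ
  weightᴾ false false _           = con 0ℤ

  quadrantᴾ-sound : ∀ π → ⟦ quadrantᴾ π ⟧ z ≈ quadrant k x π
  quadrantᴾ-sound none                = ≈-refl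
  quadrantᴾ-sound first               = ≈-refl
  quadrantᴾ-sound second              = ≈-refl
  quadrantᴾ-sound same                = ≈-refl
  quadrantᴾ-sound (apart true true)   = ≈-refl
  quadrantᴾ-sound (apart true false)  = ≈-refl
  quadrantᴾ-sound (apart false true)  = ≈-refl
  quadrantᴾ-sound (apart false false) = ≈-refl

  weightᴾ-sound : ∀ h v π → ⟦ weightᴾ h v π ⟧ z ≈ weights k x h v π
  weightᴾ-sound true  true  π           = quadrantᴾ-sound π
  weightᴾ-sound false true  none        = ≈-refl
  weightᴾ-sound false true  first       = -‿cong (quadrantᴾ-sound first)
  weightᴾ-sound false true  second      = ≈-refl
  weightᴾ-sound false true  same        = -‿cong (quadrantᴾ-sound same)
  weightᴾ-sound false true  (apart w s) = -‿cong (quadrantᴾ-sound (apart w s))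
  weightᴾ-sound true  false none        = ≈-refl
  weightᴾ-sound true  false first       = ≈-refl
  weightᴾ-sound true  false second      = -‿cong (quadrantᴾ-sound second)
  weightᴾ-sound true  false same        = -‿cong (quadrantᴾ-sound same)
  weightᴾ-sound true  false (apart w s) = -‿cong (quadrantᴾ-sound (apart w s))
  weightᴾ-sound false false none        = ≈-refl
  weightᴾ-sound false false first       = ≈-refl
  weightᴾ-sound false false second      = ≈-refl
  weightᴾ-sound false false same        = +-congʳ (quadrantᴾ-sound same)
  weightᴾ-sound false false (apart w s) = quadrantᴾ-sound (apart w s)

  private
    corner : ∀ Y → Cell Y → Bool → Bool → Position
    corner Y C h v = position Y (neighbour Y (elements Y) (below C) place h) (neighbour Y (elements Y) (below C) height v)

  cellᴾ : ∀ Y → Cell Y → Polynomial 8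
  cellᴾ Y C = (weightᴾ true true (corner Y C true true) :+ weightᴾ false true (corner Y C false true)) :+
              (weightᴾ true false (corner Y C true false) :+ weightᴾ false false (corner Y C false false))

  cellᴾ-sound : ∀ Y C → ⟦ cellᴾ Y C ⟧ z ≈ cellValue Y C
  cellᴾ-sound Y C = +-cong
    (+-cong (weightᴾ-sound true true (corner Y C true true)) (weightᴾ-sound false true (corner Y C false true)))
    (+-cong (weightᴾ-sound true false (corner Y C true false)) (weightᴾ-sound false false (corner Y C false false)))

  -- The parameters were chosen to make these polynomial identities; the solver verifies them once
  -- the neighbours in the eight words have been computed.
  word-value : ∀ i → cellValue (unmarked (column i)) (wordCell (column i)) ≈ x (column i)
  word-value i = ≈-trans (≈-sym (cellᴾ-sound (unmarked (column i)) (wordCell (column i)))) (symbolic i)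
    where
    symbolic : ∀ i → ⟦ cellᴾ (unmarked (column i)) (wordCell (column i)) ⟧ z ≈ x (column i)
    symbolic 0F = prove z (cellᴾ (unmarked 1F) (wordCell 1F)) (var 0F) ≈-refl
    symbolic 1F = prove z (cellᴾ (unmarked 2F) (wordCell 2F)) (var 1F) ≈-refl
    symbolic 2F = prove z (cellᴾ (unmarked 3F) (wordCell 3F)) (var 2F) ≈-refl
    symbolic 3F = prove z (cellᴾ (unmarked 4F) (wordCell 4F)) (var 3F) ≈-refl
    symbolic 4F = prove z (cellᴾ (unmarked 5F) (wordCell 5F)) (var 4F) ≈-refl
    symbolic 5F = prove z (cellᴾ (unmarked 6F) (wordCell 6F)) (var 5F) ≈-refl
    symbolic 6F = prove z (cellᴾ (unmarked 7F) (wordCell 7F)) (var 6F) ≈-refl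
    symbolic 7F = prove z (cellᴾ (unmarked 8F) (wordCell 8F)) (var 7F) ≈-refl

-- Vanishing of the deviation

module CellFormula {k : CommutativeRing c ℓ} (ν : Measure k) where

  open CommutativeRing k renaming (Carrier to ∣k∣; refl to ≈-refl; sym to ≈-sym; trans to ≈-trans)
  open SetoidReasoning setoid
  open Measure ν
  open Deviation ν
  open Totals k
  open LocalValue k (weights k markedValue)
  open Symbolic k markedValue using (word-value)
  open import Algebra.Properties.Group +-group
    using () renaming (x≈y⇒x∙y⁻¹≈ε to x≈y⇒x-y≈0; x∙y⁻¹≈ε⇒x≈y to x-y≈0⇒x≈y)

  word-zero : ∀ i → let m = column i in δ (unmarked m) (wordCell m) ≈ 0#
  word-zero i = let m = column i in x≈y⇒x-y≈0
    (≈-trans (≈-sym (value-extend (marked-inclusion m) (marked-onePoint m))) (≈-sym (word-value i)))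

  module _ {Y : Permutation} {p : Carrier Y} (cover : ∀ y → y ≡ p) where

    singleton-embedding : ∀ Z → Carrier Z → Embedding Y Z
    singleton-embedding Z u = embedding (λ _ → u) λ a {y} {z} r →
      contradiction (subst₂ (Order Y a) (cover y) (cover z) r) (irrefl Y a)

    singleton-zero : ∀ C i (u : Carrier (unmarked (column i))) → (∀ z → u ≡ z) →
      (∀ a → below C a p ≡ below (wordCell (column i)) a u) → δ Y C ≈ 0#
    singleton-zero C i u all h = ≈-trans
      (δ-iso f (onto⇒iso f λ z → p , all z) C (wordCell m) (λ a y → trans (cong (below C a) (cover y)) (h a)))
      (word-zero i)
      where
      m = column i
      f = singleton-embedding (unmarked m) u

    -- The four cells around a single point are those of the first four of the eight words.
    one-zero : ∀ C → δ Y C ≈ 0#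
    one-zero C = go (below C place p) (below C height p) refl refl
      where
      go : ∀ d e → below C place p ≡ d → below C height p ≡ e → δ Y C ≈ 0#
      go true true f g = singleton-zero C 1F (0F , λ ())
        (λ { (0F , _) → refl ; (1F , n) → contradiction refl n }) λ { place → f ; height → g }
      go true false f g = singleton-zero C 2F (0F , λ ())
        (λ { (0F , _) → refl ; (1F , n) → contradiction refl n }) λ { place → f ; height → g }
      go false true f g = singleton-zero C 3F (1F , λ ())
        (λ { (1F , _) → refl ; (0F , n) → contradiction refl n }) λ { place → f ; height → g }
      go false false f g = singleton-zero C 0F (1F , λ ())
        (λ { (1F , _) → refl ; (0F , n) → contradiction refl n }) λ { place → f ; height → g }

  module _ {Y : Permutation} {p q : Carrier Y} (p≢q : p ≢ q) (cover : ∀ y → y ≡ p ⊎ y ≡ q) where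

    open Moves Y

    pair-zero : ∀ C l → let m = column l in (u v : Carrier (unmarked m)) → (∀ z → u ≡ z ⊎ v ≡ z) →
      (∀ a → ∃ λ d → Ord Y a d p q × Ord (unmarked m) a d u v) →
      (∀ a → below C a p ≡ below (wordCell m) a u) → (∀ a → below C a q ≡ below (wordCell m) a v) → δ Y C ≈ 0#
    pair-zero C l u v all ord hp hq = ≈-trans
      (δ-iso i (onto⇒iso i onto) C (wordCell m) (λ a y → agree a y (cover y))) (word-zero l)
      where
      m : Fin 10
      m = column l

      f : ∀ y → y ≡ p ⊎ y ≡ q → Carrier (unmarked m)
      f y (inj₁ _) = u
      f y (inj₂ _) = v

      ordered : ∀ a d {s t} → Ord Y a d p q → Ord (unmarked m) a d s t →
                (Order Y a p q → Order (unmarked m) a s t) × (Order Y a q p → Order (unmarked m) a t s)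
      ordered a true  r w = (λ _ → w) , (λ r′ → contradiction r (asym Y a r′))
      ordered a false r w = (λ r′ → contradiction r (asym Y a r′)) , (λ _ → w)

      monotone : ∀ a {y z} → Order Y a y z → ∀ cy cz → Order (unmarked m) a (f y cy) (f z cz)
      monotone a r (inj₁ refl) (inj₁ refl) = contradiction r (irrefl Y a)
      monotone a r (inj₂ refl) (inj₂ refl) = contradiction r (irrefl Y a)
      monotone a r (inj₁ refl) (inj₂ refl) = let d , s , t = ord a in proj₁ (ordered a d s t) r
      monotone a r (inj₂ refl) (inj₁ refl) = let d , s , t = ord a in proj₂ (ordered a d s t) r

      i : Embedding Y (unmarked m)
      i = embedding (λ y → f y (cover y)) λ a {y} {z} r → monotone a r (cover y) (cover z)

      f-p : ∀ c → f p c ≡ u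
      f-p (inj₁ _) = refl
      f-p (inj₂ e) = contradiction e p≢q

      f-q : ∀ c → f q c ≡ v
      f-q (inj₁ e) = contradiction (sym e) p≢q
      f-q (inj₂ _) = refl

      onto : Onto i
      onto z with all z
      ... | inj₁ refl = p , f-p (cover p)
      ... | inj₂ refl = q , f-q (cover q)

      agree : ∀ a y cy → below C a y ≡ below (wordCell m) a (f y cy)
      agree a y (inj₁ refl) = hp a
      agree a y (inj₂ refl) = hq a

    -- Of two points, one that does not bound the cell on an axis can only be hidden by the other.
    behind : ∀ a {c} → Movable a c p → ¬ Movable a c q → c q ≡ c p × Ord Y a (c p) q p
    behind a {c} m n = same-side , order (Ord-compare Y a (c p) q p)
      where
      same-side : c q ≡ c p
      same-side = decidable-stable (c q Bool.≟ c p) λ ne → n λ y r → next (Bool.¬-not ne) y r (cover y)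
        where
        next : c q ≡ not (c p) → ∀ y → Ord Y a (c q) q y → y ≡ p ⊎ y ≡ q → c y ≡ not (c q)
        next e y r (inj₁ refl) = trans (sym (Bool.not-involutive (c p))) (cong not (sym e))
        next e y r (inj₂ refl) = contradiction r (Ord-asym Y a (c q) r)

      order : Tri (Ord Y a (c p) q p) (q ≡ p) (Ord Y a (c p) p q) → Ord Y a (c p) q p
      order (tri< r _ _) = r
      order (tri≈ _ e _) = contradiction (sym e) p≢q
      order (tri> _ _ r) = contradiction m (blocked same-side r)

  module _ {Y : Permutation} {p q : Carrier Y} (p≢q : p ≢ q) (cover : ∀ y → y ≡ p ⊎ y ≡ q)
           (vanish : ∀ p C → δ (Y ∖ p) C ≈ 0#) where

    open Moves Y

    private
      module V = Vanishing k Y (δ Y)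
      far    = λ C p → Removal.δ-far Y C p (vanish p _)
      cross  = λ C p → Removal.δ-cross Y C p (vanish p _)
      around = λ C p → Removal.δ-around Y C p (vanish p _)

    -- In place `q` is hidden behind `p`, and in height `p` is hidden behind `q`, so the cell lies
    -- beyond both points on both axes. One move brings it between them, to the cell of one of the
    -- last four of the eight words; which line to cross depends on the word available.
    base : ∀ C → CanMove C place p × ¬ CanMove C height p →
           CanMove C height q × ¬ CanMove C place q → δ Y C ≈ 0#
    base C (pm , ph) (qm , qp) = go (below C place p) (below C height q) refl refl
      where
      q-side : below C place q ≡ below C place p × Ord Y place (below C place p) q p
      q-side = behind p≢q cover place {below C place} pm qp

      p-side : below C height p ≡ below C height q × Ord Y height (below C height q) p q
      p-side = behind (λ e → p≢q (sym e)) (λ y → [ inj₂ , inj₁ ]′ (cover y)) height {below C height} qm ph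

      C₁ : Cell Y
      C₁ = move C place p pm

      C₂ : Cell Y
      C₂ = move C height q qm

      zero₁ : δ Y C₁ ≈ 0# → δ Y C ≈ 0#
      zero₁ = V.cross-zero far cross around C p place pm ph

      zero₂ : δ Y C₂ ≈ 0# → δ Y C ≈ 0#
      zero₂ = V.cross-zero far cross around C q height qm qp

      place₁ : ∀ {d} → below C place p ≡ d → toggle (below C place) p p ≡ not d × toggle (below C place) p q ≡ d
      place₁ e = trans (toggle-at (below C place) p) (cong not e) ,
                 trans (toggle-off (below C place) (λ e → p≢q (sym e))) (trans (proj₁ q-side) e)

      height₂ : ∀ {d} → below C height q ≡ d → toggle (below C height) q q ≡ not d × toggle (below C height) q p ≡ d
      height₂ e = trans (toggle-at (below C height) q) (cong not e) ,
                  trans (toggle-off (below C height) p≢q) (trans (proj₁ p-side) e)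

      order-p : ∀ d → below C place p ≡ d → Ord Y place (not d) p q
      order-p d e = Ord-reverse Y place d (subst (λ d → Ord Y place d q p) e (proj₂ q-side))

      order-q : ∀ d → below C height q ≡ d → Ord Y height d p q
      order-q d e = subst (λ d → Ord Y height d p q) e (proj₂ p-side)

      go : ∀ d e → below C place p ≡ d → below C height q ≡ e → δ Y C ≈ 0#
      go false true f g = zero₁ (pair-zero p≢q cover C₁ 5F (0F , λ ()) (2F , λ ())
        (λ { (0F , _) → inj₁ refl ; (1F , n) → contradiction refl n ; (2F , _) → inj₂ refl })
        (λ { place → true , order-p false f , from-yes (Fin._<?_ {3} {3} 0F 2F)
           ; height → true , order-q true g , from-yes (1 ℕ.<? 2) })
        (λ { place → proj₁ (place₁ f) ; height → trans (proj₁ p-side) g })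
        (λ { place → proj₂ (place₁ f) ; height → g }))
      go true false f g = zero₂ (pair-zero p≢q cover C₂ 4F (1F , λ ()) (0F , λ ())
        (λ { (0F , _) → inj₂ refl ; (2F , n) → contradiction refl n ; (1F , _) → inj₁ refl })
        (λ { place → false , order-p true f , from-yes (Fin._<?_ {3} {3} 0F 1F)
           ; height → false , order-q false g , from-yes (1 ℕ.<? 3) })
        (λ { place → f ; height → proj₂ (height₂ g) })
        (λ { place → trans (proj₁ q-side) f ; height → proj₁ (height₂ g) }))
      go false false f g = zero₂ (pair-zero p≢q cover C₂ 6F (1F , λ ()) (2F , λ ())
        (λ { (1F , _) → inj₁ refl ; (0F , n) → contradiction refl n ; (2F , _) → inj₂ refl })
        (λ { place → true , order-p false f , from-yes (Fin._<?_ {3} {3} 1F 2F)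
           ; height → false , order-q false g , from-yes (1 ℕ.<? 3) })
        (λ { place → f ; height → proj₂ (height₂ g) })
        (λ { place → trans (proj₁ q-side) f ; height → proj₁ (height₂ g) }))
      go true true f g = zero₁ (pair-zero p≢q cover C₁ 7F (2F , λ ()) (0F , λ ())
        (λ { (2F , _) → inj₁ refl ; (1F , n) → contradiction refl n ; (0F , _) → inj₂ refl })
        (λ { place → false , order-p true f , from-yes (Fin._<?_ {3} {3} 0F 2F)
           ; height → true , order-q true g , from-yes (1 ℕ.<? 2) })
        (λ { place → proj₁ (place₁ f) ; height → trans (proj₁ p-side) g })
        (λ { place → proj₂ (place₁ f) ; height → g }))

  -- None of the eight words has this cell; additivity under adding one point reduces it to cells of
  -- a single point. The choice of `C₁` is arbitrary, because every cell restricts to the only cell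
  -- of the empty permutation.
  empty-zero : ∀ Y C → (∀ y → y ∉ elements Y) → δ Y C ≈ 0#
  empty-zero Y C void = begin
    δ Y C                      ≈⟨ δ-iso e (onto⇒iso e onto) C restrict (λ a y → contradiction (∈-elements Y y) (void y)) ⟩
    δ (Y₁ ∖ nothing) restrict  ≈⟨ δ-removed (one-zero only) ⟩
    0#                         ∎
    where
    Y₁ : Permutation
    Y₁ = extend Y C

    only : ∀ y → y ≡ nothing
    only nothing  = refl
    only (just y) = contradiction (∈-elements Y y) (void y)

    C₁ : Cell Y₁
    C₁ = record { below = λ _ _ → true ; closed = λ _ _ _ → refl }

    open Removal Y₁ C₁ nothing

    e : Embedding Y (Y₁ ∖ nothing)
    e = corestrict (extension Y C) nothing (λ _ ())

    onto : Onto e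
    onto (just y , _)  = y , refl
    onto (nothing , n) = contradiction refl n

  δ-zero : ∀ Y C → δ Y C ≈ 0#
  δ-zero Y C = go (size Y) Y C refl
    where
    go : ∀ n Y C → size Y ≡ n → δ Y C ≈ 0#
    go n Y C eq = by-elements (elements Y) (∈-elements Y) (elements-unique Y)
      where
      vanish : ∀ n → size Y ≡ n → ∀ p C → δ (Y ∖ p) C ≈ 0#
      vanish zero    eq p C = contradiction (subst Fin eq (Inverse.to (enumeration Y) p)) Fin.¬Fin0
      vanish (suc n) eq p C = go n (Y ∖ p) C (cong ℕ.pred eq)

      v : ∀ p C → δ (Y ∖ p) C ≈ 0#
      v = vanish n eq

      far    = λ C p → Removal.δ-far Y C p (v p _)
      cross  = λ C p → Removal.δ-cross Y C p (v p _)
      around = λ C p → Removal.δ-around Y C p (v p _)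

      by-elements : ∀ ys → (∀ y → y ∈ ys) → AllPairs _≢_ ys → δ Y C ≈ 0#
      by-elements [] f _ = empty-zero Y C λ y _ → case f y of λ ()
      by-elements (p ∷ []) f _ = one-zero (λ y → case f y of λ { (here e) → e }) C
      by-elements (p ∷ q ∷ []) f ((p≢q ∷ _) ∷ _) = Vanishing.two-zero k Y (δ Y) far cross around
        (λ C p≢q cov → base p≢q cov v C) C p≢q (λ y → case f y of λ { (here e) → inj₁ e ; (there (here e)) → inj₂ e })
      by-elements (p ∷ q ∷ r ∷ _) _ ((p≢q ∷ p≢r ∷ _) ∷ (q≢r ∷ _) ∷ _) =
        Vanishing.three-zero k Y (δ Y) far cross around C p≢q p≢r q≢r

  value-onePoint : (i : Embedding Y X) (P : OnePoint i) → value i ≈ cellValue Y (cellOf i (OnePoint.point P))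
  value-onePoint i P = ≈-trans (value-extend i P) (x-y≈0⇒x≈y _ _ (δ-zero _ _))

-- Relations between the ten values

module Exchanged {k : CommutativeRing c ℓ} (ν : Measure k) where

  open CommutativeRing k renaming (Carrier to ∣k∣; refl to ≈-refl; sym to ≈-sym; trans to ≈-trans)
  open SetoidReasoning setoid
  open Measure ν
  open Deviation ν using (markedValue)
  open CellFormula ν using (value-onePoint)
  open LocalValue k (weights k markedValue)

  module _ (X : Permutation) (x y : Carrier X) (x≢y : x ≢ y) (y≢x : y ≢ x) where

    y′ : Carrier (X ∖ x)
    y′ = y , y≢x

    across : Embedding (X ∖ x ∖ y′) (X ∖ y)
    across = corestrict (inclusion X x ∘ᴱ inclusion (X ∖ x) y′) y
      λ u e → proj₂ u (injective (inclusion X x) e)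

    across-onePoint : OnePoint across
    across-onePoint = record
      { point = x , x≢y
      ; fresh = λ u e → proj₂ (proj₁ u) (cong proj₁ e)
      ; cover = λ u → cov u (_≟_ {X} (proj₁ u) x) }
      where
      cov : ∀ u → Dec (proj₁ u ≡ x) → u ≡ (x , x≢y) ⊎ ∃ λ z → to across z ≡ u
      cov u (yes e) = inj₁ (injective (inclusion X y) e)
      cov u (no ne) = inj₂ (((proj₁ u , ne) , λ e → proj₂ u (cong proj₁ e)) , refl)

    exchange : cellValue (X ∖ x) (cellOf (inclusion X x) x) *
                 cellValue (X ∖ x ∖ y′) (cellOf (inclusion (X ∖ x) y′) y′) ≈
               cellValue (X ∖ y) (cellOf (inclusion X y) y) *
                 cellValue (X ∖ x ∖ y′) (cellOf across (x , x≢y))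
    exchange = begin
      _ ≈⟨ *-cong (value-onePoint (inclusion X x) (inclusion-onePoint X x))
                  (value-onePoint (inclusion (X ∖ x) y′) (inclusion-onePoint (X ∖ x) y′)) ⟨
      value (inclusion X x) * value (inclusion (X ∖ x) y′)
        ≈⟨ value-∘ (inclusion X x) (inclusion (X ∖ x) y′) ⟨
      value (inclusion X x ∘ᴱ inclusion (X ∖ x) y′)
        ≈⟨ value-cong {i = inclusion X x ∘ᴱ inclusion (X ∖ x) y′} {inclusion X y ∘ᴱ across} (λ _ → refl) ⟩
      value (inclusion X y ∘ᴱ across)
        ≈⟨ value-∘ (inclusion X y) across ⟩
      value (inclusion X y) * value across
        ≈⟨ *-cong (value-onePoint (inclusion X y) (inclusion-onePoint X y)) (value-onePoint across across-onePoint) ⟩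
      _ ∎

entry : Fin 37 → Fin 10 → ℤ
entry r = lookup (lookup valueTable r)

-- The element 1 is a sum of elements w on each of which the values x act as some row of
-- the table.  They are found by splitting w into (1 + t) w and - t w, respectively
-- (1 - t) w and t w, whenever a value t satisfies t² w = - t w, respectively t² w = t w.

module Decomposition {k : CommutativeRing c ℓ} (x : Fin 10 → CommutativeRing.Carrier k) where

  open CommutativeRing k renaming (Carrier to ∣k∣; refl to ≈-refl; sym to ≈-sym; trans to ≈-trans)
  open SetoidReasoning setoid
  open Integers k
  open Symbolic k x using (z)
  open import Algebra.Properties.Ring ring using (-‿distribˡ-*)

  ActsAs : Fin 37 → ∣k∣ → Set ℓ
  ActsAs r w = ∀ i → x (column i) * w ≈ ι (entry r (column i)) * w

  -- All that is recorded of a summand is how the eight values act on it; several summands may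
  -- belong to the same row.
  data Decomposed (w : ∣k∣) : Set (c ⊔ ℓ) where
    row  : ∀ r → ActsAs r w → Decomposed w
    plus : ∀ {u v} → Decomposed u → Decomposed v → w ≈ u + v → Decomposed w

  -- The state of a branch of the case distinction: the integers by which some of the eight values
  -- are known to act.
  Knowledge : Set
  Knowledge = Vec (Maybe ℤ) 8

  record Known (ρ : Knowledge) (w : ∣k∣) : Set ℓ where
    constructor known
    field acts : ∀ i n → lookup ρ i ≡ just n → lookup z i * w ≈ ι n * w
  open Known

  substitute : Knowledge → Polynomial 8 → Polynomial 8
  substitute ρ (op o P Q) = op o (substitute ρ P) (substitute ρ Q)
  substitute ρ (con n)    = con n
  substitute ρ (var i)    = Maybe.maybe con (var i) (lookup ρ i)
  substitute ρ (P :^ n)   = P :^ n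
  substitute ρ (:- P)     = :- substitute ρ P

  private
    swap : ∀ a b w → a * (b * w) ≈ b * (a * w)
    swap a b w = ≈-trans (≈-sym (*-assoc a b w)) (≈-trans (*-congʳ (*-comm a b)) (*-assoc b a w))

  substitute-sound : ∀ {ρ w} → Known ρ w → ∀ P → ⟦ P ⟧ z * w ≈ ⟦ substitute ρ P ⟧ z * w
  substitute-sound {ρ} {w} K (op [+] P Q) = begin
    (⟦ P ⟧ z + ⟦ Q ⟧ z) * w          ≈⟨ distribʳ w _ _ ⟩
    ⟦ P ⟧ z * w + ⟦ Q ⟧ z * w        ≈⟨ +-cong (substitute-sound K P) (substitute-sound K Q) ⟩
    ⟦ substitute ρ P ⟧ z * w + ⟦ substitute ρ Q ⟧ z * w ≈⟨ distribʳ w _ _ ⟨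
    (⟦ substitute ρ P ⟧ z + ⟦ substitute ρ Q ⟧ z) * w ∎
  substitute-sound {ρ} {w} K (op [*] P Q) = begin
    (⟦ P ⟧ z * ⟦ Q ⟧ z) * w                ≈⟨ *-assoc _ _ _ ⟩
    ⟦ P ⟧ z * (⟦ Q ⟧ z * w)                ≈⟨ *-congˡ (substitute-sound K Q) ⟩
    ⟦ P ⟧ z * (⟦ substitute ρ Q ⟧ z * w)   ≈⟨ swap _ _ _ ⟩
    ⟦ substitute ρ Q ⟧ z * (⟦ P ⟧ z * w)   ≈⟨ *-congˡ (substitute-sound K P) ⟩
    ⟦ substitute ρ Q ⟧ z * (⟦ substitute ρ P ⟧ z * w) ≈⟨ swap _ _ _ ⟩
    ⟦ substitute ρ P ⟧ z * (⟦ substitute ρ Q ⟧ z * w) ≈⟨ *-assoc _ _ _ ⟨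
    (⟦ substitute ρ P ⟧ z * ⟦ substitute ρ Q ⟧ z) * w ∎
  substitute-sound K (con n) = ≈-refl
  substitute-sound {ρ} {w} K (var i) = go (lookup ρ i) (acts K i)
    where
    go : ∀ m → (∀ n → m ≡ just n → lookup z i * w ≈ ι n * w) →
         lookup z i * w ≈ ⟦ Maybe.maybe con (var i) m ⟧ z * w
    go nothing  f = ≈-refl
    go (just n) f = f n refl
  substitute-sound K (P :^ n) = ≈-refl
  substitute-sound {ρ} {w} K (:- P) = begin
    - ⟦ P ⟧ z * w                    ≈⟨ -‿distribˡ-* _ _ ⟨
    - (⟦ P ⟧ z * w)                  ≈⟨ -‿cong (substitute-sound K P) ⟩
    - (⟦ substitute ρ P ⟧ z * w)     ≈⟨ -‿distribˡ-* _ _ ⟩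
    - ⟦ substitute ρ P ⟧ z * w       ∎

  record Relation : Set ℓ where
    constructor _is-zero-by_
    field
      polynomial : Polynomial 8
      vanishes   : ⟦ polynomial ⟧ z ≈ 0#
  open Relation

  -- An equation between normal forms, so that each use is settled by computation with `≈-refl`.
  _becomes_under_ : Relation → Polynomial 8 → Knowledge → Set ℓ
  R becomes P under ρ = ⟦ substitute ρ (polynomial R) ⟧↓ z ≈ ⟦ P ⟧↓ z

  becomes-zero : ∀ {ρ w} R P → R becomes P under ρ → Known ρ w → ⟦ P ⟧ z * w ≈ 0#
  becomes-zero {ρ} {w} R P e K = begin
    ⟦ P ⟧ z * w                              ≈⟨ *-congʳ (prove z (substitute ρ (polynomial R)) P e) ⟨
    ⟦ substitute ρ (polynomial R) ⟧ z * w    ≈⟨ substitute-sound K (polynomial R) ⟨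
    ⟦ polynomial R ⟧ z * w                   ≈⟨ *-congʳ (vanishes R) ⟩
    0# * w                                   ≈⟨ zeroˡ w ⟩
    0#                                       ∎

  learn : ∀ {ρ w} → Known ρ w → ∀ i n → lookup z i * w ≈ ι n * w → Known (ρ Vec.[ i ]≔ just n) w
  learn {ρ} {w} K i n e = known λ j m f → go j m f (i Fin.≟ j)
    where
    go : ∀ j m → lookup (ρ Vec.[ i ]≔ just n) j ≡ just m → Dec (i ≡ j) → lookup z j * w ≈ ι m * w
    go j m f (yes refl) = subst (λ m → lookup z i * w ≈ ι m * w)
      (Maybe.just-injective (trans (sym (Vec.lookup∘update i ρ (just n))) f)) e
    go j m f (no ne) = acts K j m (trans (sym (Vec.lookup∘update′ (λ q → ne (sym q)) ρ (just n))) f)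

  known-multiple : ∀ {ρ w} → Known ρ w → ∀ e → Known ρ (e * w)
  known-multiple K e = known λ i n f → ≈-trans (swap _ _ _) (≈-trans (*-congˡ (acts K i n f)) (swap _ _ _))

  record Goal (ρ : Knowledge) : Set (c ⊔ ℓ) where
    constructor goal
    field decompose : ∀ w → Known ρ w → Decomposed w
  open Goal

  leaf : ∀ r → Goal (Vec.tabulate (λ i → just (entry r (column i))))
  leaf r = goal λ w K → row r λ i → ≈-trans
    (*-congʳ (reflexive (sym (Vec.lookup∘tabulate (λ i → x (column i)) i))))
    (acts K i _ (Vec.lookup∘tabulate (λ i → just (entry r (column i))) i))

  deduce : ∀ {ρ} R i n → R becomes (var i :- con n) under ρ → Goal (ρ Vec.[ i ]≔ just n) → Goal ρ
  deduce {ρ} R i n e G = goal λ w K → decompose G w (learn K i n (begin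
    lookup z i * w                                  ≈⟨ solve 3 (λ t u w → t :* w := (t :- u) :* w :+ u :* w) ≈-refl _ _ _ ⟩
    (lookup z i - ι n) * w + ι n * w                ≈⟨ +-congʳ (becomes-zero R (var i :- con n) e K) ⟩
    0# + ι n * w                                    ≈⟨ +-identityˡ _ ⟩
    ι n * w                                         ∎))

  split⁻ : ∀ {ρ} R i → R becomes (var i :+ var i :* var i) under ρ →
           Goal (ρ Vec.[ i ]≔ just -1ℤ) → Goal (ρ Vec.[ i ]≔ just 0ℤ) → Goal ρ
  split⁻ {ρ} R i e G H = goal λ w K →
    let t = lookup z i
        zero′ = becomes-zero R (var i :+ var i :* var i) e K in
    plus
      (decompose G (- t * w) (learn (known-multiple K (- t)) i -1ℤ (begin
        t * (- t * w)                      ≈⟨ solve 2 (λ t w → t :* (:- t :* w) :=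
                                                con -1ℤ :* (:- t :* w) :- (t :+ t :* t) :* w) ≈-refl t w ⟩
        - 1# * (- t * w) - (t + t * t) * w ≈⟨ +-congˡ (-‿cong zero′) ⟩
        - 1# * (- t * w) - 0#              ≈⟨ solve 1 (λ u → u :- con 0ℤ := u) ≈-refl _ ⟩
        - 1# * (- t * w)                   ∎)))
      (decompose H ((1# + t) * w) (learn (known-multiple K (1# + t)) i 0ℤ (begin
        t * ((1# + t) * w)                 ≈⟨ solve 2 (λ t w → t :* ((con 1ℤ :+ t) :* w) := (t :+ t :* t) :* w) ≈-refl t w ⟩
        (t + t * t) * w                    ≈⟨ zero′ ⟩
        0#                                 ≈⟨ zeroˡ _ ⟨
        0# * ((1# + t) * w)                ∎)))
      (solve 2 (λ t w → w := :- t :* w :+ (con 1ℤ :+ t) :* w) ≈-refl t w)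

  split⁺ : ∀ {ρ} R i → R becomes (var i :* var i :- var i) under ρ →
           Goal (ρ Vec.[ i ]≔ just 1ℤ) → Goal (ρ Vec.[ i ]≔ just 0ℤ) → Goal ρ
  split⁺ {ρ} R i e G H = goal λ w K →
    let t = lookup z i
        zero′ = becomes-zero R (var i :* var i :- var i) e K in
    plus
      (decompose G (t * w) (learn (known-multiple K t) i 1ℤ (begin
        t * (t * w)                        ≈⟨ solve 2 (λ t w → t :* (t :* w) :=
                                                con 1ℤ :* (t :* w) :+ (t :* t :- t) :* w) ≈-refl t w ⟩
        1# * (t * w) + (t * t - t) * w     ≈⟨ +-congˡ zero′ ⟩
        1# * (t * w) + 0#                  ≈⟨ +-identityʳ _ ⟩
        1# * (t * w)                       ∎)))
      (decompose H ((1# - t) * w) (learn (known-multiple K (1# - t)) i 0ℤ (begin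
        t * ((1# - t) * w)                 ≈⟨ solve 2 (λ t w → t :* ((con 1ℤ :- t) :* w) := :- ((t :* t :- t) :* w)) ≈-refl t w ⟩
        - ((t * t - t) * w)                ≈⟨ -‿cong zero′ ⟩
        - 0#                               ≈⟨ solve 1 (λ u → :- con 0ℤ := con 0ℤ :* u) ≈-refl _ ⟩
        0# * ((1# - t) * w)                ∎)))
      (solve 2 (λ t w → w := t :* w :+ (con 1ℤ :- t) :* w) ≈-refl t w)

  infixl 6 _minus_
  _minus_ : Relation → Relation → Relation
  R minus S = (polynomial R :- polynomial S) is-zero-by
    ≈-trans (+-cong (vanishes R) (-‿cong (vanishes S))) (solve 0 (con 0ℤ :- con 0ℤ := con 0ℤ) ≈-refl)

  -- Substituting `-1` can leave a relation such as `- G`; its negative has the shape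
  -- `var i :- con n` that `deduce` expects.
  negated : Relation → Relation
  negated R = (:- polynomial R) is-zero-by ≈-trans (-‿cong (vanishes R)) (solve 0 (:- con 0ℤ := con 0ℤ) ≈-refl)

  simplified : ∀ P R → ⟦ polynomial R ⟧↓ z ≈ ⟦ P ⟧↓ z → Relation
  simplified P R e = P is-zero-by ≈-trans (≈-sym (prove z (polynomial R) P e)) (vanishes R)

module RowDecomposition {k : CommutativeRing c ℓ} (ν : Measure k) where

  open CommutativeRing k renaming (Carrier to ∣k∣; refl to ≈-refl; sym to ≈-sym; trans to ≈-trans)
  open Integers k
  open Deviation ν using (markedValue)
  open Decomposition {k = k} markedValue
  open Symbolic k markedValue
  open SetoidReasoning setoid
  open LocalValue k (weights k markedValue)
  open Exchanged ν
  open import Algebra.Properties.Group +-group using () renaming (x≈y⇒x∙y⁻¹≈ε to x≈y⇒x-y≈0)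

  commuting : ∀ X u v → u ≢ v → v ≢ u → Relation
  commuting X u v u≢v v≢u = (cellᴾ (X ∖ u) C :* cellᴾ (X ∖ u ∖ v′) D :- cellᴾ (X ∖ v) C₂ :* cellᴾ (X ∖ u ∖ v′) D₂)
    is-zero-by x≈y⇒x-y≈0 (begin
      ⟦ cellᴾ (X ∖ u) C ⟧ z * ⟦ cellᴾ (X ∖ u ∖ v′) D ⟧ z    ≈⟨ *-cong (cellᴾ-sound _ C) (cellᴾ-sound _ D) ⟩
      cellValue (X ∖ u) C * cellValue (X ∖ u ∖ v′) D        ≈⟨ exchange X u v u≢v v≢u ⟩
      cellValue (X ∖ v) C₂ * cellValue (X ∖ u ∖ v′) D₂      ≈⟨ *-cong (cellᴾ-sound _ C₂) (cellᴾ-sound _ D₂) ⟨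
      ⟦ cellᴾ (X ∖ v) C₂ ⟧ z * ⟦ cellᴾ (X ∖ u ∖ v′) D₂ ⟧ z  ∎)
    where
    v′ = v , v≢u
    C  = cellOf (inclusion X u) u
    D  = cellOf (inclusion (X ∖ u) v′) v′
    C₂ = cellOf (inclusion X v) v
    D₂ = cellOf (across X u v u≢v v≢u) (u , u≢v)

  private
    -- `P`, `Q`, `R`, `S` are the lower left, upper right, lower right and upper left quadrants of a
    -- point. `A` and `B` belong to 132 with 2 and with 3 marked, `G` and `H` to 231 with 2 and with
    -- 3 marked.
    P Q R S A B G H : Polynomial 8
    P = var 0F
    Q = var 1F
    R = var 2F
    S = var 3F
    A = var 4F
    B = var 5F
    G = var 6F
    H = var 7F

    -- For `A = B = 0` the relation `p²` says that `P² = - P`, and for `A = B = -1` that `P² = P`.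
    -- Likewise for `Q`, and for `R` and `S` with `G` and `H`. The second case is the source of the
    -- entries 1 in the columns of `P`, `Q`, `R` and `S`.
    p² q² ps pr qab pab qs qr sgh rgh s² r² bg ag bh ah b² a² g² h² : Relation
    p² = simplified (P :+ P :* P :+ P :* A :+ P :* B) (commuting (word (1 ∷ 2 ∷ 3 ∷ [])) 0F 1F (λ ()) (λ ())) ≈-refl
    q² = simplified (Q :+ Q :* Q :+ Q :* A :+ Q :* B) (commuting (word (1 ∷ 2 ∷ 3 ∷ [])) 2F 1F (λ ()) (λ ())) ≈-refl
    ps = simplified (P :* S :- (P :* B :+ S :* G)) (commuting (word (1 ∷ 3 ∷ 2 ∷ [])) 0F 1F (λ ()) (λ ())) ≈-refl
    pr = simplified (P :* R :- (P :* A :+ R :* G)) (commuting (word (1 ∷ 3 ∷ 2 ∷ [])) 0F 2F (λ ()) (λ ())) ≈-refl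
    qab = simplified (Q :* A :- Q :* B) (commuting (word (1 ∷ 3 ∷ 2 ∷ [])) 2F 1F (λ ()) (λ ())) ≈-refl
    pab = simplified (P :* A :- P :* B) (commuting (word (2 ∷ 1 ∷ 3 ∷ [])) 1F 0F (λ ()) (λ ())) ≈-refl
    qs = simplified (Q :* S :- (Q :* B :+ S :* H)) (commuting (word (2 ∷ 1 ∷ 3 ∷ [])) 2F 0F (λ ()) (λ ())) ≈-refl
    qr = simplified (Q :* R :- (Q :* A :+ R :* H)) (commuting (word (2 ∷ 1 ∷ 3 ∷ [])) 2F 1F (λ ()) (λ ())) ≈-refl
    sgh = simplified (S :* G :- S :* H) (commuting (word (2 ∷ 3 ∷ 1 ∷ [])) 0F 1F (λ ()) (λ ())) ≈-refl
    rgh = simplified (R :* G :- R :* H) (commuting (word (3 ∷ 1 ∷ 2 ∷ [])) 1F 2F (λ ()) (λ ())) ≈-refl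
    s² = simplified (S :+ S :* S :+ S :* G :+ S :* H) (commuting (word (3 ∷ 2 ∷ 1 ∷ [])) 0F 1F (λ ()) (λ ())) ≈-refl
    r² = simplified (R :+ R :* R :+ R :* G :+ R :* H) (commuting (word (3 ∷ 2 ∷ 1 ∷ [])) 2F 1F (λ ()) (λ ())) ≈-refl
    bg = simplified (B :* G) (commuting (word (1 ∷ 2 ∷ 4 ∷ 3 ∷ [])) 2F 1F (λ ()) (λ ())) ≈-refl
    ag = simplified (A :* G) (commuting (word (1 ∷ 2 ∷ 4 ∷ 3 ∷ [])) 3F 1F (λ ()) (λ ())) ≈-refl
    bh = simplified (B :* H) (commuting (word (1 ∷ 3 ∷ 2 ∷ 4 ∷ [])) 1F 3F (λ ()) (λ ())) ≈-refl
    ah = simplified (A :* H) (commuting (word (1 ∷ 3 ∷ 2 ∷ 4 ∷ [])) 2F 3F (λ ()) (λ ())) ≈-refl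
    -- This exchange and the next three each give a square together with two mixed products, which
    -- vanish by the four relations before.
    b² = simplified (B :+ B :* B) (commuting (word (1 ∷ 4 ∷ 3 ∷ 2 ∷ [])) 1F 2F (λ ()) (λ ()) minus bg minus bh) ≈-refl
    a² = simplified (A :+ A :* A) (commuting (word (1 ∷ 4 ∷ 3 ∷ 2 ∷ [])) 3F 2F (λ ()) (λ ()) minus ag minus ah) ≈-refl
    g² = simplified (G :+ G :* G) (commuting (word (2 ∷ 3 ∷ 4 ∷ 1 ∷ [])) 0F 1F (λ ()) (λ ()) minus ag minus bg) ≈-refl
    h² = simplified (H :+ H :* H) (commuting (word (2 ∷ 3 ∷ 4 ∷ 1 ∷ [])) 2F 1F (λ ()) (λ ()) minus ah minus bh) ≈-refl

    four : ∀ {ρ} i j (U V : Relation) → U becomes (var i :+ var i :* var i) under ρ →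
      V becomes (var j :+ var j :* var j) under (ρ Vec.[ i ]≔ just -1ℤ) →
      V becomes (var j :+ var j :* var j) under (ρ Vec.[ i ]≔ just 0ℤ) →
      Goal ((ρ Vec.[ i ]≔ just -1ℤ) Vec.[ j ]≔ just -1ℤ) → Goal ((ρ Vec.[ i ]≔ just -1ℤ) Vec.[ j ]≔ just 0ℤ) →
      Goal ((ρ Vec.[ i ]≔ just 0ℤ) Vec.[ j ]≔ just -1ℤ) → Goal ((ρ Vec.[ i ]≔ just 0ℤ) Vec.[ j ]≔ just 0ℤ) → Goal ρ
    four i j U V e f g K L M N = split⁻ U i e (split⁻ V j f K L) (split⁻ V j g M N)

  -- The rows are numbered from 0.

  decomposition : Goal (Vec.replicate 8 nothing)
  decomposition = split⁻ a² 4F ≈-refl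
    (deduce (negated ag) 6F 0ℤ ≈-refl (deduce (negated ah) 7F 0ℤ ≈-refl
      (split⁻ b² 5F ≈-refl
        (split⁺ p² 0F ≈-refl
          (deduce ps 3F -1ℤ ≈-refl (deduce pr 2F -1ℤ ≈-refl (split⁺ q² 1F ≈-refl (leaf (# 35)) (leaf (# 16)))))
          (split⁺ q² 1F ≈-refl
            (deduce qs 3F -1ℤ ≈-refl (deduce qr 2F -1ℤ ≈-refl (leaf (# 17))))
            (four 2F 3F r² s² ≈-refl ≈-refl ≈-refl (leaf (# 34)) (leaf (# 12)) (leaf (# 13)) (leaf (# 25)))))
        (deduce (negated pab) 0F 0ℤ ≈-refl (deduce (negated qab) 1F 0ℤ ≈-refl
          (four 2F 3F r² s² ≈-refl ≈-refl ≈-refl (leaf (# 31)) (leaf (# 0)) (leaf (# 1)) (leaf (# 20))))))))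
    (split⁻ b² 5F ≈-refl
      (deduce (negated bg) 6F 0ℤ ≈-refl (deduce (negated bh) 7F 0ℤ ≈-refl
        (deduce pab 0F 0ℤ ≈-refl (deduce qab 1F 0ℤ ≈-refl
          (four 2F 3F r² s² ≈-refl ≈-refl ≈-refl (leaf (# 32)) (leaf (# 2)) (leaf (# 3)) (leaf (# 21)))))))
      (split⁻ g² 6F ≈-refl
        (split⁻ h² 7F ≈-refl
          (split⁺ r² 2F ≈-refl
            (deduce pr 0F -1ℤ ≈-refl (deduce qr 1F -1ℤ ≈-refl (split⁺ s² 3F ≈-refl (leaf (# 36)) (leaf (# 18)))))
            (split⁺ s² 3F ≈-refl
              (deduce ps 0F -1ℤ ≈-refl (deduce qs 1F -1ℤ ≈-refl (leaf (# 19))))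
              (four 0F 1F p² q² ≈-refl ≈-refl ≈-refl (leaf (# 30)) (leaf (# 14)) (leaf (# 15)) (leaf (# 26)))))
          (deduce (negated sgh) 3F 0ℤ ≈-refl (deduce (negated rgh) 2F 0ℤ ≈-refl
            (four 0F 1F p² q² ≈-refl ≈-refl ≈-refl (leaf (# 27)) (leaf (# 4)) (leaf (# 5)) (leaf (# 22))))))
        (split⁻ h² 7F ≈-refl
          (deduce sgh 3F 0ℤ ≈-refl (deduce rgh 2F 0ℤ ≈-refl
            (four 0F 1F p² q² ≈-refl ≈-refl ≈-refl (leaf (# 28)) (leaf (# 6)) (leaf (# 7)) (leaf (# 23)))))
          (split⁻ p² 0F ≈-refl
            (deduce (negated ps) 3F 0ℤ ≈-refl (deduce (negated pr) 2F 0ℤ ≈-refl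
              (split⁻ q² 1F ≈-refl (leaf (# 29)) (leaf (# 8)))))
            (split⁻ q² 1F ≈-refl
              (deduce (negated qs) 3F 0ℤ ≈-refl (deduce (negated qr) 2F 0ℤ ≈-refl (leaf (# 9))))
              (four 2F 3F r² s² ≈-refl ≈-refl ≈-refl (leaf (# 33)) (leaf (# 10)) (leaf (# 11)) (leaf (# 24))))))))

  decomposed : Decomposed 1#
  decomposed = Goal.decompose decomposition 1# (known λ i n e → case trans (sym (Vec.lookup-replicate i nothing)) e of λ ())

-- The thirty-seven measures

-- Evaluating through the arguments of tabulated lets a value be computed only once.

memoize : {A : Set} → (Position → A) → Position → A
memoize {A} f = tabulated (f none) (f first) (f second) (f same)
  (f (apart true true)) (f (apart true false)) (f (apart false true)) (f (apart false false))
  where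
  tabulated : (a b c d e g h i : A) → Position → A
  tabulated a b c d e g h i none                = a
  tabulated a b c d e g h i first               = b
  tabulated a b c d e g h i second              = c
  tabulated a b c d e g h i same                = d
  tabulated a b c d e g h i (apart true true)   = e
  tabulated a b c d e g h i (apart true false)  = g
  tabulated a b c d e g h i (apart false true)  = h
  tabulated a b c d e g h i (apart false false) = i

rowQuadrant : Fin 37 → Position → ℤ
rowQuadrant r = memoize (quadrant ℤ-ring (lookup (lookup valueTable r)))

rowWeight : Fin 37 → Weight ℤ
rowWeight r = weight {k = ℤ-ring} (rowQuadrant r)

-- Unfolding the measures during conversion checking would repeat these computations.

abstract

  rows-lawful : ∀ r → Checks.Lawful (rowWeight r)
  rows-lawful = from-yes (Fin.all? λ r → Checks.lawful? (rowWeight r))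

abstract

  rowMeasure : Fin 37 → Measure ℤ-ring
  rowMeasure r = Balance.measure M base
    where
    φ : Weight ℤ
    φ = rowWeight r

    open Product ℤ-ring φ
    open LocalValue ℤ-ring φ

    M : Multiplicative ℤ-ring
    M = product (ExchangeLaw.exchange φ (rows-lawful r))

    base : ∀ {Y X Y′} (i : Embedding Y X) (j : Embedding Y Y′) → OnePoint i → OnePoint j → Balance.Balanced M i j
    base {Y} {X} {Y′} i j P Q = onePoint-enumeration , trans (value-onePoint i P)
      (Additivity.additivity ℤ-ring (rowQuadrant r) i j P Q
        (λ A → value (Amalgamation.i′ A))
        (λ o₁ o₂ → trans (value-onePoint (extension Y′ (cell (choice o₁ o₂))) (extension-onePoint Y′ (cell (choice o₁ o₂))))
          (cellValue-cong ℤ-ring φ Y′ {cellOf (extension Y′ (cell (choice o₁ o₂))) nothing} {cell (choice o₁ o₂)}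
            (cellOf-extension Y′ (cell (choice o₁ o₂)))))
        (λ A → Multiplicative.value-iso M (idᴱ {X = Y′}) (idᴱ , (λ _ → refl) , λ _ → refl)))
      where open OnePointAmalgamations i j P Q

  rowMeasure-cell : ∀ r (i : Embedding Y X) (P : OnePoint i) → Measure.value (rowMeasure r) i ≡
    LocalValue.cellValue ℤ-ring (rowWeight r) Y (cellOf i (OnePoint.point P))
  rowMeasure-cell r i P = Product.value-onePoint ℤ-ring (rowWeight r) i P

  -- All ten columns are compared, including the two entries of a row that do not enter `quadrant`.
  rowMeasure-values : ∀ r → HasValues (rowMeasure r) (lookup valueTable r)
  rowMeasure-values r m =
    trans (rowMeasure-cell r (marked-inclusion m) (marked-onePoint m)) (table r m)
    where
    v : Fin 37 → Fin 10 → ℤ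
    v r m = LocalValue.cellValue ℤ-ring (rowWeight r) (unmarked m)
      (cellOf (marked-inclusion m) (OnePoint.point (marked-onePoint m)))

    table : ∀ r m → v r m ≡ lookup (lookup valueTable r) m
    table = from-yes (Fin.all? λ r → Fin.all? λ m → v r m ℤ.≟ lookup (lookup valueTable r) m)

-- The ring Θ(𝔓)

module Comparison {k : CommutativeRing c ℓ} (ν : Measure k) where

  open CommutativeRing k renaming (Carrier to ∣k∣; refl to ≈-refl; sym to ≈-sym; trans to ≈-trans)
  open SetoidReasoning setoid
  open Integers k
  open Deviation ν using (markedValue)
  open CellFormula ν using (value-onePoint)
  open Decomposition {k = k} markedValue using (ActsAs)
  open Measure ν
  open import Algebra.Properties.Ring ring using (-‿distribˡ-*)

  module _ (r : Fin 37) {w : ∣k∣} (acts : ActsAs r w) where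

    infix 4 _∼_
    -- A record keeps `t` and `n` inferable, which unification could not recover from `ι n * w`.
    record _∼_ (t : ∣k∣) (n : ℤ) : Set ℓ where
      constructor acting
      field action : t * w ≈ ι n * w
    open _∼_ public

    ∼-+ : ∀ {t u m n} → t ∼ m → u ∼ n → t + u ∼ m ℤ.+ n
    ∼-+ {t} {u} {m} {n} (acting e) (acting f) = acting (begin
      (t + u) * w              ≈⟨ distribʳ w t u ⟩
      t * w + u * w            ≈⟨ +-cong e f ⟩
      ι m * w + ι n * w        ≈⟨ distribʳ w (ι m) (ι n) ⟨
      (ι m + ι n) * w          ≈⟨ *-congʳ (ι-+ m n) ⟨
      ι (m ℤ.+ n) * w          ∎)

    ∼-neg : ∀ {t m} → t ∼ m → - t ∼ ℤ.- m
    ∼-neg {t} {m} (acting e) = acting (begin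
      - t * w          ≈⟨ -‿distribˡ-* t w ⟨
      - (t * w)        ≈⟨ -‿cong e ⟩
      - (ι m * w)      ≈⟨ -‿distribˡ-* (ι m) w ⟩
      - ι m * w        ≈⟨ *-congʳ (ι-neg m) ⟨
      ι (ℤ.- m) * w    ∎)

    ∼-* : ∀ {t u m n} → t ∼ m → u ∼ n → t * u ∼ m ℤ.* n
    ∼-* {t} {u} {m} {n} (acting e) (acting f) = acting (begin
      (t * u) * w          ≈⟨ *-assoc t u w ⟩
      t * (u * w)          ≈⟨ *-congˡ f ⟩
      t * (ι n * w)        ≈⟨ solve 3 (λ t n w → t :* (n :* w) := n :* (t :* w)) ≈-refl t (ι n) w ⟩
      ι n * (t * w)        ≈⟨ *-congˡ e ⟩
      ι n * (ι m * w)      ≈⟨ solve 3 (λ m n w → n :* (m :* w) := m :* n :* w) ≈-refl (ι m) (ι n) w ⟩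
      ι m * ι n * w        ≈⟨ *-congʳ (ι-* m n) ⟨
      ι (m ℤ.* n) * w      ∎)

    ∼-0 : 0# ∼ 0ℤ
    ∼-0 = acting ≈-refl

    ∼-1 : 1# ∼ 1ℤ
    ∼-1 = acting ≈-refl

    ∼-cong : ∀ {t u m n} → t ≈ u → m ≡ n → u ∼ n → t ∼ m
    ∼-cong e refl (acting f) = acting (≈-trans (*-congʳ e) f)

    private
      x∼ : ∀ i → markedValue (suc (Fin.inject₁ i)) ∼ entry r (suc (Fin.inject₁ i))
      x∼ i = acting (acts i)

    quadrant-∼ : ∀ π → quadrant k markedValue π ∼ rowQuadrant r π
    quadrant-∼ none                = ∼-+ ∼-1 (∼-+ (∼-+ (x∼ 0F) (x∼ 1F)) (∼-+ (x∼ 2F) (x∼ 3F)))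
    quadrant-∼ first               = ∼-+ (x∼ 1F) (x∼ 2F)
    quadrant-∼ second              = ∼-+ (x∼ 1F) (x∼ 3F)
    quadrant-∼ same                = x∼ 1F
    quadrant-∼ (apart true true)   = ∼-+ (x∼ 1F) (x∼ 4F)
    quadrant-∼ (apart true false)  = ∼-+ (x∼ 1F) (∼-neg (x∼ 7F))
    quadrant-∼ (apart false true)  = ∼-+ (x∼ 1F) (∼-neg (∼-+ ∼-1 (x∼ 6F)))
    quadrant-∼ (apart false false) = ∼-+ (x∼ 1F) (x∼ 5F)

    weight-∼ : ∀ h v π → weights k markedValue h v π ∼ rowWeight r h v π
    weight-∼ true  true  π           = quadrant-∼ π
    weight-∼ false true  none        = ∼-0
    weight-∼ false true  second      = ∼-0
    weight-∼ false true  first       = ∼-neg (quadrant-∼ first)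
    weight-∼ false true  same        = ∼-neg (quadrant-∼ same)
    weight-∼ false true  (apart u s) = ∼-neg (quadrant-∼ (apart u s))
    weight-∼ true  false none        = ∼-0
    weight-∼ true  false first       = ∼-0
    weight-∼ true  false second      = ∼-neg (quadrant-∼ second)
    weight-∼ true  false same        = ∼-neg (quadrant-∼ same)
    weight-∼ true  false (apart u s) = ∼-neg (quadrant-∼ (apart u s))
    weight-∼ false false none        = ∼-0
    weight-∼ false false first       = ∼-0
    weight-∼ false false second      = ∼-0
    weight-∼ false false same        = ∼-+ (quadrant-∼ same) (∼-neg ∼-1)
    weight-∼ false false (apart u s) = quadrant-∼ (apart u s)

    cellValue-∼ : ∀ Y C → LocalValue.cellValue k (weights k markedValue) Y C ∼
                          LocalValue.cellValue ℤ-ring (rowWeight r) Y C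
    cellValue-∼ Y C = ∼-+ (∼-+ (corner true true) (corner false true)) (∼-+ (corner true false) (corner false false))
      where
      n : Axis → Bool → Maybe (Carrier Y)
      n = neighbour Y (elements Y) (Cell.below C)

      corner : ∀ h v → weights k markedValue h v (position Y (n place h) (n height v)) ∼
                       rowWeight r h v (position Y (n place h) (n height v))
      corner h v = weight-∼ h v (position Y (n place h) (n height v))

    -- Both values are multiplicative and equal cell values on one-point steps, so the action
    -- spreads from the eight parameters to all embeddings. Over the integers with `w` equal to 1
    -- this is the uniqueness of the measure of a row; over `Θ` it is the core of injectivity.
    value-∼ : (i : Embedding Y X) → value i ∼ Measure.value (rowMeasure r) i
    value-∼ = embedding-induction (λ i → value i ∼ Measure.value (rowMeasure r) i)
      (λ {_} {_} {i} {j} p → ∼-cong (value-cong {i = j} {i} (λ y → sym (p y)))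
                                    (Measure.value-cong (rowMeasure r) {i = j} {i} (λ y → sym (p y))))
      (λ i s → ∼-cong (value-iso i s) (Measure.value-iso (rowMeasure r) i s) ∼-1)
      (λ {_} {X} x i q → ∼-cong (value-∘ (inclusion X x) i) (Measure.value-∘ (rowMeasure r) (inclusion X x) i)
        (∼-* (∼-cong (value-onePoint (inclusion X x) (inclusion-onePoint X x))
                     (rowMeasure-cell r (inclusion X x) (inclusion-onePoint X x))
                     (cellValue-∼ (X ∖ x) (cellOf (inclusion X x) x))) q))

module _ {k : CommutativeRing c ℓ} where

  open CommutativeRing k renaming (Carrier to ∣k∣; refl to ≈-refl; sym to ≈-sym; trans to ≈-trans)
  open SetoidReasoning setoid
  open Integers k
  open import Algebra.Properties.Group +-group using (inverseˡ-unique)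

  ι-unique : (f : ℤ → ∣k∣) → (∀ m n → f (m ℤ.+ n) ≈ f m + f n) → f 0ℤ ≈ 0# → f 1ℤ ≈ 1# → ∀ n → f n ≈ ι n
  ι-unique f f-+ f-0 f-1 (ℤ.+ n) = natural n
    where
    natural : ∀ n → f (ℤ.+ n) ≈ ι (ℤ.+ n)
    natural zero    = f-0
    natural (suc n) = begin
      f (1ℤ ℤ.+ ℤ.+ n)     ≈⟨ f-+ 1ℤ (ℤ.+ n) ⟩
      f 1ℤ + f (ℤ.+ n)     ≈⟨ +-cong f-1 (natural n) ⟩
      ι 1ℤ + ι (ℤ.+ n)     ≈⟨ ι-+ 1ℤ (ℤ.+ n) ⟨
      ι (1ℤ ℤ.+ ℤ.+ n)     ∎
  ι-unique f f-+ f-0 f-1 ℤ.-[1+ n ] = begin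
    f ℤ.-[1+ n ]          ≈⟨ inverseˡ-unique _ _ (begin
      f ℤ.-[1+ n ] + f (ℤ.+ suc n)  ≈⟨ f-+ ℤ.-[1+ n ] (ℤ.+ suc n) ⟨
      f (ℤ.-[1+ n ] ℤ.+ ℤ.+ suc n)  ≡⟨ cong f (ℤ.+-inverseˡ (ℤ.+ suc n)) ⟩
      f 0ℤ                          ≈⟨ f-0 ⟩
      0#                            ∎) ⟩
    - f (ℤ.+ suc n)       ≈⟨ -‿cong (ι-unique f f-+ f-0 f-1 (ℤ.+ suc n)) ⟩
    ι ℤ.-[1+ n ]          ∎

rowMeasure-unique : ∀ r (ν : Measure ℤ-ring) → HasValues ν (lookup valueTable r) →
                    (i : Embedding Y X) → Measure.value ν i ≡ Measure.value (rowMeasure r) i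
rowMeasure-unique r ν h i = begin
  Measure.value ν i                       ≡⟨ ℤ.*-identityʳ _ ⟨
  Measure.value ν i ℤ.* 1ℤ                ≡⟨ Comparison.action (Comparison.value-∼ ν r
                                               (λ m → cong (ℤ._* 1ℤ) (trans (h _) (ι-id _))) i) ⟩
  ι (Measure.value (rowMeasure r) i) ℤ.* 1ℤ ≡⟨ ℤ.*-identityʳ _ ⟩
  ι (Measure.value (rowMeasure r) i)      ≡⟨ ι-id _ ⟨
  Measure.value (rowMeasure r) i          ∎
  where
  open ≡-Reasoning
  open Integers ℤ-ring using (ι)

  ι-id : ∀ n → n ≡ ι n
  ι-id = ι-unique {k = ℤ-ring} (λ n → n) (λ _ _ → refl) refl refl

open Polynomials symbols
open Quotient ℤ[symbols] Relator using (Ideal; _≈ᴵ_; generator; zeroᴵ; addᴵ; scaleᴵ; respᴵ)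

universalMeasure : Measure Θ
universalMeasure = record
  { value      = [_]
  ; value-cong = λ {_} {_} {i} {j} p → respᴵ (symᴾ (transᴾ
      (⊕-cong (var-cong (symbol-cong {i = i} {j} p)) reflᴾ)
      (proj₂ (CommutativeRing.-‿inverse ℤ[symbols]) [ j ]))) zeroᴵ
  ; value-iso  = λ i s → generator (iso i s)
  ; value-∘    = λ j i → generator (composition j i)
  ; value-sum  = λ i j As → generator (amalgamation i j As)
  }

module _ (r : Fin 37) where

  open Measure (rowMeasure r)
  private
    module Σᴾ = RawMonoidDefinitions (CommutativeRing.+-rawMonoid ℤ[symbols])
    module Σᶻ = RawMonoidDefinitions (CommutativeRing.+-rawMonoid ℤ-ring)

  evaluate : Poly → ℤ
  evaluate (con n)          = n
  evaluate (var (symbol i)) = value i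
  evaluate (P ⊕ Q)          = evaluate P ℤ.+ evaluate Q
  evaluate (P ⊗ Q)          = evaluate P ℤ.* evaluate Q
  evaluate (⊝ P)            = ℤ.- evaluate P

  evaluate-cong : ∀ {P Q} → P ≈ᴾ Q → evaluate P ≡ evaluate Q
  evaluate-cong reflᴾ                        = refl
  evaluate-cong (symᴾ e)                     = sym (evaluate-cong e)
  evaluate-cong (transᴾ e f)                 = trans (evaluate-cong e) (evaluate-cong f)
  evaluate-cong (var-cong (symbol-cong {i = i} {j} p)) = value-cong {i = i} {j} p
  evaluate-cong (⊕-cong e f)                 = cong₂ ℤ._+_ (evaluate-cong e) (evaluate-cong f)
  evaluate-cong (⊗-cong e f)                 = cong₂ ℤ._*_ (evaluate-cong e) (evaluate-cong f)
  evaluate-cong (⊝-cong e)                   = cong ℤ.-_ (evaluate-cong e)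
  evaluate-cong (con-+ m n)                  = refl
  evaluate-cong (con-* m n)                  = refl
  evaluate-cong (⊕-assoc P Q R)              = ℤ.+-assoc (evaluate P) (evaluate Q) (evaluate R)
  evaluate-cong (⊕-comm P Q)                 = ℤ.+-comm (evaluate P) (evaluate Q)
  evaluate-cong (⊕-identityˡ P)              = ℤ.+-identityˡ (evaluate P)
  evaluate-cong (⊝-inverseˡ P)               = ℤ.+-inverseˡ (evaluate P)
  evaluate-cong (⊗-assoc P Q R)              = ℤ.*-assoc (evaluate P) (evaluate Q) (evaluate R)
  evaluate-cong (⊗-comm P Q)                 = ℤ.*-comm (evaluate P) (evaluate Q)
  evaluate-cong (⊗-identityˡ P)              = ℤ.*-identityˡ (evaluate P)
  evaluate-cong (⊗-distribˡ P Q R)           = ℤ.*-distribˡ-+ (evaluate P) (evaluate Q) (evaluate R)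

  evaluate-sum : ∀ {n} (f : Fin n → Poly) → evaluate (Σᴾ.sum f) ≡ Σᶻ.sum (λ α → evaluate (f α))
  evaluate-sum {zero}  f = refl
  evaluate-sum {suc n} f = cong (λ t → evaluate (f zero) ℤ.+ t) (evaluate-sum (λ α → f (suc α)))

  private
    cancel : ∀ {m n} → m ≡ n → m ℤ.- n ≡ 0ℤ
    cancel {m} refl = ℤ.+-inverseʳ m

  evaluate-ideal : ∀ {P} → Ideal P → evaluate P ≡ 0ℤ
  evaluate-ideal (generator (iso i s))           = cancel (value-iso i s)
  evaluate-ideal (generator (composition j i))   = cancel (value-∘ j i)
  evaluate-ideal (generator (amalgamation i j As)) = cancel (trans (value-sum i j As)
    (sym (evaluate-sum λ α → [ Amalgamation.i′ (AllAmalgamations.member As α) ])))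
  evaluate-ideal zeroᴵ         = refl
  evaluate-ideal (addᴵ e f)    = cong₂ ℤ._+_ (evaluate-ideal e) (evaluate-ideal f)
  evaluate-ideal (scaleᴵ R e)  = trans (cong (evaluate R ℤ.*_) (evaluate-ideal e)) (ℤ.*-zeroʳ (evaluate R))
  evaluate-ideal (respᴵ e f)   = trans (sym (evaluate-cong e)) (evaluate-ideal f)

  evaluate-≈ᴵ : ∀ {P Q} → P ≈ᴵ Q → evaluate P ≡ evaluate Q
  evaluate-≈ᴵ e = ℤ.i-j≡0⇒i≡j _ _ (evaluate-ideal e)

evaluation : Poly → Fin 37 → ℤ
evaluation P r = evaluate r P

module _ where

  open CommutativeRing Θ renaming (Carrier to ∣Θ∣; refl to ≈-refl; sym to ≈-sym; trans to ≈-trans)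
  open SetoidReasoning setoid
  open Integers Θ using (ι)
  open Deviation universalMeasure using (markedValue)
  open Decomposition {k = Θ} markedValue
  open RowDecomposition universalMeasure using (decomposed)
  open Comparison universalMeasure

  private
    ≈ᴾ⇒≈ : ∀ {P Q} → P ≈ᴾ Q → P ≈ Q
    ≈ᴾ⇒≈ {P} {Q} e = respᴵ (symᴾ (transᴾ (⊕-cong e reflᴾ)
      (proj₂ (CommutativeRing.-‿inverse ℤ[symbols]) Q))) zeroᴵ

    con≈ι : ∀ n → con n ≈ ι n
    con≈ι = ι-unique {k = Θ} con (λ m n → ≈ᴾ⇒≈ (con-+ m n)) ≈-refl ≈-refl

    evaluate-ι : ∀ s n → evaluate s (ι n) ≡ n
    evaluate-ι s n = sym (evaluate-≈ᴵ s (con≈ι n))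

  acts-by-evaluation : ∀ r {w} (acts : ActsAs r w) → ∀ P → _∼_ r acts P (evaluate r P)
  acts-by-evaluation r acts (con n)          = acting (*-congʳ (con≈ι n))
  acts-by-evaluation r acts (var (symbol i)) = value-∼ r acts i
  acts-by-evaluation r acts (P ⊕ Q) = ∼-+ r acts (acts-by-evaluation r acts P) (acts-by-evaluation r acts Q)
  acts-by-evaluation r acts (P ⊗ Q) = ∼-* r acts (acts-by-evaluation r acts P) (acts-by-evaluation r acts Q)
  acts-by-evaluation r acts (⊝ P)   = ∼-neg r acts (acts-by-evaluation r acts P)

  -- On a summand of `1#` which belongs to the row `r`, an element acts as the integer to which `r`
  -- evaluates it.
  evaluation-injective : ∀ {P Q} → (∀ r → evaluation P r ≡ evaluation Q r) → P ≈ Q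
  evaluation-injective {P} {Q} e = begin
    P        ≈⟨ *-identityʳ P ⟨
    P * 1#   ≈⟨ go decomposed ⟩
    Q * 1#   ≈⟨ *-identityʳ Q ⟩
    Q        ∎
    where
    go : ∀ {w} → Decomposed w → P * w ≈ Q * w
    go {w} (row r acts) = begin
      P * w                     ≈⟨ action (acts-by-evaluation r acts P) ⟩
      ι (evaluate r P) * w      ≡⟨ cong (λ n → ι n * w) (e r) ⟩
      ι (evaluate r Q) * w      ≈⟨ action (acts-by-evaluation r acts Q) ⟨
      Q * w                     ∎
    go {w} (plus {u} {v} p q f) = begin
      P * w              ≈⟨ *-congˡ f ⟩
      P * (u + v)        ≈⟨ distribˡ P u v ⟩
      P * u + P * v      ≈⟨ +-cong (go p) (go q) ⟩
      Q * u + Q * v      ≈⟨ distribˡ Q u v ⟨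
      Q * (u + v)        ≈⟨ *-congˡ f ⟨
      Q * w              ∎

  -- The difference must show in one of the eight middle columns, because `ActsAs` speaks of these.
  rows-differ : ∀ r s → r ≢ s → ∃ λ i → entry s (suc (Fin.inject₁ i)) ≢ entry r (suc (Fin.inject₁ {8} i))
  rows-differ = from-yes (Fin.all? λ r → Fin.all? λ s → ¬? (r Fin.≟ s) →-dec
    Fin.any? λ i → ¬? (entry s (suc (Fin.inject₁ i)) ℤ.≟ entry r (suc (Fin.inject₁ {8} i))))

  -- Evaluating the action on `w` at the row `s` gives `a v = b v` for distinct integers `a` and
  -- `b`, where `v` is the value of `w`; hence `v` is zero.
  evaluate-other-row : ∀ r {w} → ActsAs r w → ∀ s → r ≢ s → evaluate s w ≡ 0ℤ
  evaluate-other-row r {w} acts s r≢s = let i , ne = rows-differ r s r≢s in go i ne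
    where
    go : ∀ i → entry s (suc (Fin.inject₁ i)) ≢ entry r (suc (Fin.inject₁ i)) → evaluate s w ≡ 0ℤ
    go i ne = [ (λ z → contradiction (ℤ.i-j≡0⇒i≡j _ _ z) ne) , (λ z → z) ]′
      (ℤ.i*j≡0⇒i≡0∨j≡0 (a ℤ.- b) (trans (ℤ.*-distribʳ-+ v a (ℤ.- b))
        (trans (cong (λ t → t ℤ.+ ℤ.- b ℤ.* v) agree) (trans (sym (ℤ.*-distribʳ-+ v b (ℤ.- b)))
          (cong (ℤ._* v) (ℤ.+-inverseʳ b))))))
      where
      a b v : ℤ
      a = entry s (suc (Fin.inject₁ i))
      b = entry r (suc (Fin.inject₁ i))
      v = evaluate s w

      agree : a ℤ.* v ≡ b ℤ.* v
      agree = trans (cong (ℤ._* v) (sym (rowMeasure-values s (suc (Fin.inject₁ i)))))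
        (trans (evaluate-≈ᴵ s (acts i)) (cong (ℤ._* v) (evaluate-ι s b)))

  evaluation-surjective : (t : Fin 37 → ℤ) → ∃ λ P → ∀ s → evaluation P s ≡ t s
  evaluation-surjective t = finish (go decomposed)
    where
    finish : (∃ λ P → ∀ s → evaluate s P ≡ t s ℤ.* 1ℤ) → ∃ λ P → ∀ s → evaluation P s ≡ t s
    finish (P , e) = P , λ s → trans (e s) (ℤ.*-identityʳ (t s))

    -- The factor `evaluate s w` lets the claim pass to sums, whatever a summand evaluates to at its
    -- own row. At `w = 1#` the factor is 1.
    go : ∀ {w} → Decomposed w → ∃ λ P → ∀ s → evaluate s P ≡ t s ℤ.* evaluate s w
    go {w} (row r acts) = con (t r) ⊗ w , λ s → only s (r Fin.≟ s)
      where
      only : ∀ s → Dec (r ≡ s) → t r ℤ.* evaluate s w ≡ t s ℤ.* evaluate s w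
      only s (yes refl) = refl
      only s (no ne) = trans (vanish (t r)) (sym (vanish (t s)))
        where
        vanish : ∀ n → n ℤ.* evaluate s w ≡ 0ℤ
        vanish n = trans (cong (n ℤ.*_) (evaluate-other-row r acts s ne)) (ℤ.*-zeroʳ n)
    go {w} (plus {u} {v} p q f) = combine (go p) (go q)
      where
      combine : (∃ λ P → ∀ s → evaluate s P ≡ t s ℤ.* evaluate s u) →
                (∃ λ Q → ∀ s → evaluate s Q ≡ t s ℤ.* evaluate s v) →
                ∃ λ P → ∀ s → evaluate s P ≡ t s ℤ.* evaluate s w
      combine (P , e) (Q , g) = P ⊕ Q , λ s → trans (cong₂ ℤ._+_ (e s) (g s)) (trans
        (sym (ℤ.*-distribˡ-+ (t s) (evaluate s u) (evaluate s v)))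
        (cong (t s ℤ.*_) (sym (evaluate-≈ᴵ s f))))

  evaluation-isomorphism :
    RingMorphisms.IsRingIsomorphism (CommutativeRing.rawRing Θ) (CommutativeRing.rawRing (ℤ^ 37)) evaluation
  evaluation-isomorphism = record
    { isRingMonomorphism = record
      { isRingHomomorphism = record
        { isSemiringHomomorphism = record
          { isNearSemiringHomomorphism = record
            { +-isMonoidHomomorphism = record
              { isMagmaHomomorphism = record
                { isRelHomomorphism = record { cong = λ e r → evaluate-≈ᴵ r e }
                ; homo              = λ _ _ _ → refl
                }
              ; ε-homo = λ _ → refl
              }
            ; *-homo = λ _ _ _ → refl
            }
          ; 1#-homo = λ _ → refl
          }
        ; -‿homo = λ _ _ → refl
        }
      ; injective = evaluation-injective
      }
    ; surjective = λ t → finish t (evaluation-surjective t)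
    }
    where
    finish : (t : Fin 37 → ℤ) → (∃ λ P → ∀ s → evaluation P s ≡ t s) →
             ∃ λ P → ∀ {Q} → Q ≈ P → ∀ s → evaluation Q s ≡ t s
    finish t (P , e) = P , λ f s → trans (evaluate-≈ᴵ s f) (e s)

theorem1p1 : Σ[ μ ∈ (Fin 37 → Measure ℤ-ring) ]
    (∀ r → HasValues (μ r) (lookup valueTable r))
    × (∀ r (ν : Measure ℤ-ring) → HasValues ν (lookup valueTable r) →
    ∀ {Y X} (i : Embedding Y X) → Measure.value ν i ≡ Measure.value (μ r) i)
    × (Σ[ φ ∈ (CommutativeRing.Carrier Θ → CommutativeRing.Carrier (ℤ^ 37)) ]
    RingMorphisms.IsRingIsomorphism
    (CommutativeRing.rawRing Θ) (CommutativeRing.rawRing (ℤ^ 37)) φ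
    × (∀ {Y X} (i : Embedding Y X) r → φ [ i ] r ≡ Measure.value (μ r) i))
theorem1p1 = rowMeasure , rowMeasure-values , (λ r ν h i → rowMeasure-unique r ν h i) ,
  evaluation , evaluation-isomorphism , λ i r → refl
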